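{- Let $\mathbf{P}$ be a nondegenerate polar space of rank $d \ge 3$ in a vector space $V$ over $\mathbb{F}_q$, with collinearity graph $\Gamma_0$. Let $U$ be (the set of points of) a totally isotropic (maximal singular) $d$-space, let $\mathcal{H}$ be the set of hyperplanes of $U$, let $\mathbf{D}$ be a symmetric design on the point set $U$ with the parameters $2$-$\big(\frac{q^{d}-1}{q-1}, \frac{q^{d-1}-1}{q-1}, \frac{q^{d-2}-1}{q-1}\big)$, and let $\phi$ be a bijection from $\mathcal{H}$ to the set of blocks of $\mathbf{D}$. Then the graph $\Gamma_\phi$ is strongly regular with the same parameters as $\Gamma_0$.
   Context: The polar spaces considered are the finite nondegenerate polar spaces consisting of the totally isotropic (or totally singular) points and lines of a finite-dimensional vector space $V$ over $\mathbb{F}_q$ with respect to a nondegenerate symplectic, quadratic or hermitian form. Two points are collinear when they lie on a common totally isotropic/singular line; $x^\perp$ is the set of points collinear with $x$, including $x$ itself. A singular subspace is a line-closed set of pairwise collinear points; the rank $d$ is the vector space dimension of the maximal singular subspaces. The collinearity graph $\Gamma_0$ has the point set $P$ of $\mathbf{P}$ as vertices, distinct points being adjacent when collinear. Subspaces are identified with their sets of projective points, and "hyperplane of $U$" means $(d-1)$-dimensional subspace of $U$. For $y \in P\setminus U$ the set $y^\perp\cap U$ is a hyperplane of $U$. The image of $H$ under $\phi$ is written $H^\phi$, a block of $\mathbf{D}$, viewed as a subset of $U$. The graph $\Gamma_\phi$ has vertex set $P$, with adjacency as follows: (1) distinct vertices in $U$ are adjacent; (2) distinct vertices $x,y \notin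 U$ are adjacent if and only if $x \in y^\perp$; (3) vertices $x \in U$, $y \notin U$ are adjacent if and only if $x \in (y^\perp \cap U)^\phi$. A graph of order $v$ is strongly regular with parameters $(v,k,\lambda,\mu)$ if it is neither complete nor edgeless, each vertex has degree $k$, any two adjacent vertices have exactly $\lambda$ common neighbors, and any two distinct non-adjacent vertices have exactly $\mu$ common neighbors. -}

module Defs where

open import Level using (Level; _⊔_)
open import Algebra.Bundles using (CommutativeRing)
open import Algebra.Module.Bundles using (LeftModule)
open import Algebra.Morphism.Structures using (module RingMorphisms)
import Algebra.Properties.Monoid.Sum as MonoidSum
open import Data.Empty using (⊥-elim)
open import Data.Fin.Base using (Fin; zero)
open import Data.Nat.Base as ℕ using (ℕ; zero; suc; NonZero; _∸_; _^_)
import Data.Nat.DivMod as ℕ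
open import Data.Product.Base using (Σ; ∃; _×_; _,_; proj₁; proj₂)
open import Data.Sum.Base using (_⊎_; inj₁; inj₂)
open import Data.Vec.Functional using (Vector)
open import Function.Base using (id)
open import Function.Bundles using (Inverse; Bijection)
open import Relation.Binary.Bundles using (Setoid)
open import Relation.Binary.Core using (Rel)
open import Relation.Binary.Definitions using (Symmetric; Irreflexive; _Respects_; _Respects₂_)
import Relation.Binary.Construct.On as On
open import Relation.Binary.PropositionalEquality.Core as ≡ using (_≡_)
import Relation.Binary.PropositionalEquality.Properties as ≡
open import Relation.Nullary.Negation.Core using (¬_)
open import Relation.Unary using (Pred; Decidable; _⊆_; _≐_; _∩_)

private variable
  a b c e i m p ℓ ℓm ℓb : Level

-- Quotients (projective points, subspaces, ...) are setoids, so a cardinality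
-- counts equivalence classes.

Subsetoid : (S : Setoid a ℓ) → Pred (Setoid.Carrier S) p → Setoid (a ⊔ p) ℓ
Subsetoid S P = On.setoid S (proj₁ {B = P})

HasCard : Setoid a ℓ → ℕ → Set (a ⊔ ℓ)
HasCard S n = Inverse S (≡.setoid (Fin n))

record Graph a ℓ e : Set (Level.suc (a ⊔ ℓ ⊔ e)) where
  infix 4 _~_
  field
    vertices : Setoid a ℓ
  open Setoid vertices public
    using (_≈_; _≉_) renaming (Carrier to Vertex)
  field
    _~_      : Rel Vertex e
    ~-resp-≈ : _~_ Respects₂ _≈_
    ~-sym    : Symmetric _~_
    ~-irrefl : Irreflexive _≈_ _~_

record IsStronglyRegular (G : Graph a ℓ e) (v k λ' μ : ℕ) : Set (a ⊔ ℓ ⊔ e) where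
  open Graph G
  field
    order       : HasCard vertices v
    notComplete : ¬ (∀ x y → x ≉ y → x ~ y)
    notEdgeless : ¬ (∀ x y → ¬ (x ~ y))
    degree      : ∀ x → HasCard (Subsetoid vertices (x ~_)) k
    adjacent    : ∀ x y → x ~ y →
                  HasCard (Subsetoid vertices ((x ~_) ∩ (y ~_))) λ'
    nonadjacent : ∀ x y → x ≉ y → ¬ (x ~ y) →
                  HasCard (Subsetoid vertices ((x ~_) ∩ (y ~_))) μ

-- A symmetric 2-(v, k, λ) design on the set X.  By `extensional`, a block is
-- the same thing as the set of points incident with it.
record SymmetricDesign (X : Setoid a ℓ) (v k λ' : ℕ) b ℓb i
       : Set (a ⊔ ℓ ⊔ Level.suc (b ⊔ ℓb ⊔ i)) where
  infix 4 _∈ᴮ_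
  open Setoid X using () renaming (Carrier to Pt; _≈_ to _≈ₓ_)
  field
    Blocks : Setoid b ℓb
  open Setoid Blocks using () renaming (Carrier to Block; _≈_ to _≈ᴮ_)
  field
    _∈ᴮ_        : Pt → Block → Set i
    ∈ᴮ-respˡ    : ∀ {B} → (_∈ᴮ B) Respects _≈ₓ_
    ∈ᴮ-respʳ    : ∀ {x} → (x ∈ᴮ_) Respects _≈ᴮ_
    extensional : ∀ {B C} → (_∈ᴮ B) ≐ (_∈ᴮ C) → B ≈ᴮ C
    pointCount  : HasCard X v
    blockCount  : HasCard Blocks v
    blockSize   : ∀ B → HasCard (Subsetoid X (_∈ᴮ B)) k
    pairCount   : ∀ x y → ¬ (x ≈ₓ y) →
                  HasCard (Subsetoid Blocks ((x ∈ᴮ_) ∩ (y ∈ᴮ_))) λ'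

record FiniteField c ℓ : Set (Level.suc (c ⊔ ℓ)) where
  field
    commutativeRing : CommutativeRing c ℓ
  open CommutativeRing commutativeRing public
  field
    0≉1      : 0# ≉ 1#
    inverse  : ∀ x → x ≉ 0# → ∃ λ y → x * y ≈ 1#
    q        : ℕ
    hasCard  : HasCard setoid q

  q-1≢0 : NonZero (q ∸ 1)
  q-1≢0 = go q hasCard
    where
    go : ∀ n → HasCard setoid n → NonZero (n ∸ 1)
    go zero h with () ← Inverse.to h 0#
    go (suc zero) h = ⊥-elim (0≉1 (trans (sym (Inverse.strictlyInverseʳ h 0#))
      (trans (Inverse.from-cong h (one (Inverse.to h 0#) (Inverse.to h 1#)))
             (Inverse.strictlyInverseʳ h 1#))))
      where
      one : (x y : Fin 1) → x ≡ y
      one zero zero = ≡.refl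
    go (suc (suc n)) h = _

  -- (qⁿ - 1) / (q - 1); the division is exact.
  θ : ℕ → ℕ
  θ n = ℕ._/_ (q ^ n ∸ 1) (q ∸ 1) {{q-1≢0}}

module LinearAlgebra (F : FiniteField c ℓ) (V : LeftModule (FiniteField.ring F) m ℓm) where
  open FiniteField F
  open LeftModule V
  open MonoidSum +ᴹ-monoid using (sum)

  combination : ∀ {n} → Vector Carrier n → Vector Carrierᴹ n → Carrierᴹ
  combination a v = sum (λ i → a i *ₗ v i)

  LinearlyIndependent : ∀ {n} → Vector Carrierᴹ n → Set (c ⊔ ℓ ⊔ ℓm)
  LinearlyIndependent v = ∀ a → combination a v ≈ᴹ 0ᴹ → ∀ i → a i ≈ 0#

  -- A k-dimensional subspace is given by a basis; subspaces are always
  -- compared through their sets of vectors ⟦_⟧.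
  Subspace : ℕ → Set (c ⊔ ℓ ⊔ m ⊔ ℓm)
  Subspace k = Σ (Vector Carrierᴹ k) LinearlyIndependent

  ⟦_⟧ : ∀ {k} → Subspace k → Pred Carrierᴹ (c ⊔ ℓm)
  ⟦ v , _ ⟧ x = ∃ λ a → combination a v ≈ᴹ x

  infix 4 _≤ₛ_

  _≤ₛ_ : ∀ {j k} → Subspace j → Subspace k → Set (c ⊔ m ⊔ ℓm)
  W ≤ₛ X = ⟦ W ⟧ ⊆ ⟦ X ⟧

  subspaces : ℕ → Setoid (c ⊔ ℓ ⊔ m ⊔ ℓm) (c ⊔ m ⊔ ℓm)
  subspaces k = record
    { Carrier       = Subspace k
    ; _≈_           = λ W X → ⟦ W ⟧ ≐ ⟦ X ⟧
    ; isEquivalence = record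
      { refl  = id , id
      ; sym   = λ (f , g) → g , f
      ; trans = λ (f , g) (f′ , g′) → (λ x → f′ (f x)) , (λ x → g (g′ x))
      }
    }

  hyperplanes : ∀ {k} → Subspace k → Setoid (c ⊔ ℓ ⊔ m ⊔ ℓm) (c ⊔ m ⊔ ℓm)
  hyperplanes {k} W = Subsetoid (subspaces (k ∸ 1)) (_≤ₛ W)

  FiniteDimensional : Set (c ⊔ ℓ ⊔ m ⊔ ℓm)
  FiniteDimensional = ∃ λ n → Σ (Subspace n) λ W → ∀ x → ⟦ W ⟧ x

  record IsSesquilinear (σ : Carrier → Carrier) (B : Carrierᴹ → Carrierᴹ → Carrier)
         : Set (c ⊔ ℓ ⊔ m ⊔ ℓm) where
    field
      cong      : ∀ {x x′ y y′} → x ≈ᴹ x′ → y ≈ᴹ y′ → B x y ≈ B x′ y′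
      additiveˡ : ∀ x y z → B (x +ᴹ y) z ≈ B x z + B y z
      additiveʳ : ∀ x y z → B x (y +ᴹ z) ≈ B x y + B x z
      scalarˡ   : ∀ a x y → B (a *ₗ x) y ≈ a * B x y
      scalarʳ   : ∀ a x y → B x (a *ₗ y) ≈ σ a * B x y

  IsBilinear : (Carrierᴹ → Carrierᴹ → Carrier) → Set (c ⊔ ℓ ⊔ m ⊔ ℓm)
  IsBilinear = IsSesquilinear id

  record SymplecticForm : Set (c ⊔ ℓ ⊔ m ⊔ ℓm) where
    field
      B             : Carrierᴹ → Carrierᴹ → Carrier
      bilinear      : IsBilinear B
      alternating   : ∀ x → B x x ≈ 0#
      nondegenerate : ∀ x → (∀ y → B x y ≈ 0#) → x ≈ᴹ 0ᴹ

  -- Nondegenerate means that Q has no nonzero zero in the radical of its polar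
  -- form.  In characteristic 2 and odd dimension that radical is never zero, so
  -- asking for a zero radical would exclude the parabolic quadrics.
  record QuadraticForm : Set (c ⊔ ℓ ⊔ m ⊔ ℓm) where
    field
      Q    : Carrierᴹ → Carrier
      cong : ∀ {x y} → x ≈ᴹ y → Q x ≈ Q y
    polar : Carrierᴹ → Carrierᴹ → Carrier
    polar x y = Q (x +ᴹ y) - Q x - Q y
    field
      homogeneous   : ∀ a x → Q (a *ₗ x) ≈ (a * a) * Q x
      bilinear      : IsBilinear polar
      nondegenerate : ∀ x → Q x ≈ 0# → (∀ y → polar x y ≈ 0#) → x ≈ᴹ 0ᴹ

  record HermitianForm : Set (c ⊔ ℓ ⊔ m ⊔ ℓm) where
    open RingMorphisms rawRing rawRing using (IsRingHomomorphism)
    field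
      σ             : Carrier → Carrier
      homomorphism  : IsRingHomomorphism σ
      involutive    : ∀ a → σ (σ a) ≈ a
      nontrivial    : ¬ (∀ a → σ a ≈ a)
      B             : Carrierᴹ → Carrierᴹ → Carrier
      sesquilinear  : IsSesquilinear σ B
      hermitian     : ∀ x y → B y x ≈ σ (B x y)
      nondegenerate : ∀ x → (∀ y → B x y ≈ 0#) → x ≈ᴹ 0ᴹ

  data Form : Set (c ⊔ ℓ ⊔ m ⊔ ℓm) where
    symplectic : SymplecticForm → Form
    quadratic  : QuadraticForm → Form
    hermitian  : HermitianForm → Form

  -- Totally isotropic, respectively (quadratic case) totally singular.
  TotallyIsotropic : Form → ∀ {k} → Subspace k → Set (c ⊔ ℓ ⊔ m ⊔ ℓm)
  TotallyIsotropic (symplectic f) W = ∀ x y → ⟦ W ⟧ x → ⟦ W ⟧ y → SymplecticForm.B f x y ≈ 0#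
  TotallyIsotropic (quadratic f)  W = ∀ x → ⟦ W ⟧ x → QuadraticForm.Q f x ≈ 0#
  TotallyIsotropic (hermitian f)  W = ∀ x y → ⟦ W ⟧ x → ⟦ W ⟧ y → HermitianForm.B f x y ≈ 0#

record PolarSpace c ℓ m ℓm : Set (Level.suc (c ⊔ ℓ ⊔ m ⊔ ℓm)) where
  field
    field′            : FiniteField c ℓ
    space             : LeftModule (FiniteField.ring field′) m ℓm
  open LinearAlgebra field′ space
  field
    finiteDimensional : FiniteDimensional
    form              : Form

module Geometry (𝐏 : PolarSpace c ℓ m ℓm) where
  open PolarSpace 𝐏
  open FiniteField field′ public using (q; θ)
  open LinearAlgebra field′ space hiding (TotallyIsotropic) public

  L E : Level
  L = c ⊔ ℓ ⊔ m ⊔ ℓm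
  E = c ⊔ m ⊔ ℓm

  TotallyIsotropic : ∀ {k} → Subspace k → Set L
  TotallyIsotropic = LinearAlgebra.TotallyIsotropic field′ space form

  points : Setoid L E
  points = Subsetoid (subspaces 1) TotallyIsotropic

  open Setoid points using (_≈_; _≉_) renaming (Carrier to Point)
  module Pt = Setoid points

  infix 4 _on_

  _on_ : ∀ {k} → Point → Subspace k → Set E
  x on W = proj₁ x ≤ₛ W

  Collinear : Rel Point L
  Collinear x y = Σ (Subspace 2) λ ℒ → TotallyIsotropic ℒ × x on ℒ × y on ℒ

  _⊥ : Point → Pred Point L
  (x ⊥) y = y ≈ x ⊎ Collinear y x

  -- A set of points of the (finite) polar space is a decidable predicate
  -- respecting equality of points.
  record IsSingular (S : Pred Point E) : Set L where
    field
      decidable  : Decidable S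
      respects   : S Respects _≈_
      pairwise   : ∀ {x y} → S x → S y → (y ⊥) x
      lineClosed : ∀ {x y} → S x → S y → x ≉ y →
                   (ℒ : Subspace 2) → TotallyIsotropic ℒ → x on ℒ → y on ℒ →
                   ∀ {z} → z on ℒ → S z

  IsMaximalSingular : Pred Point E → Set (Level.suc E ⊔ L)
  IsMaximalSingular S = IsSingular S × (∀ T → IsSingular T → S ⊆ T → T ⊆ S)

  HasRank : ℕ → Set (Level.suc E ⊔ L)
  HasRank d = ∀ S → IsMaximalSingular S →
              Σ (Subspace d) λ W → TotallyIsotropic W × S ≐ (_on W)

  pointsOn : ∀ {k} → Subspace k → Setoid L E
  pointsOn W = Subsetoid points (_on W)

  on-resp : ∀ {k} (W : Subspace k) → (_on W) Respects _≈_
  on-resp W (_ , g) x⊆W y = x⊆W (g y)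

  collinear-sym : Symmetric Collinear
  collinear-sym (ℒ , t , x , y) = ℒ , t , y , x

  collinear-respˡ : ∀ {y} → (λ x → Collinear x y) Respects _≈_
  collinear-respˡ x≈x′ (ℒ , t , x , y) = ℒ , t , (λ v → x (proj₂ x≈x′ v)) , y

  ⊥-sym : ∀ {x y} → (x ⊥) y → (y ⊥) x
  ⊥-sym {x} {y} (inj₁ y≈x) = inj₁ (Pt.sym {y} {x} y≈x)
  ⊥-sym {x} {y} (inj₂ c)     = inj₂ (collinear-sym {y} {x} c)

  ⊥-resp : ∀ {x} → (x ⊥) Respects _≈_
  ⊥-resp {x} {y} {y′} e (inj₁ y≈x) =
    inj₁ (Pt.trans {y′} {y} {x} (Pt.sym {y} {y′} e) y≈x)
  ⊥-resp {x} {y} {y′} e (inj₂ c) =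
    inj₂ (collinear-respˡ {x} {y} {y′} e c)

  ⊥-respˡ : ∀ {x x′} → x ≈ x′ → (x ⊥) ⊆ (x′ ⊥)
  ⊥-respˡ {x} {x′} e {y} p = ⊥-sym {y} {x′} (⊥-resp {y} {x} {x′} e (⊥-sym {x} {y} p))

  ≉-sym : Symmetric _≉_
  ≉-sym {x} {y} x≉y y≈x = x≉y (Pt.sym {y} {x} y≈x)

  ≉-respʳ : ∀ {x} → (x ≉_) Respects _≈_
  ≉-respʳ {x} {y} {y′} e x≉y x≈y′ =
    x≉y (Pt.trans {x} {y′} {y} x≈y′ (Pt.sym {y} {y′} e))

  symmetricResp : ∀ {e} {R : Rel Point e} → Symmetric R →
                  (∀ {x} → (R x) Respects _≈_) → R Respects₂ _≈_
  symmetricResp s r =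
    (λ {x} {y} {z} → r {x} {y} {z}) ,
    (λ {y} {x} {z} e p → s {y} {z} (r {y} {x} {z} e (s {x} {y} p)))

  Γ₀ : Graph L E L
  Γ₀ = record
    { vertices = points
    ; _~_      = Adj
    ; ~-resp-≈ = symmetricResp {R = Adj} (λ {x} {y} → adj-sym {x} {y})
                               (λ {x} {y} {z} → adj-resp {x} {y} {z})
    ; ~-sym    = λ {x} {y} → adj-sym {x} {y}
    ; ~-irrefl = λ x≈y (x≉y , _) → x≉y x≈y
    }
    where
    Adj : Rel Point L
    Adj x y = x ≉ y × Collinear x y

    adj-sym : Symmetric Adj
    adj-sym {x} {y} (n , c) = ≉-sym {x} {y} n , collinear-sym {x} {y} c

    adj-resp : ∀ {x} → (Adj x) Respects _≈_
    adj-resp {x} {y} {z} e (n , c) =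
      ≉-respʳ {x} {y} {z} e n ,
      collinear-sym {z} {x} (collinear-respˡ {x} {y} {z} e (collinear-sym {x} {y} c))

  module Deformation
    {d : ℕ} (U : Subspace d) {v k λ' : ℕ}
    (𝐃 : SymmetricDesign (pointsOn U) v k λ' b ℓb i)
    (φ : Bijection (hyperplanes U) (SymmetricDesign.Blocks 𝐃))
    where
    open SymmetricDesign 𝐃
    open Setoid (hyperplanes U) using () renaming (Carrier to Hyperplane)

    -- x ∈ (y⊥ ∩ U)^φ for x ∈ U and y ∉ U.  The hyperplane H is the one whose
    -- set of points is y⊥ ∩ U; hyperplanes being compared by their vectors,
    -- H is determined up to equality.
    Cross : Rel Point (L ⊔ i)
    Cross x y = Σ (x on U) λ x∈U → ¬ (y on U) ×
      Σ Hyperplane λ H →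
        (_on proj₁ H) ≐ ((_on U) ∩ (y ⊥)) × (x , x∈U) ∈ᴮ Bijection.to φ H

    data Adj (x y : Point) : Set (L ⊔ i) where
      inside  : x on U → y on U → x ≉ y → Adj x y
      outside : ¬ (x on U) → ¬ (y on U) → x ≉ y → (y ⊥) x → Adj x y
      cross   : Cross x y → Adj x y
      cross′  : Cross y x → Adj x y

    Γφ : Graph L E (L ⊔ i)
    Γφ = record
      { vertices = points
      ; _~_      = Adj
      ; ~-resp-≈ = symmetricResp {R = Adj} (λ {x} {y} → adj-sym {x} {y})
                                 (λ {x} {y} {z} → adj-resp {x} {y} {z})
      ; ~-sym    = λ {x} {y} → adj-sym {x} {y}
      ; ~-irrefl = λ {x} {y} → adj-irrefl {x} {y}
      }
      where
      adj-sym : Symmetric Adj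
      adj-sym {x} {y} (inside p r n)    = inside r p (≉-sym {x} {y} n)
      adj-sym {x} {y} (outside p r n c) = outside r p (≉-sym {x} {y} n) (⊥-sym {y} {x} c)
      adj-sym (cross p)         = cross′ p
      adj-sym (cross′ p)        = cross p

      off-resp : ∀ {y z : Point} → y ≈ z → ¬ (y on U) → ¬ (z on U)
      off-resp {y} {z} e n p = n (on-resp U {z} {y} (Pt.sym {y} {z} e) p)

      adj-resp : ∀ {x} → (Adj x) Respects _≈_
      adj-resp {x} {y} {z} e (inside p r n) =
        inside p (on-resp U {y} {z} e r) (≉-respʳ {x} {y} {z} e n)
      adj-resp {x} {y} {z} e (outside p r n c) =
        outside p (off-resp {y} {z} e r) (≉-respʳ {x} {y} {z} e n)
                (⊥-respˡ {y} {z} e {x} c)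
      adj-resp {x} {y} {z} e (cross (p , r , H , (f , g) , h)) =
        cross (p , off-resp {y} {z} e r , H ,
          ((λ {w} w∈H → proj₁ (f {w} w∈H) , ⊥-respˡ {y} {z} e {w} (proj₂ (f {w} w∈H))) ,
           (λ {w} (w∈U , w⊥z) →
             g {w} (w∈U , ⊥-respˡ {z} {y} (Pt.sym {y} {z} e) {w} w⊥z))) ,
          h)
      adj-resp {x} {y} {z} e (cross′ (p , r , H , s , h)) =
        cross′ (on-resp U {y} {z} e p , r , H , s , ∈ᴮ-respˡ e h)

      adj-irrefl : Irreflexive _≈_ Adj
      adj-irrefl e (inside _ _ n) = n e
      adj-irrefl e (outside _ _ n _) = n e
      adj-irrefl {x} {y} e (cross (p , r , _)) = r (on-resp U {x} {y} e p)
      adj-irrefl {x} {y} e (cross′ (p , r , _)) =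
        r (on-resp U {y} {x} (Pt.sym {x} {y} e) p)

{-# OPTIONS --safe #-}

-- Count vectors instead of points; a point has q - 1 of them.  If v is singular,
-- every affine line y + ⟨v⟩ with y not orthogonal to v contains the same number s
-- of singular vectors.  Averaging over the translations by v therefore turns a
-- count of singular vectors into a count of solutions of independent linear
-- equations, and this gives the parameters of Γ₀.
--
-- A singular vector z induces the functional B(_, z) on U, which is zero only if
-- z ∈ U.  By the same averaging each nonzero functional is induced equally often,
-- and, for y ∉ U, each functional not proportional to that of y is induced
-- equally often by vectors of y⊥.  Hence the degrees and the numbers of common
-- neighbours of Γφ depend on the incidence of points and blocks only through the
-- block size, the number of blocks on a point, the number of blocks on two points
-- and the size of the intersection of two blocks.  These numbers are the same for
-- 𝐃 as for the hyperplanes of U, where Γφ is Γ₀.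

module Submission where

open import Algebra.Bundles using (CommutativeMonoid)
open import Algebra.Module.Bundles using (LeftModule)
import Algebra.Properties.AbelianGroup as AbelianGroupProperties
import Algebra.Properties.CommutativeMonoid.Sum as CommutativeMonoidSum
import Algebra.Properties.Monoid.Sum as MonoidSum
import Algebra.Properties.Ring as RingProperties
import Algebra.Properties.Semiring.Sum as SemiringSum
open import Data.Bool.Base using (if_then_else_)
open import Data.Empty using (⊥-elim)
open import Data.Fin.Base as Fin using (Fin; zero; suc)
import Data.Fin.Properties as Fin
open import Data.List.Base as List using (List)
import Data.List.Relation.Unary.All as All
import Data.List.Relation.Unary.AllPairs as AllPairs
import Data.List.Relation.Unary.Any as Any
import Data.List.Relation.Unary.Any.Properties as Any
open import Data.List.Relation.Unary.Enumerates.Setoid using (IsEnumeration)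
open import Data.List.Relation.Unary.Enumerates.Setoid.Properties using (deduplicate⁺)
open import Data.List.Relation.Unary.Unique.DecSetoid.Properties using (deduplicate-!)
open import Data.Nat.Base as ℕ using (ℕ; zero; suc; _+_; _*_; _^_; _∸_; NonZero; z≤n; s≤s; ∣_-_∣; _≤_)
import Data.Nat.DivMod as ℕ
import Data.Nat.Properties as ℕ
open import Data.Nat.Solver using (module +-*-Solver)
open import Data.Product.Base using (Σ; ∃; _×_; _,_; proj₁; proj₂)
open import Data.Sum.Base using (inj₁; inj₂)
open import Data.Unit.Base using (⊤; tt)
open import Data.Vec.Functional as Vector using (Vector; []; _∷_)
import Data.Vec.Functional.Properties as Vector
open import Function.Base using (_∘_; id)
open import Function.Bundles using (Inverse; Bijection)
open import Level using (Level; _⊔_)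
open import Relation.Binary.Bundles using (Setoid; DecSetoid)
open import Relation.Binary.Core using (Rel)
import Relation.Binary.Definitions as B
open import Relation.Binary.Definitions using (_Respects_; _Respects₂_)
open import Relation.Binary.PropositionalEquality as ≡ using (_≡_; _≢_; module ≡-Reasoning)
import Relation.Binary.Reasoning.Setoid as SetoidReasoning
open import Relation.Nullary using (Dec; yes; no; does; ¬_; contradiction; ¬?; _×-dec_; map′; decidable-stable)
import Relation.Unary as U
open import Relation.Unary using (Pred; _∩_; _≐_)
open import Defs

-- No parameter is computed explicitly. Each count for `Γ₀` satisfies an equation with coefficients
-- built from q, `s`, the number of vectors and the number of singular vectors, so it does not
-- depend on the points chosen; this stands in for the transitivity of the isometry group.
--
-- A design prescribes the number of blocks on two points, but two vertices outside U ask for the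
-- points on two blocks; that number comes from a variance argument. The delicate pair is x in U, y
-- outside. The vectors of y⊥ whose functional is a multiple of that of y escape the averaging, but
-- on them incidence with x has one constant value, so their number may stay unknown: it is the same
-- on both sides. All that then remains of the design is whether x and y are adjacent. Hence the
-- pair is compared not with itself in `Γ₀`, where its status may differ, but with a pair x′, y of
-- the same status.
--
-- Identities in ℕ keep sums on both sides and are cancelled, so truncated subtraction never
-- interferes. As everything is finite, existence proofs by contradiction are searches.

private variable
  c ℓ ℓ₁ ℓ₂ ℓ₃ m ℓm : Level
  𝒫 𝒬 : Set ℓ

-- Finite sums, indicators and cardinalities of setoids.

private module Sum = SemiringSum ℕ.+-*-semiring

sum-single : (M : CommutativeMonoid c ℓ) → let open CommutativeMonoid M in
             ∀ {n} (t : Fin n → Carrier) j → (∀ i → i ≢ j → t i ≈ ε) → MonoidSum.sum monoid t ≈ t j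
sum-single M {suc n} t j t≈ε = trans (sum-remove {i = j} t)
  (trans (∙-congˡ (trans (sum-cong-≋ (λ i → t≈ε _ (Fin.punchInᵢ≢i j i))) (sum-replicate-zero n))) (identityʳ _))
  where
  open CommutativeMonoid M
  open CommutativeMonoidSum M hiding (sum)

opaque
  𝟙 : Dec 𝒫 → ℕ
  𝟙 d = if does d then 1 else 0

opaque
  unfolding 𝟙

  𝟙-yes : (d : Dec 𝒫) → 𝒫 → 𝟙 d ≡ 1
  𝟙-yes (yes _) _ = ≡.refl
  𝟙-yes (no ¬a) x = contradiction x ¬a

  𝟙-no : (d : Dec 𝒫) → ¬ 𝒫 → 𝟙 d ≡ 0
  𝟙-no (yes x) ¬a = contradiction x ¬a
  𝟙-no (no _)  _  = ≡.refl

  𝟙-⇔ : (𝒫 → 𝒬) → (𝒬 → 𝒫) → (d : Dec 𝒫) (e : Dec 𝒬) → 𝟙 d ≡ 𝟙 e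
  𝟙-⇔ f g (yes x) e = ≡.sym (𝟙-yes e (f x))
  𝟙-⇔ f g (no ¬x) e = ≡.sym (𝟙-no e (¬x ∘ g))

  𝟙-¬ : (d : Dec 𝒫) → 𝟙 d + 𝟙 (¬? d) ≡ 1
  𝟙-¬ (yes _) = ≡.refl
  𝟙-¬ (no _)  = ≡.refl

  𝟙-≤ : (𝒫 → 𝒬) → (d : Dec 𝒫) (e : Dec 𝒬) → 𝟙 d ℕ.≤ 𝟙 e
  𝟙-≤ f (yes x) e = ℕ.≤-reflexive (≡.sym (𝟙-yes e (f x)))
  𝟙-≤ f (no _)  e = z≤n

  𝟙-idem : (d : Dec 𝒫) → 𝟙 d * 𝟙 d ≡ 𝟙 d
  𝟙-idem (yes _) = ≡.refl
  𝟙-idem (no _)  = ≡.refl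

  𝟙-× : (d : Dec 𝒫) (e : Dec 𝒬) → 𝟙 (d ×-dec e) ≡ 𝟙 d * 𝟙 e
  𝟙-× (yes _) (yes _) = ≡.refl
  𝟙-× (yes _) (no _)  = ≡.refl
  𝟙-× (no _)  _       = ≡.refl

  -- Where the indicator vanishes both sides are 0, so a fact that holds only under `𝒫` may be used
  -- inside a sum weighted by it.
  𝟙-guard : (d : Dec 𝒫) {m n : ℕ} → (𝒫 → m ≡ n) → 𝟙 d * m ≡ 𝟙 d * n
  𝟙-guard (yes x) eq = ≡.cong (_+ 0) (eq x)
  𝟙-guard (no _)  _  = ≡.refl

module _ {S : Setoid ℓ₁ ℓ} {N : ℕ} (h : HasCard S N) where
  open Setoid S
  open Inverse h using (to; from; to-cong; strictlyInverseʳ; strictlyInverseˡ)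

  opaque
    ∑ : (Carrier → ℕ) → ℕ
    ∑ f = Sum.sum (λ i → f (from i))

  card-≟ : B.Decidable _≈_
  card-≟ x y = map′ (λ e → trans (sym (strictlyInverseʳ x)) (trans (reflexive (≡.cong from e)) (strictlyInverseʳ y)))
                    to-cong (to x Fin.≟ to y)

  -- Exhaustive search along the enumeration. Together with `decidable-stable` it justifies the
  -- later existence proofs by contradiction.
  card-∃? : {P : Carrier → Set ℓ₂} → P B.Respects _≈_ → U.Decidable P → Dec (∃ P)
  card-∃? resp P? = map′ (λ (i , pi) → from i , pi)
                         (λ (x , px) → to x , resp (sym (strictlyInverseʳ x)) px)
                         (Fin.any? (P? ∘ from))

  opaque
    unfolding ∑

    ∑-cong : {f g : Carrier → ℕ} → (∀ x → f x ≡ g x) → ∑ f ≡ ∑ g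
    ∑-cong e = Sum.sum-cong-≗ (e ∘ from)

    ∑-+ : (f g : Carrier → ℕ) → ∑ (λ x → f x + g x) ≡ ∑ f + ∑ g
    ∑-+ f g = Sum.∑-distrib-+ (f ∘ from) (g ∘ from)

    ∑-*ˡ : (n : ℕ) (f : Carrier → ℕ) → ∑ (λ x → n * f x) ≡ n * ∑ f
    ∑-*ˡ n f = ≡.sym (Sum.*-distribˡ-sum n (f ∘ from))

    ∑-*ʳ : (f : Carrier → ℕ) (n : ℕ) → ∑ (λ x → f x * n) ≡ ∑ f * n
    ∑-*ʳ f n = ≡.sym (Sum.*-distribʳ-sum n (f ∘ from))

    ∑-const : (n : ℕ) → ∑ (λ _ → n) ≡ N * n
    ∑-const n = ≡.trans (Sum.sum-replicate N) (×≡* N)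
      where
      open import Algebra.Definitions.RawMonoid ℕ.+-0-rawMonoid using () renaming (_×_ to _×ₙ_)
      ×≡* : ∀ m → m ×ₙ n ≡ m * n
      ×≡* zero    = ≡.refl
      ×≡* (suc m) = ≡.cong (n +_) (×≡* m)

  ∑-zero : {f : Carrier → ℕ} → (∀ x → f x ≡ 0) → ∑ f ≡ 0
  ∑-zero e = ≡.trans (∑-cong e) (≡.trans (∑-const 0) (ℕ.*-zeroʳ N))

  opaque
    unfolding ∑

    ∑-point : ∀ x₀ {P : Carrier → Set ℓ₂} (P? : U.Decidable P) →
              (∀ {x} → P x → x ≈ x₀) → (∀ {x} → x ≈ x₀ → P x) →
              (f : Carrier → ℕ) → (∀ {x y} → x ≈ y → f x ≡ f y) →
              ∑ (λ x → 𝟙 (P? x) * f x) ≡ f x₀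
    ∑-point x₀ P? P⇒ P⇐ f f-cong = ≡.trans (sum-single ℕ.+-0-commutativeMonoid (λ i → 𝟙 (P? (from i)) * f (from i))
        (to x₀) off)
        (≡.trans (≡.cong (_* f (from (to x₀))) (𝟙-yes (P? _) (P⇐ (strictlyInverseʳ x₀))))
          (≡.trans (ℕ.+-identityʳ _) (f-cong (strictlyInverseʳ x₀))))
      where
      off : ∀ i → i ≢ to x₀ → 𝟙 (P? (from i)) * f (from i) ≡ 0
      off i ne = ≡.cong (_* f (from i)) (𝟙-no (P? _) λ pi →
        ne (≡.trans (≡.sym (strictlyInverseˡ i)) (to-cong (P⇒ pi))))

  ∑-unique : ∀ x₀ {P : Carrier → Set ℓ₂} (P? : U.Decidable P) →
             (∀ {x} → P x → x ≈ x₀) → (∀ {x} → x ≈ x₀ → P x) → ∑ (λ x → 𝟙 (P? x)) ≡ 1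
  ∑-unique x₀ P? P⇒ P⇐ = ≡.trans (∑-cong (λ x → ≡.sym (ℕ.*-identityʳ _))) (∑-point x₀ P? P⇒ P⇐ (λ _ → 1) (λ _ → ≡.refl))

  opaque
    unfolding ∑

    -- A strict inequality at one term would separate the totals. With `f` constantly 0 it says that
    -- a vanishing sum has vanishing terms; for indicators it turns an inclusion between sets of
    -- equal size into an equality.
    ∑-≤-≡ : {f g : Carrier → ℕ} → (∀ {x y} → x ≈ y → f x ≡ f y) → (∀ {x y} → x ≈ y → g x ≡ g y) →
            (∀ x → f x ℕ.≤ g x) → ∑ f ≡ ∑ g → ∀ x → f x ≡ g x
    ∑-≤-≡ f-cong g-cong f≤g eq x = ≡.trans (f-cong (sym (strictlyInverseʳ x)))
      (≡.trans (go (f≤g ∘ from) eq (to x)) (g-cong (strictlyInverseʳ x)))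
      where
      mono : ∀ {n} {s t : Fin n → ℕ} → (∀ i → s i ℕ.≤ t i) → Sum.sum s ℕ.≤ Sum.sum t
      mono {zero}  _ = z≤n
      mono {suc n} s≤t = ℕ.+-mono-≤ (s≤t zero) (mono (s≤t ∘ suc))

      head≡ : ∀ {a b c d} → a ℕ.≤ b → c ℕ.≤ d → a + c ≡ b + d → a ≡ b
      head≡ {a} {b} {c} {d} a≤b c≤d e = ℕ.≤-antisym a≤b
        (ℕ.+-cancelʳ-≤ d b a (ℕ.≤-trans (ℕ.≤-reflexive (≡.sym e)) (ℕ.+-monoʳ-≤ a c≤d)))

      go : ∀ {n} {s t : Fin n → ℕ} → (∀ i → s i ℕ.≤ t i) → Sum.sum s ≡ Sum.sum t → ∀ i → s i ≡ t i
      go {suc n} s≤t e zero    = head≡ (s≤t zero) (mono (s≤t ∘ suc)) e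
      go {suc n} {s} {t} s≤t e (suc i) = go (s≤t ∘ suc)
        (ℕ.+-cancelˡ-≡ (t zero) _ _
          (≡.trans (≡.cong (_+ Sum.sum (s ∘ suc)) (≡.sym (head≡ (s≤t zero) (mono (s≤t ∘ suc)) e))) e)) i

  ∑-split : {P : Carrier → Set ℓ₂} (P? : U.Decidable P) (f : Carrier → ℕ) →
            ∑ f ≡ ∑ (λ x → 𝟙 (P? x) * f x) + ∑ (λ x → 𝟙 (¬? (P? x)) * f x)
  ∑-split P? f = ≡.trans (∑-cong λ x → ≡.trans (≡.sym (ℕ.*-identityˡ (f x)))
      (≡.trans (≡.cong (_* f x) (≡.sym (𝟙-¬ (P? x)))) (ℕ.*-distribʳ-+ (f x) (𝟙 (P? x)) _)))
    (∑-+ _ _)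

module _ {S : Setoid ℓ₃ ℓ₁} {N : ℕ} (h : HasCard S N) {T : Setoid c ℓ₂} {M : ℕ} (k : HasCard T M) where
  private
    module S = Setoid S
    module T = Setoid T

  opaque
    unfolding ∑

    ∑-swap : (f : S.Carrier → T.Carrier → ℕ) →
             ∑ h (λ x → ∑ k (λ y → f x y)) ≡ ∑ k (λ y → ∑ h (λ x → f x y))
    ∑-swap f = Sum.∑-comm (λ i j → f (Inverse.from h i) (Inverse.from k j))

  -- Each value of `f` is spread over the graph of `π`, which is then summed in the other order. The
  -- two implications together say that `π` and `π⁻` are mutually inverse.
  ∑-reindex : (π : S.Carrier → T.Carrier) (π⁻ : T.Carrier → S.Carrier) →
              (∀ {x y} → x S.≈ π⁻ y → π x T.≈ y) → (∀ {x y} → π x T.≈ y → x S.≈ π⁻ y) →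
              {f : T.Carrier → ℕ} → (∀ {x y} → x T.≈ y → f x ≡ f y) →
              ∑ h (f ∘ π) ≡ ∑ k f
  ∑-reindex π π⁻ l r {f} f-cong = begin
    ∑ h (f ∘ π) ≡⟨ ∑-cong h (λ x → ≡.sym (∑-point k (π x) (λ y → card-≟ k (π x) y) T.sym T.sym f f-cong)) ⟩
    ∑ h (λ x → ∑ k (λ y → 𝟙 (card-≟ k (π x) y) * f y)) ≡⟨ ∑-swap _ ⟩
    ∑ k (λ y → ∑ h (λ x → 𝟙 (card-≟ k (π x) y) * f y)) ≡⟨ ∑-cong k (λ y → ∑-point h (π⁻ y) (λ x → card-≟ k (π x) y) r l
        (λ _ → f y) (λ _ → ≡.refl)) ⟩
    ∑ k f                                             ∎
    where open ≡-Reasoning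

-- Double counting of the relation `R`. This is the passage from vectors to projective objects: `S`
-- consists of vectors, `T` of points or blocks, and `w` is the number of vectors belonging to one
-- of them.
∑-classes : {S : Setoid ℓ₃ ℓ₁} {N : ℕ} (h : HasCard S N) {T : Setoid c ℓ₂} {m : ℕ} (k : HasCard T m)
            {R : Setoid.Carrier S → Setoid.Carrier T → Set ℓ} (R? : ∀ x y → Dec (R x y))
            (f : Setoid.Carrier S → ℕ) (w : ℕ) →
            (∀ x → f x ≡ ∑ k (λ y → 𝟙 (R? x y))) → (∀ y → ∑ h (λ x → 𝟙 (R? x y)) ≡ w) →
            ∑ h f ≡ m * w
∑-classes h {m = m} k R? f w rows cols =
  ≡.trans (∑-cong h rows) (≡.trans (∑-swap h k _) (≡.trans (∑-cong k cols) (∑-const k w)))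

-- A list with repetitions is enough: duplicates are removed by the decidable equality, and the
-- position in the remaining list is the bijection.
finite : (S : Setoid ℓ₁ ℓ) → B.Decidable (Setoid._≈_ S) → (xs : List (Setoid.Carrier S)) →
         IsEnumeration S xs → ∃ λ m → HasCard S m
finite S _≟_ xs enum = List.length ys , record
  { to = λ x → Any.index (enum′ x)
  ; from = List.lookup ys
  ; to-cong = λ {x} {y} x≈y → unique uniq _ _
      (trans (sym (Any.lookup-index (enum′ x))) (trans x≈y (Any.lookup-index (enum′ y))))
  ; from-cong = λ { ≡.refl → refl }
  ; inverse = (λ { {x} {y} y≈ → unique uniq _ _ (trans (sym (Any.lookup-index (enum′ y))) y≈) })
            , (λ { {x} ≡.refl → sym (Any.lookup-index (enum′ x)) })
  }
  where
  open Setoid S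
  DS : DecSetoid _ _
  DS = record { isDecEquivalence = record { isEquivalence = isEquivalence ; _≟_ = _≟_ } }
  ys : List Carrier
  ys = List.deduplicate _≟_ xs
  enum′ : IsEnumeration S ys
  enum′ = deduplicate⁺ DS enum
  uniq = deduplicate-! DS xs
  at : ∀ {P : Carrier → Set _} {zs} → All.All P zs → ∀ j → P (List.lookup zs j)
  at (pz All.∷ _)  zero    = pz
  at (_ All.∷ pzs) (suc j) = at pzs j
  unique : ∀ {zs} → AllPairs.AllPairs _≉_ zs → ∀ i j → List.lookup zs i ≈ List.lookup zs j → i ≡ j
  unique (_ AllPairs.∷ _)  zero    zero    _ = ≡.refl
  unique (z≉ AllPairs.∷ _) zero    (suc j) e = contradiction e (at z≉ j)
  unique (z≉ AllPairs.∷ _) (suc i) zero    e = contradiction (sym e) (at z≉ i)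
  unique (_ AllPairs.∷ u)  (suc i) (suc j) e = ≡.cong suc (unique u i j e)

-- The sum 1 + q + ... + qⁿ⁻¹ with q written as `suc p`, so that neither subtraction nor division
-- occurs.
geometric : ℕ → ℕ → ℕ
geometric p zero    = 0
geometric p (suc n) = suc p * geometric p n + 1

geometric-sum : ∀ p n → geometric p n * p + 1 ≡ suc p ^ n
geometric-sum p zero    = ≡.refl
geometric-sum p (suc n) = ≡.trans (solve 2 (λ p g → ((con 1 :+ p) :* g :+ con 1) :* p :+ con 1 := (con 1 :+ p) :*
    (g :* p :+ con 1)) ≡.refl p (geometric p n))
                                  (≡.cong (suc p *_) (geometric-sum p n))
  where open +-*-Solver

-- Finite fields, coordinate spaces and one-dimensional subspaces.

module FieldProperties (F : FiniteField c ℓ) where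
  module F = FiniteField F
  open F using (Carrier; _≈_; _≉_; 0#; q; θ)

  infix 4 _≟_
  _≟_ : B.Decidable _≈_
  _≟_ = card-≟ F.hasCard

  opaque
    q∸1 : ℕ
    q∸1 = q ∸ 1

    instance
      q∸1-nonZero : NonZero q∸1
      q∸1-nonZero = F.q-1≢0

    q≡1+q∸1 : q ≡ suc q∸1
    q≡1+q∸1 = suc-pred q F.q-1≢0
      where
      suc-pred : ∀ n → NonZero (n ∸ 1) → n ≡ suc (n ∸ 1)
      suc-pred (suc n) _ = ≡.refl

    -- The shape in which `θ` is always used: the zero vector, and q - 1 nonzero vectors for each of
    -- the `θ n` points.
    q^ : ∀ n → q ^ n ≡ θ n * q∸1 + 1
    q^ n = ≡.trans q^≡ (≡.cong (λ t → t * q∸1 + 1) (≡.sym θ≡))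
      where
      q^≡ : q ^ n ≡ geometric q∸1 n * q∸1 + 1
      q^≡ = ≡.trans (≡.cong (_^ n) q≡1+q∸1) (≡.sym (geometric-sum q∸1 n))
      θ≡ : θ n ≡ geometric q∸1 n
      θ≡ = ≡.trans (≡.cong (λ t → ℕ._/_ (t ∸ 1) q∸1 {{F.q-1≢0}}) q^≡)
             (≡.trans (≡.cong (λ t → ℕ._/_ t q∸1 {{F.q-1≢0}}) (ℕ.m+n∸n≡m (geometric q∸1 n * q∸1) 1))
               (ℕ.m*n/n≡m (geometric q∸1 n) q∸1 {{F.q-1≢0}}))

  q-nonZero : NonZero q
  q-nonZero = ≡.subst NonZero (≡.sym q≡1+q∸1) _

  _⁻¹ : ∀ {x} → x ≉ 0# → Carrier
  x≉0 ⁻¹ = proj₁ (F.inverse _ x≉0)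

  cancel-*ʳ : ∀ {x} → x ≉ 0# → ∀ {y z} → y F.* x ≈ z F.* x → y ≈ z
  cancel-*ʳ {x} x≉0 {y} {z} e = begin
    y                  ≈⟨ unit y ⟨
    (y F.* x) F.* x≉0 ⁻¹ ≈⟨ F.*-congʳ e ⟩
    (z F.* x) F.* x≉0 ⁻¹ ≈⟨ unit z ⟩
    z                  ∎
    where
    open SetoidReasoning F.setoid
    unit : ∀ y → (y F.* x) F.* x≉0 ⁻¹ ≈ y
    unit y = F.trans (F.*-assoc _ _ _) (F.trans (F.*-congˡ (proj₂ (F.inverse x x≉0))) (F.*-identityʳ y))

  div-*ʳ : ∀ {x} (x≉0 : x ≉ 0#) y → (y F.* x≉0 ⁻¹) F.* x ≈ y
  div-*ʳ {x} x≉0 y = F.trans (F.*-assoc _ _ _) (F.trans (F.*-congˡ (F.trans (F.*-comm _ _) (proj₂ (F.inverse x x≉0))))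
      (F.*-identityʳ y))

  *-≉0 : ∀ {x y} → x ≉ 0# → y ≉ 0# → x F.* y ≉ 0#
  *-≉0 x≉0 y≉0 e = x≉0 (cancel-*ʳ y≉0 (F.trans e (F.sym (F.zeroˡ _))))

  Fⁿ : ℕ → LeftModule F.ring c ℓ
  Fⁿ n = record
    { Carrierᴹ = Vector Carrier n
    ; _≈ᴹ_ = λ x y → ∀ i → x i ≈ y i
    ; _+ᴹ_ = λ x y i → x i F.+ y i
    ; _*ₗ_ = λ a x i → a F.* x i
    ; 0ᴹ = λ _ → 0#
    ; -ᴹ_ = λ x i → F.- x i
    ; isLeftModule = record
      { isLeftSemimodule = record
        { +ᴹ-isCommutativeMonoid = isCommutativeMonoid F.+-isCommutativeMonoid
        ; isPreleftSemimodule = record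
          { *ₗ-cong = λ a≈b x≈y i → F.*-cong a≈b (x≈y i)
          ; *ₗ-zeroˡ = λ x i → F.zeroˡ (x i)
          ; *ₗ-distribʳ = λ x a b i → F.distribʳ (x i) a b
          ; *ₗ-identityˡ = λ x i → F.*-identityˡ (x i)
          ; *ₗ-assoc = λ a b x i → F.*-assoc a b (x i)
          ; *ₗ-zeroʳ = λ a i → F.zeroʳ a
          ; *ₗ-distribˡ = λ a x y i → F.distribˡ a (x i) (y i)
          }
        }
      ; -ᴹ‿cong = λ x≈y i → F.-‿cong (x≈y i)
      ; -ᴹ‿inverse = (λ x i → F.-‿inverseˡ (x i)) , (λ x i → F.-‿inverseʳ (x i))
      }
    }
    where open import Algebra.Construct.Pointwise (Fin n)

  Fⁿ-card : ∀ n → HasCard (LeftModule.≈ᴹ-setoid (Fⁿ n)) (q ^ n)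
  Fⁿ-card n = record
    { to = λ x → Fin.funToFin (to ∘ x)
    ; from = λ i → from ∘ Fin.finToFun i
    ; to-cong = λ x≈y → funToFin-cong (λ i → to-cong (x≈y i))
    ; from-cong = λ { ≡.refl i → F.refl }
    ; inverse = (λ {x} {y} y≈ → ≡.trans (funToFin-cong (λ i → ≡.trans (to-cong (y≈ i)) (strictlyInverseˡ _)))
                                         (Fin.funToFin-finToFin {n} x))
              , (λ { {x} ≡.refl i → F.trans (F.reflexive (≡.cong from (Fin.finToFun-funToFin (to ∘ x) i)))
                  (strictlyInverseʳ (x i)) })
    }
    where
    open Inverse F.hasCard
    funToFin-cong : ∀ {m} {f g : Fin m → Fin q} → (∀ i → f i ≡ g i) → Fin.funToFin f ≡ Fin.funToFin g
    funToFin-cong {zero}  _ = ≡.refl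
    funToFin-cong {suc m} e = ≡.cong₂ Fin.combine (e zero) (funToFin-cong (e ∘ suc))

module FiniteModule (F : FiniteField c ℓ) (M : LeftModule (FiniteField.ring F) m ℓm)
                    {N : ℕ} (h : HasCard (LeftModule.≈ᴹ-setoid M) N) where
  open FieldProperties F public
  open LeftModule M public
  open AbelianGroupProperties +ᴹ-abelianGroup public
    using () renaming (xyx⁻¹≈y to +ᴹ-xyx⁻¹≈y; //-rightDividesʳ to +ᴹ-cancelʳ′; //-rightDividesˡ to +ᴹ-divʳ)

  infix 4 _≟ᴹ_ _∈⟨_⟩ _∈⟨_⟩?
  _≟ᴹ_ : B.Decidable _≈ᴹ_
  _≟ᴹ_ = card-≟ h

  ∑-translate : ∀ u {f : Carrierᴹ → ℕ} → (∀ {x y} → x ≈ᴹ y → f x ≡ f y) →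
                ∑ h (λ z → f (z +ᴹ u)) ≡ ∑ h f
  ∑-translate u = ∑-reindex h h (_+ᴹ u) (λ z → z +ᴹ -ᴹ u)
    (λ e → ≈ᴹ-trans (+ᴹ-cong e ≈ᴹ-refl) (+ᴹ-divʳ u _))
    (λ e → ≈ᴹ-trans (≈ᴹ-sym (+ᴹ-cancelʳ′ u _)) (+ᴹ-cong e ≈ᴹ-refl))

  -- Average over the lines in direction u: on the u-invariant weight c, every
  -- line contributes s to g.
  ∑-fibration : ∀ u {c g : Carrierᴹ → ℕ} s →
                (∀ {x y} → x ≈ᴹ y → c x ≡ c y) → (∀ {x y} → x ≈ᴹ y → g x ≡ g y) →
                (∀ a z → c (z +ᴹ a *ₗ u) ≡ c z) →
                (∀ z → c z * ∑ F.hasCard (λ a → g (z +ᴹ a *ₗ u)) ≡ c z * s) →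
                F.q * ∑ h (λ z → c z * g z) ≡ s * ∑ h c
  ∑-fibration u {c} {g} s c-cong g-cong inv line = begin
    -- The sum is taken q times, once for each translation by `a *ₗ u`; this sweeps out the lines
    -- without choosing representatives of them.
    F.q * ∑ h (λ z → c z * g z)                                                   ≡⟨ ∑-const F.hasCard _ ⟨
    ∑ F.hasCard (λ a → ∑ h (λ z → c z * g z)) ≡⟨ ∑-cong F.hasCard
        (λ a → ∑-translate (a *ₗ u) (λ e → ≡.cong₂ _*_ (c-cong e) (g-cong e))) ⟨
    ∑ F.hasCard (λ a → ∑ h (λ z → c (z +ᴹ a *ₗ u) * g (z +ᴹ a *ₗ u))) ≡⟨ ∑-cong F.hasCard
        (λ a → ∑-cong h (λ z → ≡.cong (_* g (z +ᴹ a *ₗ u)) (inv a z))) ⟩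
    ∑ F.hasCard (λ a → ∑ h (λ z → c z * g (z +ᴹ a *ₗ u)))                          ≡⟨ ∑-swap F.hasCard h _ ⟩
    ∑ h (λ z → ∑ F.hasCard (λ a → c z * g (z +ᴹ a *ₗ u))) ≡⟨ ∑-cong h (λ z → ≡.trans (∑-*ˡ F.hasCard (c z) _)
        (≡.trans (line z) (ℕ.*-comm (c z) s))) ⟩
    ∑ h (λ z → s * c z)                                                           ≡⟨ ∑-*ˡ h s c ⟩
    s * ∑ h c                                                                     ∎
    where open ≡-Reasoning

  _∈⟨_⟩ : Carrierᴹ → Carrierᴹ → Set _
  z ∈⟨ v ⟩ = ∃ λ a → z ≈ᴹ a *ₗ v

  _∈⟨_⟩? : ∀ z v → Dec (z ∈⟨ v ⟩)
  z ∈⟨ v ⟩? = card-∃? F.hasCard (λ a≈b e → ≈ᴹ-trans e (*ₗ-cong a≈b ≈ᴹ-refl)) (λ a → z ≟ᴹ (a *ₗ v))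

  0∈⟨_⟩ : ∀ v → 0ᴹ ∈⟨ v ⟩
  0∈⟨ v ⟩ = F.0# , ≈ᴹ-sym (*ₗ-zeroˡ v)

  v∈⟨v⟩ : ∀ v → v ∈⟨ v ⟩
  v∈⟨v⟩ v = F.1# , ≈ᴹ-sym (*ₗ-identityˡ v)

  *ₗ-cancel : ∀ {a v} → a F.≉ F.0# → a *ₗ v ≈ᴹ 0ᴹ → v ≈ᴹ 0ᴹ
  *ₗ-cancel {a} {v} a≉0 e = ≈ᴹ-trans (≈ᴹ-sym (*ₗ-identityˡ v))
    (≈ᴹ-trans (*ₗ-cong (F.sym (F.trans (F.*-comm _ _) (proj₂ (F.inverse a a≉0)))) ≈ᴹ-refl)
    (≈ᴹ-trans (*ₗ-assoc _ a v) (≈ᴹ-trans (*ₗ-cong F.refl e) (*ₗ-zeroʳ _))))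

  ∈⟨⟩-sym : ∀ {v w} → ¬ (v ≈ᴹ 0ᴹ) → v ∈⟨ w ⟩ → w ∈⟨ v ⟩
  ∈⟨⟩-sym {v} {w} v≉0 (a , e) = a≉0 ⁻¹ , (begin
    w                        ≈⟨ *ₗ-identityˡ w ⟨
    F.1# *ₗ w                ≈⟨ *ₗ-cong (F.trans (F.*-comm _ _) (proj₂ (F.inverse a a≉0))) ≈ᴹ-refl ⟨
    (a≉0 ⁻¹ F.* a) *ₗ w      ≈⟨ *ₗ-assoc _ a w ⟩
    a≉0 ⁻¹ *ₗ (a *ₗ w)       ≈⟨ *ₗ-cong F.refl e ⟨
    a≉0 ⁻¹ *ₗ v              ∎)
    where
    open SetoidReasoning ≈ᴹ-setoid
    a≉0 : a F.≉ F.0#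
    a≉0 a≈0 = v≉0 (≈ᴹ-trans e (≈ᴹ-trans (*ₗ-cong a≈0 ≈ᴹ-refl) (*ₗ-zeroˡ w)))

  ∈⟨⟩-trans : ∀ {u v w} → u ∈⟨ v ⟩ → v ∈⟨ w ⟩ → u ∈⟨ w ⟩
  ∈⟨⟩-trans {w = w} (a , e) (b , f) = a F.* b , ≈ᴹ-trans e (≈ᴹ-trans (*ₗ-cong F.refl f) (≈ᴹ-sym (*ₗ-assoc a b w)))

  ∈⟨⟩-resp : ∀ {u u′ v v′} → u ≈ᴹ u′ → v ≈ᴹ v′ → u ∈⟨ v ⟩ → u′ ∈⟨ v′ ⟩
  ∈⟨⟩-resp u≈ v≈ (a , e) = a , ≈ᴹ-trans (≈ᴹ-sym u≈) (≈ᴹ-trans e (*ₗ-cong F.refl v≈))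

  *ₗ-injective : ∀ {v} → ¬ (v ≈ᴹ 0ᴹ) → ∀ {a b} → a *ₗ v ≈ᴹ b *ₗ v → a F.≈ b
  *ₗ-injective {v} v≉0 {a} {b} e with (a F.- b) ≟ F.0#
  ... | yes a-b≈0 = RingProperties.x∙y⁻¹≈ε⇒x≈y F.ring a b a-b≈0
  ... | no  a-b≉0 = contradiction (*ₗ-cancel a-b≉0
        (≈ᴹ-trans (*ₗ-distribʳ v a _) (≈ᴹ-trans (+ᴹ-cong e ≈ᴹ-refl)
          (≈ᴹ-trans (≈ᴹ-sym (*ₗ-distribʳ v b _)) (≈ᴹ-trans (*ₗ-cong (F.-‿inverseʳ b) ≈ᴹ-refl) (*ₗ-zeroˡ v)))))) v≉0

  ∑-⟨⟩ : ∀ {v} → ¬ (v ≈ᴹ 0ᴹ) → ∑ h (λ z → 𝟙 (z ∈⟨ v ⟩?)) ≡ F.q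
  ∑-⟨⟩ {v} v≉0 = ≡.trans (∑-classes h F.hasCard (λ z a → z ≟ᴹ (a *ₗ v)) _ 1 row
                    (λ a → ∑-unique h (a *ₗ v) (λ z → z ≟ᴹ (a *ₗ v)) id id)) (ℕ.*-identityʳ F.q)
    where
    row : ∀ z → 𝟙 (z ∈⟨ v ⟩?) ≡ ∑ F.hasCard (λ a → 𝟙 (z ≟ᴹ (a *ₗ v)))
    row z with z ∈⟨ v ⟩?
    ... | yes (a , e) = ≡.trans (𝟙-yes (yes (a , e)) (a , e)) (≡.sym (∑-unique F.hasCard a (λ b → z ≟ᴹ (b *ₗ v))
            (λ f → *ₗ-injective v≉0 (≈ᴹ-trans (≈ᴹ-sym f) e)) (λ b≈a → ≈ᴹ-trans e (*ₗ-cong (F.sym b≈a) ≈ᴹ-refl))))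
    ... | no ¬e = ≡.trans (𝟙-no (no ¬e) ¬e) (≡.sym (∑-zero F.hasCard (λ a → 𝟙-no (z ≟ᴹ (a *ₗ v)) (λ e → ¬e (a , e)))))

  ∑-0 : {f : Carrierᴹ → ℕ} → (∀ {x y} → x ≈ᴹ y → f x ≡ f y) →
        ∑ h f ≡ f 0ᴹ + ∑ h (λ z → 𝟙 (¬? (z ≟ᴹ 0ᴹ)) * f z)
  ∑-0 {f} f-cong = ≡.trans (∑-split h (_≟ᴹ 0ᴹ) f) (≡.cong (_+ ∑ h (λ z → 𝟙 (¬? (z ≟ᴹ 0ᴹ)) * f z))
      (∑-point h 0ᴹ (_≟ᴹ 0ᴹ) id id f f-cong))

  ∑-⟨⟩≉0 : ∀ {v} → ¬ (v ≈ᴹ 0ᴹ) → ∑ h (λ z → 𝟙 (¬? (z ≟ᴹ 0ᴹ)) * 𝟙 (z ∈⟨ v ⟩?)) ≡ q∸1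
  ∑-⟨⟩≉0 {v} v≉0 = ℕ.suc-injective (≡.trans (≡.sym (≡.trans
    (∑-0 (λ {x} {y} e → 𝟙-⇔ (∈⟨⟩-resp e ≈ᴹ-refl) (∈⟨⟩-resp (≈ᴹ-sym e) ≈ᴹ-refl) (x ∈⟨ v ⟩?) (y ∈⟨ v ⟩?)))
    (≡.cong (_+ ∑ h (λ z → 𝟙 (¬? (z ≟ᴹ 0ᴹ)) * 𝟙 (z ∈⟨ v ⟩?))) (𝟙-yes (0ᴹ ∈⟨ v ⟩?) 0∈⟨ v ⟩))))
        (≡.trans (∑-⟨⟩ v≉0) q≡1+q∸1))

-- Linear equations given by a sesquilinear form.

module SesquilinearForm
  (F : FiniteField c ℓ) (M : LeftModule (FiniteField.ring F) m ℓm)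
  {N : ℕ} (h : HasCard (LeftModule.≈ᴹ-setoid M) N)
  (σ : FiniteField.Carrier F → FiniteField.Carrier F)
  (σ-cong : ∀ {x y} → FiniteField._≈_ F x y → FiniteField._≈_ F (σ x) (σ y))
  (σ-involutive : ∀ x → FiniteField._≈_ F (σ (σ x)) x)
  (B : LeftModule.Carrierᴹ M → LeftModule.Carrierᴹ M → FiniteField.Carrier F)
  (sesquilinear : LinearAlgebra.IsSesquilinear F M σ B)
  where

  open FiniteModule F M h
  open F using (Carrier; _≈_; 0#; 1#)
  open LinearAlgebra F M using (combination)
  open LinearAlgebra.IsSesquilinear sesquilinear public renaming (cong to B-cong)
  private module R = RingProperties F.ring
  open SemiringSum F.semiring using (sum; sum-cong-≋; ∑-distrib-+; sum-replicate-zero)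
  open SetoidReasoning F.setoid

  zeroˡ : ∀ y → B 0ᴹ y ≈ 0#
  zeroˡ y = R.x+x≈x⇒x≈0 _ (F.trans (F.sym (additiveˡ 0ᴹ 0ᴹ y)) (B-cong (+ᴹ-identityˡ 0ᴹ) ≈ᴹ-refl))

  zeroʳ : ∀ x → B x 0ᴹ ≈ 0#
  zeroʳ x = R.x+x≈x⇒x≈0 _ (F.trans (F.sym (additiveʳ x 0ᴹ 0ᴹ)) (B-cong ≈ᴹ-refl (+ᴹ-identityˡ 0ᴹ)))

  negʳ : ∀ x y → B x (-ᴹ y) ≈ F.- B x y
  negʳ x y = R.+-inverseˡ-unique _ _ (F.trans (F.sym (additiveʳ x (-ᴹ y) y)) (F.trans (B-cong ≈ᴹ-refl (-ᴹ‿inverseˡ y))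
      (zeroʳ x)))

  combinationˡ : ∀ {n} (a : Vector Carrier n) t y → B (combination a t) y ≈ sum (λ i → a i F.* B (t i) y)
  combinationˡ {zero}  a t y = zeroˡ y
  combinationˡ {suc n} a t y = F.trans (additiveˡ _ _ y) (F.+-cong (scalarˡ _ _ y) (combinationˡ (a ∘ suc) (t ∘ suc) y))

  combinationʳ : ∀ {n} (a : Vector Carrier n) t x → B x (combination a t) ≈ sum (λ i → σ (a i) F.* B x (t i))
  combinationʳ {zero}  a t x = zeroʳ x
  combinationʳ {suc n} a t x = F.trans (additiveʳ x _ _) (F.+-cong (scalarʳ _ x _) (combinationʳ (a ∘ suc) (t ∘ suc) x))

  -- Independence of the functionals `B (t i) _`. It is asked of `t` and not of `B`, because the
  -- polar form of a quadratic form in characteristic 2 can have a radical.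
  Nondegenerate : ∀ {n} → Vector Carrierᴹ n → Set _
  Nondegenerate t = ∀ a → (∀ z → B (combination a t) z ≈ 0#) → ∀ i → a i ≈ 0#

  tail-nondegenerate : ∀ {n} {t : Vector Carrierᴹ (suc n)} → Nondegenerate t → Nondegenerate (t ∘ suc)
  tail-nondegenerate nd a a⊥ i = nd (0# Vector.∷ a)
      (λ z → F.trans (B-cong (≈ᴹ-trans (+ᴹ-cong (*ₗ-zeroˡ _) ≈ᴹ-refl) (+ᴹ-identityˡ _)) ≈ᴹ-refl) (a⊥ z)) (suc i)

  -- Induction on the number of equations. A vector killed by all functionals but the first corrects
  -- the first equation and leaves the others alone; if there is none, the first functional depends
  -- on the others.
  solvable : ∀ {n} (t : Vector Carrierᴹ n) → Nondegenerate t → (b : Vector Carrier n) → ∃ λ z → ∀ i → B (t i) z ≈ b i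
  solvable {zero}  t nd b = 0ᴹ , λ ()
  solvable {suc n} t nd b with card-∃? h
      (λ {x} {y} x≈y (p , q) → (λ i → F.trans (B-cong ≈ᴹ-refl (≈ᴹ-sym x≈y)) (p i)) , λ e → q
          (F.trans (B-cong ≈ᴹ-refl x≈y) e))
      (λ w → Fin.all? (λ i → B (t (suc i)) w ≟ 0#) ×-dec ¬? (B (t zero) w ≟ 0#))
  ... | yes (w , w⊥ , t₀w≉0) = z +ᴹ α *ₗ w , λ
      { zero → begin
          B (t zero) (z +ᴹ α *ₗ w)                   ≈⟨ F.trans (additiveʳ _ _ _) (F.+-congˡ (scalarʳ _ _ _)) ⟩
          B (t zero) z F.+ σ α F.* B (t zero) w      ≈⟨ F.+-congˡ (F.*-congʳ (σ-involutive _)) ⟩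
          B (t zero) z F.+ ((b zero F.- B (t zero) z) F.* t₀w≉0 ⁻¹) F.* B (t zero) w ≈⟨ F.+-congˡ (div-*ʳ t₀w≉0 _) ⟩
          B (t zero) z F.+ (b zero F.- B (t zero) z) ≈⟨ F.trans (F.sym (F.+-assoc _ _ _)) (R.xyx⁻¹≈y _ _) ⟩
          b zero                                     ∎
      ; (suc i) → begin
          B (t (suc i)) (z +ᴹ α *ₗ w)                   ≈⟨ F.trans (additiveʳ _ _ _) (F.+-congˡ (scalarʳ _ _ _)) ⟩
          B (t (suc i)) z F.+ σ α F.* B (t (suc i)) w ≈⟨ F.+-cong (proj₂ tail-solution i)
              (F.trans (F.*-congˡ (w⊥ i)) (F.zeroʳ _)) ⟩
          b (suc i) F.+ 0#                              ≈⟨ F.+-identityʳ _ ⟩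
          b (suc i)                                     ∎ }
    where
    tail-solution = solvable (t ∘ suc) (tail-nondegenerate {t = t} nd) (b ∘ suc)
    z = proj₁ tail-solution
    -- Scalars leave the second argument through `σ`, so the required factor is conjugated in
    -- advance.
    α = σ ((b zero F.- B (t zero) z) F.* t₀w≉0 ⁻¹)
  -- The first functional vanishes on the common kernel of the others. With `e` dual to them, it is
  -- the combination of them with coefficients `B (t zero) (e i)`, and `coeff` records this
  -- relation.
  ... | no none = contradiction (F.sym (nd coeff coeff⊥ zero)) F.0≉1
    where
    δ : Fin n → Fin n → Carrier
    δ i j = if does (i Fin.≟ j) then 1# else 0#
    δ-≢ : ∀ i j → i ≢ j → δ i j ≈ 0#
    δ-≢ i j i≢j with i Fin.≟ j
    ... | yes e = contradiction e i≢j
    ... | no _ = F.refl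
    δ-≡ : ∀ i → δ i i ≈ 1#
    δ-≡ i with i Fin.≟ i
    ... | yes _ = F.refl
    ... | no i≢i = contradiction ≡.refl i≢i
    dual = λ i → solvable (t ∘ suc) (tail-nondegenerate {t = t} nd) (δ i)
    e : Fin n → Carrierᴹ
    e i = proj₁ (dual i)
    coeff : Vector Carrier (suc n)
    coeff = 1# Vector.∷ (λ i → F.- B (t zero) (e i))

    module _ (z : Carrierᴹ) where
      -- The vector in the span of `e` on which the other functionals agree with `z`; hence
      -- `z +ᴹ -ᴹ k` lies in their common kernel, and the first functional vanishes there too.
      k : Carrierᴹ
      k = combination (λ i → σ (B (t (suc i)) z)) e

      k-values : ∀ j → B (t (suc j)) k ≈ B (t (suc j)) z
      k-values j = begin
        B (t (suc j)) k                                                     ≈⟨ combinationʳ _ e _ ⟩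
        sum (λ i → σ (σ (B (t (suc i)) z)) F.* B (t (suc j)) (e i))         ≈⟨ sum-single F.+-commutativeMonoid _ j
                (λ i i≢j → F.trans (F.*-congˡ (F.trans (proj₂ (dual i) j) (δ-≢ i j i≢j))) (F.zeroʳ _)) ⟩
        σ (σ (B (t (suc j)) z)) F.* B (t (suc j)) (e j) ≈⟨ F.*-cong (σ-involutive _)
            (F.trans (proj₂ (dual j) j) (δ-≡ j)) ⟩
        B (t (suc j)) z F.* 1#                                              ≈⟨ F.*-identityʳ _ ⟩
        B (t (suc j)) z                                                     ∎

      t₀-value : B (t zero) z ≈ B (t zero) k
      t₀-value = R.x∙y⁻¹≈ε⇒x≈y _ _ (F.trans (F.sym (diff (t zero))) (decidable-stable (B (t zero) (z +ᴹ -ᴹ k) ≟ 0#)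
          (λ ≉0 → none (z +ᴹ -ᴹ k , (λ j → F.trans (diff (t (suc j))) (F.trans (F.+-congˡ (F.-‿cong (k-values j)))
              (F.-‿inverseʳ _))) , ≉0))))
        where
        diff : ∀ x → B x (z +ᴹ -ᴹ k) ≈ B x z F.- B x k
        diff x = F.trans (additiveʳ x z (-ᴹ k)) (F.+-congˡ (negʳ x k))

      coeff⊥ : B (combination coeff t) z ≈ 0#
      coeff⊥ = begin
        B (combination coeff t) z                                                     ≈⟨ combinationˡ coeff t z ⟩
        1# F.* B (t zero) z F.+ sum (λ i → (F.- B (t zero) (e i)) F.* B (t (suc i)) z) ≈⟨ F.+-congʳ
            (F.trans (F.*-identityˡ _) (F.trans t₀-value (combinationʳ _ e _))) ⟩
        sum (λ i → σ (σ (B (t (suc i)) z)) F.* B (t zero) (e i)) F.+ sum (λ i → (F.- B (t zero) (e i)) F.* B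
            (t (suc i)) z) ≈⟨ ∑-distrib-+ (λ i → σ (σ (B (t (suc i)) z)) F.* B (t zero) (e i))
            (λ i → (F.- B (t zero) (e i)) F.* B (t (suc i)) z) ⟨
        sum (λ i → σ (σ (B (t (suc i)) z)) F.* B (t zero) (e i) F.+ (F.- B (t zero) (e i)) F.* B (t (suc i)) z)
            ≈⟨ sum-cong-≋ {n} (λ i →
           F.trans (F.+-cong (F.trans (F.*-congʳ (σ-involutive _)) (F.*-comm _ _)) (F.sym (R.-‿distribˡ-* _ _)))
               (F.-‿inverseʳ _)) ⟩
        sum {n} (λ i → 0#)                                                            ≈⟨ sum-replicate-zero n ⟩
        0#                                                                            ∎

  _≟ⁿ_ : ∀ {n} (x y : Vector Carrier n) → Dec (∀ i → x i ≈ y i)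
  x ≟ⁿ y = Fin.all? (λ i → x i ≟ y i)

  -- Translation by a solution for the difference of two right-hand sides matches their solution
  -- sets. So all `F.q ^ n` right-hand sides have equally many solutions, and every vector solves
  -- exactly one system.
  ∑-solutions : ∀ {n} (t : Vector Carrierᴹ n) → Nondegenerate t → (b : Vector Carrier n) →
                F.q ^ n * ∑ h (λ z → 𝟙 ((λ i → B (t i) z) ≟ⁿ b)) ≡ N
  ∑-solutions {n} t nd b = ≡.trans (≡.sym (∑-const k _)) (≡.trans (∑-cong k same)
    (≡.trans (∑-swap k h _) (≡.trans (∑-cong h (λ z → ∑-unique k (λ i → B (t i) z) (λ b′ → (λ i → B (t i) z) ≟ⁿ b′)
      (λ e i → F.sym (e i)) (λ e i → F.sym (e i)))) (≡.trans (∑-const h 1) (ℕ.*-identityʳ N)))))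
    where
    k = Fⁿ-card n
    f : Vector Carrier n → Carrierᴹ → ℕ
    f b′ z = 𝟙 ((λ i → B (t i) z) ≟ⁿ b′)
    f-cong : ∀ b′ {x y} → x ≈ᴹ y → f b′ x ≡ f b′ y
    f-cong b′ x≈y = 𝟙-⇔ (λ e i → F.trans (B-cong ≈ᴹ-refl (≈ᴹ-sym x≈y)) (e i)) (λ e i → F.trans (B-cong ≈ᴹ-refl x≈y)
        (e i)) _ _
    same : ∀ b′ → ∑ h (f b) ≡ ∑ h (f b′)
    same b′ = ≡.trans (≡.sym (∑-translate w (f-cong b))) (∑-cong h (λ z → 𝟙-⇔
        (λ e i → R.+-cancelʳ _ _ _ (F.trans (F.sym (shift z i)) (F.trans (e i) (F.sym (eq i)))))
        (λ e i → F.trans (shift z i) (F.trans (F.+-congʳ (e i)) (eq i))) _ _))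
      where
      solution = solvable t nd (λ i → b i F.- b′ i)
      w = proj₁ solution
      shift : ∀ z i → B (t i) (z +ᴹ w) ≈ B (t i) z F.+ (b i F.- b′ i)
      shift z i = F.trans (additiveʳ _ z w) (F.+-congˡ (proj₂ solution i))
      eq : ∀ i → b′ i F.+ (b i F.- b′ i) ≈ b i
      eq i = F.trans (F.sym (F.+-assoc _ _ _)) (R.xyx⁻¹≈y _ _)

  -- Along the line, `B x` is an affine function of `σ a` with the nonzero slope `B x u`.
  ∑-line : ∀ x u → ¬ (B x u ≈ 0#) → ∀ b z → ∑ F.hasCard (λ a → 𝟙 (B x (z +ᴹ a *ₗ u) ≟ b)) ≡ 1
  ∑-line x u xu≉0 b z = ∑-unique F.hasCard (σ β) (λ a → B x (z +ᴹ a *ₗ u) ≟ b)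
    (λ {a} e → F.trans (F.sym (σ-involutive a)) (σ-cong (cancel-*ʳ xu≉0 (F.trans (R.+-cancelˡ (B x z) _ _
      (F.trans (F.sym (expand a)) (F.trans e (F.sym eq)))) (F.sym (div-*ʳ xu≉0 _))))))
    (λ {a} a≈ → F.trans (expand a)
        (F.trans (F.+-congˡ (F.trans (F.*-congʳ (F.trans (σ-cong a≈) (σ-involutive β))) (div-*ʳ xu≉0 _))) eq))
    where
    β = (b F.- B x z) F.* xu≉0 ⁻¹
    expand : ∀ a → B x (z +ᴹ a *ₗ u) ≈ B x z F.+ σ a F.* B x u
    expand a = F.trans (additiveʳ _ _ _) (F.+-congˡ (scalarʳ _ _ _))
    eq : B x z F.+ (b F.- B x z) ≈ b
    eq = F.trans (F.sym (F.+-assoc _ _ _)) (R.xyx⁻¹≈y _ _)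

-- Symmetric designs in terms of vectors, and their block intersections.

square-diff : ∀ m n → m * m + n * n ≡ 2 * m * n + ∣ m - n ∣ * ∣ m - n ∣
square-diff m n with ℕ.≤-total m n
... | inj₁ m≤n with k , ≡.refl ← ℕ.m≤n⇒∃[o]m+o≡n m≤n =
  ≡.trans (solve 2 (λ m k → m :* m :+ (m :+ k) :* (m :+ k) := con 2 :* m :* (m :+ k) :+ k :* k) ≡.refl m k)
          (≡.cong (λ t → 2 * m * (m + k) + t * t) (≡.sym (ℕ.∣m-m+n∣≡n m k)))
  where open +-*-Solver
... | inj₂ n≤m with k , ≡.refl ← ℕ.m≤n⇒∃[o]m+o≡n n≤m =
  ≡.trans (solve 2 (λ n k → (n :+ k) :* (n :+ k) :+ n :* n := con 2 :* (n :+ k) :* n :+ k :* k) ≡.refl n k)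
          (≡.cong (λ t → 2 * (n + k) * n + t * t) (≡.sym (≡.trans (ℕ.∣-∣-comm (n + k) n) (ℕ.∣m-m+n∣≡n n k))))
  where open +-*-Solver

-- A symmetric design blown up to vectors: every point and every block is
-- replaced by its q - 1 nonzero representatives.
module VectorDesign (F : FiniteField c ℓ) (M : LeftModule (FiniteField.ring F) m ℓm)
                    {N : ℕ} (h : HasCard (LeftModule.≈ᴹ-setoid M) N) where
  open FiniteModule F M h

  infix 4 _∼_
  _∼_ : Carrierᴹ → Carrierᴹ → Set _
  x ∼ y = ¬ (x ≈ᴹ 0ᴹ) × x ∈⟨ y ⟩

  -- An incidence matrix whose rows and columns are both indexed by vectors of the same space.
  -- Idempotence makes the entries 0 or 1. The constants `k` and `l` are q - 1 times the block size
  -- and the number of blocks on two points.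
  record IsVectorDesign (k l : ℕ) (ρ : Carrierᴹ → Carrierᴹ → ℕ) : Set (c ⊔ m ⊔ ℓm) where
    field
      idem      : ∀ x f → ρ x f * ρ x f ≡ ρ x f
      ρ-cong    : ∀ {x y f g} → x ≈ᴹ y → f ≈ᴹ g → ρ x f ≡ ρ y g
      ρ-zeroˡ   : ∀ f → ρ 0ᴹ f ≡ 0
      ρ-zeroʳ   : ∀ x → ρ x 0ᴹ ≡ 0
      ρ-classˡ  : ∀ {x y} f → x ∼ y → ρ x f ≡ ρ y f
      ρ-classʳ  : ∀ {f g} x → f ∼ g → ρ x f ≡ ρ x g
      blockSize : ∀ {f} → ¬ (f ≈ᴹ 0ᴹ) → ∑ h (λ x → ρ x f) ≡ k
      pairCount : ∀ {x y} → ¬ (x ≈ᴹ 0ᴹ) → ¬ (y ∈⟨ x ⟩) → ∑ h (λ f → ρ x f * ρ y f) ≡ l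

  -- The two equations hold for N = qⁿ, k = qⁿ⁻¹ - 1 and l = qⁿ⁻² - 1, written without subtraction.
  module _ {k l ρ} (D : IsVectorDesign k l ρ) {{_ : NonZero l}}
           (k≡ : k ≡ suc q∸1 * l + q∸1) (N≡ : N ≡ suc q∸1 * k + suc q∸1) where
    open IsVectorDesign D
    open ≡-Reasoning
    open +-*-Solver using (solve; con; _:+_; _:*_; _:=_)

    private
      P : ℕ
      P = q∸1

      ∼? : ∀ x y → Dec (x ∼ y)
      ∼? x y = ¬? (x ≟ᴹ 0ᴹ) ×-dec (x ∈⟨ y ⟩?)

      ∑-∼ : ∀ {v} → ¬ (v ≈ᴹ 0ᴹ) → ∑ h (λ z → 𝟙 (∼? z v)) ≡ P
      ∑-∼ {v} v≉0 = ≡.trans (∑-cong h (λ z → 𝟙-× (¬? (z ≟ᴹ 0ᴹ)) (z ∈⟨ v ⟩?))) (∑-⟨⟩≉0 v≉0)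

      ∑-⟨⟩′ : ∀ {v} → ¬ (v ≈ᴹ 0ᴹ) → ∑ h (λ z → 𝟙 (z ∈⟨ v ⟩?)) ≡ suc P
      ∑-⟨⟩′ v≉0 = ≡.trans (∑-⟨⟩ v≉0) q≡1+q∸1

      ρ-guardˡ : ∀ {x} f {m n} → (¬ (x ≈ᴹ 0ᴹ) → m ≡ n) → ρ x f * m ≡ ρ x f * n
      ρ-guardˡ {x} f e with x ≟ᴹ 0ᴹ
      ... | no x≉0  = ≡.cong (ρ x f *_) (e x≉0)
      ... | yes x≈0 rewrite ≡.trans (ρ-cong {f = f} x≈0 ≈ᴹ-refl) (ρ-zeroˡ f) = ≡.refl

      ρ-guardʳ : ∀ x {f} {m n} → (¬ (f ≈ᴹ 0ᴹ) → m ≡ n) → ρ x f * m ≡ ρ x f * n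
      ρ-guardʳ x {f} e with f ≟ᴹ 0ᴹ
      ... | no f≉0  = ≡.cong (ρ x f *_) (e f≉0)
      ... | yes f≈0 rewrite ≡.trans (ρ-cong {x = x} ≈ᴹ-refl f≈0) (ρ-zeroʳ x) = ≡.refl

      module _ {x} (x≉0 : ¬ (x ≈ᴹ 0ᴹ)) where
        r : ℕ
        r = ∑ h (λ f → ρ x f)

        joint : Carrierᴹ → ℕ
        joint y = ∑ h (λ f → ρ x f * ρ y f)

        -- One formula for three cases: `joint y` is `l` off the line of `x`, `r` at its nonzero
        -- vectors and 0 at the zero vector.
        joint-value : ∀ y → joint y + 𝟙 (y ∈⟨ x ⟩?) * l ≡ 𝟙 (∼? y x) * r + l
        joint-value y = go (y ∈⟨ x ⟩?) (y ≟ᴹ 0ᴹ)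
          where
          go : Dec (y ∈⟨ x ⟩) → Dec (y ≈ᴹ 0ᴹ) → joint y + 𝟙 (y ∈⟨ x ⟩?) * l ≡ 𝟙 (∼? y x) * r + l
          go (no y∉) _ = ≡.trans (≡.cong₂ _+_ (pairCount x≉0 y∉) (≡.cong (_* l) (𝟙-no (y ∈⟨ x ⟩?) y∉)))
            (≡.trans (ℕ.+-comm l 0) (≡.sym (≡.cong (λ t → t * r + l) (𝟙-no (∼? y x) (y∉ ∘ proj₂)))))
          go (yes y∈) (yes y≈0) = ≡.cong₂ _+_
            (≡.trans (∑-zero h (λ f → ≡.trans (≡.cong (ρ x f *_) (≡.trans (ρ-cong {f = f} y≈0 ≈ᴹ-refl) (ρ-zeroˡ f)))
                (ℕ.*-zeroʳ (ρ x f))))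
                     (≡.sym (≡.cong (_* r) (𝟙-no (∼? y x) (λ p → proj₁ p y≈0)))))
            (≡.trans (≡.cong (_* l) (𝟙-yes (y ∈⟨ x ⟩?) y∈)) (ℕ.*-identityˡ l))
          go (yes y∈) (no y≉0) = ≡.cong₂ _+_
            (≡.trans (∑-cong h (λ f → ≡.trans (≡.cong (ρ x f *_) (ρ-classˡ f (y≉0 , y∈))) (idem x f)))
                     (≡.sym (≡.trans (≡.cong (_* r) (𝟙-yes (∼? y x) (y≉0 , y∈))) (ℕ.*-identityˡ r))))
            (≡.trans (≡.cong (_* l) (𝟙-yes (y ∈⟨ x ⟩?) y∈)) (ℕ.*-identityˡ l))

        ∑-joint : ∑ h joint ≡ k * r
        ∑-joint = begin
          ∑ h (λ y → ∑ h (λ f → ρ x f * ρ y f)) ≡⟨ ∑-swap h h _ ⟩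
          ∑ h (λ f → ∑ h (λ y → ρ x f * ρ y f)) ≡⟨ ∑-cong h (λ f → ≡.trans (∑-*ˡ h (ρ x f) (λ y → ρ y f))
              (ρ-guardʳ x blockSize)) ⟩
          ∑ h (λ f → ρ x f * k)                 ≡⟨ ∑-*ʳ h (ρ x) k ⟩
          r * k                                 ≡⟨ ℕ.*-comm r k ⟩
          k * r                                 ∎

        equation : k * r + suc P * l ≡ P * r + N * l
        equation = begin
          k * r + suc P * l ≡⟨ ≡.cong₂ _+_ ∑-joint (≡.trans (∑-*ʳ h (λ y → 𝟙 (y ∈⟨ x ⟩?)) l)
              (≡.cong (_* l) (∑-⟨⟩′ x≉0))) ⟨
          ∑ h joint + ∑ h (λ y → 𝟙 (y ∈⟨ x ⟩?) * l)             ≡⟨ ∑-+ h _ _ ⟨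
          ∑ h (λ y → joint y + 𝟙 (y ∈⟨ x ⟩?) * l)               ≡⟨ ∑-cong h joint-value ⟩
          ∑ h (λ y → 𝟙 (∼? y x) * r + l)                        ≡⟨ ∑-+ h _ _ ⟩
          ∑ h (λ y → 𝟙 (∼? y x) * r) + ∑ h (λ _ → l) ≡⟨ ≡.cong₂ _+_ (≡.trans (∑-*ʳ h _ r) (≡.cong (_* r) (∑-∼ x≉0)))
              (∑-const h l) ⟩
          P * r + N * l                                         ∎

    -- Counting pairs of a point y and a block on both x and y gives (k - (q - 1)) r = (N - q) l. By
    -- the parameter equations this reads q l r = q k l, and q l is not zero.
    replication : ∀ {x} → ¬ (x ≈ᴹ 0ᴹ) → ∑ h (λ f → ρ x f) ≡ k
    replication x≉0 = ℕ.*-cancelˡ-≡ _ _ (suc P * l) {{ℕ.m*n≢0 (suc P) l}} (ℕ.+-cancelʳ-≡ (P * R + suc P * l) _ _ (begin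
      suc P * l * R + (P * R + suc P * l) ≡⟨ solve 3 (λ p l r → (con 1 :+ p) :* l :* r :+ (p :* r :+ (con 1 :+ p) :* l)
          := ((con 1 :+ p) :* l :+ p) :* r :+ (con 1 :+ p) :* l) ≡.refl P l R ⟩
      (suc P * l + P) * R + suc P * l       ≡⟨ ≡.cong (λ t → t * R + suc P * l) k≡ ⟨
      k * R + suc P * l                     ≡⟨ equation x≉0 ⟩
      P * R + N * l                         ≡⟨ ≡.cong (λ t → P * R + t * l) N≡ ⟩
      P * R + (suc P * k + suc P) * l ≡⟨ solve 4 (λ p l r k → p :* r :+ ((con 1 :+ p) :* k :+ (con 1 :+ p)) :* l :=
          (con 1 :+ p) :* l :* k :+ (p :* r :+ (con 1 :+ p) :* l)) ≡.refl P l R k ⟩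
      suc P * l * k + (P * R + suc P * l)   ∎))
      where R = r x≉0

    private
      module Intersections {f} (f≉0 : ¬ (f ≈ᴹ 0ᴹ)) where
        meet : Carrierᴹ → ℕ
        meet g = ∑ h (λ x → ρ x f * ρ x g)

        meet-cong : ∀ {g g′} → g ≈ᴹ g′ → meet g ≡ meet g′
        meet-cong e = ∑-cong h (λ x → ≡.cong (ρ x f *_) (ρ-cong ≈ᴹ-refl e))

        S₁ : ∑ h meet ≡ k * k
        S₁ = begin
          ∑ h (λ g → ∑ h (λ x → ρ x f * ρ x g)) ≡⟨ ∑-swap h h _ ⟩
          ∑ h (λ x → ∑ h (λ g → ρ x f * ρ x g)) ≡⟨ ∑-cong h (λ x → ≡.trans (∑-*ˡ h (ρ x f) (ρ x))
              (ρ-guardˡ f replication)) ⟩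
          ∑ h (λ x → ρ x f * k)                 ≡⟨ ∑-*ʳ h (λ x → ρ x f) k ⟩
          ∑ h (λ x → ρ x f) * k                 ≡⟨ ≡.cong (_* k) (blockSize f≉0) ⟩
          k * k                                 ∎

        -- For x on f, the k vectors y on f are the q - 1 multiples of x, each with k blocks in
        -- common with x, and k - (q - 1) others, each with l.
        row : ∀ x → ρ x f * (∑ h (λ y → ρ y f * ∑ h (λ g → ρ x g * ρ y g)) + P * l) ≡ ρ x f * (P * k + k * l)
        row x with x ≟ᴹ 0ᴹ
        ... | yes x≈0 rewrite ≡.trans (ρ-cong {f = f} x≈0 ≈ᴹ-refl) (ρ-zeroˡ f) = ≡.refl
        ... | no x≉0 = begin
          ρ x f * (∑ h (λ y → ρ y f * J y) + P * l) ≡⟨ ≡.cong (λ t → ρ x f * (∑ h (λ y → ρ y f * J y) + t * l))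
              (∑-∼ x≉0) ⟨
          ρ x f * (∑ h (λ y → ρ y f * J y) + ∑ h (λ y → 𝟙 (∼? y x)) * l) ≡⟨ ≡.cong
              (λ t → ρ x f * (∑ h (λ y → ρ y f * J y) + t)) (∑-*ʳ h _ l) ⟨
          ρ x f * (∑ h (λ y → ρ y f * J y) + ∑ h (λ y → 𝟙 (∼? y x) * l)) ≡⟨ ≡.cong (ρ x f *_) (∑-+ h _ _) ⟨
          ρ x f * ∑ h (λ y → ρ y f * J y + 𝟙 (∼? y x) * l) ≡⟨ ∑-*ˡ h (ρ x f) _ ⟨
          ∑ h (λ y → ρ x f * (ρ y f * J y + 𝟙 (∼? y x) * l)) ≡⟨ ∑-cong h pointwise ⟩
          ∑ h (λ y → ρ x f * (𝟙 (∼? y x) * k + ρ y f * l)) ≡⟨ ∑-*ˡ h (ρ x f) _ ⟩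
          ρ x f * ∑ h (λ y → 𝟙 (∼? y x) * k + ρ y f * l) ≡⟨ ≡.cong (ρ x f *_) (∑-+ h _ _) ⟩
          ρ x f * (∑ h (λ y → 𝟙 (∼? y x) * k) + ∑ h (λ y → ρ y f * l)) ≡⟨ ≡.cong (ρ x f *_)
              (≡.cong₂ _+_ (≡.trans (∑-*ʳ h _ k) (≡.cong (_* k) (∑-∼ x≉0)))
              (≡.trans (∑-*ʳ h _ l) (≡.cong (_* l) (blockSize f≉0)))) ⟩
          ρ x f * (P * k + k * l) ∎
          where
          J = joint x≉0
          collapse : ∀ y → ρ x f * (ρ y f * 𝟙 (∼? y x)) ≡ ρ x f * 𝟙 (∼? y x)
          collapse y = go (∼? y x)
            where
            go : Dec (y ∼ x) → ρ x f * (ρ y f * 𝟙 (∼? y x)) ≡ ρ x f * 𝟙 (∼? y x)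
            go (yes y∼x) = ≡.trans (≡.cong (λ t → ρ x f * (t * 𝟙 (∼? y x))) (ρ-classˡ f y∼x))
              (≡.trans (≡.sym (ℕ.*-assoc (ρ x f) (ρ x f) _)) (≡.cong (_* 𝟙 (∼? y x)) (idem x f)))
            go (no y≁x) rewrite 𝟙-no (∼? y x) y≁x = ≡.cong (ρ x f *_) (ℕ.*-zeroʳ (ρ y f))
          pointwise : ∀ y → ρ x f * (ρ y f * J y + 𝟙 (∼? y x) * l) ≡ ρ x f * (𝟙 (∼? y x) * k + ρ y f * l)
          pointwise y = begin
            ρ x f * (ρ y f * J y + 𝟙 (∼? y x) * l) ≡⟨ ℕ.*-distribˡ-+ (ρ x f) _ _ ⟩
            ρ x f * (ρ y f * J y) + ρ x f * (𝟙 (∼? y x) * l) ≡⟨ ≡.cong (ρ x f * (ρ y f * J y) +_) (≡.trans (≡.sym (ℕ.*-assoc (ρ x f) _ l)) (≡.trans (≡.cong (_* l) (≡.trans (≡.sym (collapse y)) (≡.cong (ρ x f *_) in⟨⟩))) (solve 4 (λ a b i l → a :* (b :* i) :* l := a :* (b :* (i :* l))) ≡.refl (ρ x f) (ρ y f) (𝟙 (y ∈⟨ x ⟩?)) l))) ⟩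
            ρ x f * (ρ y f * J y) + ρ x f * (ρ y f * (𝟙 (y ∈⟨ x ⟩?) * l)) ≡⟨ solve 4 (λ a b j i → a :* (b :* j) :+ a :*
                (b :* i) := a :* (b :* (j :+ i))) ≡.refl (ρ x f) (ρ y f) (J y) (𝟙 (y ∈⟨ x ⟩?) * l) ⟩
            ρ x f * (ρ y f * (J y + 𝟙 (y ∈⟨ x ⟩?) * l)) ≡⟨ ≡.cong (λ t → ρ x f * (ρ y f * t))
                (≡.trans (joint-value x≉0 y) (≡.cong (λ t → 𝟙 (∼? y x) * t + l) (replication x≉0))) ⟩
            ρ x f * (ρ y f * (𝟙 (∼? y x) * k + l)) ≡⟨ solve 5 (λ a b i k l → a :* (b :* (i :* k :+ l)) := a :*
                (b :* i) :* k :+ a :* (b :* l)) ≡.refl (ρ x f) (ρ y f) (𝟙 (∼? y x)) k l ⟩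
            ρ x f * (ρ y f * 𝟙 (∼? y x)) * k + ρ x f * (ρ y f * l) ≡⟨ ≡.cong (λ t → t * k + ρ x f * (ρ y f * l))
                (collapse y) ⟩
            ρ x f * 𝟙 (∼? y x) * k + ρ x f * (ρ y f * l) ≡⟨ solve 5 (λ a b i k l → a :* i :* k :+ a :* (b :* l) := a :*
                (i :* k :+ b :* l)) ≡.refl (ρ x f) (ρ y f) (𝟙 (∼? y x)) k l ⟩
            ρ x f * (𝟙 (∼? y x) * k + ρ y f * l) ∎
            where
            in⟨⟩ : ρ y f * 𝟙 (∼? y x) ≡ ρ y f * 𝟙 (y ∈⟨ x ⟩?)
            in⟨⟩ = ρ-guardˡ f (λ y≉0 → 𝟙-⇔ proj₂ (y≉0 ,_) (∼? y x) (y ∈⟨ x ⟩?))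

        -- The second moment of `meet` counts triples x, y, g with x and y on both f and g; the sum
        -- over g is done first, where the design axioms apply.
        S₂ : ∑ h (λ g → meet g * meet g) + k * (P * l) ≡ k * (P * k + k * l)
        S₂ = begin
          ∑ h (λ g → meet g * meet g) + k * (P * l) ≡⟨ ≡.cong₂ _+_ expand (≡.cong (_* (P * l)) (≡.sym (blockSize f≉0)))
              ⟩
          ∑ h (λ x → ρ x f * T x) + ∑ h (λ x → ρ x f) * (P * l) ≡⟨ ≡.cong (∑ h (λ x → ρ x f * T x) +_)
              (∑-*ʳ h _ (P * l)) ⟨
          ∑ h (λ x → ρ x f * T x) + ∑ h (λ x → ρ x f * (P * l)) ≡⟨ ∑-+ h _ _ ⟨
          ∑ h (λ x → ρ x f * T x + ρ x f * (P * l)) ≡⟨ ∑-cong h (λ x → ≡.trans (≡.sym (ℕ.*-distribˡ-+ (ρ x f) _ _))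
              (row x)) ⟩
          ∑ h (λ x → ρ x f * (P * k + k * l)) ≡⟨ ∑-*ʳ h _ (P * k + k * l) ⟩
          ∑ h (λ x → ρ x f) * (P * k + k * l) ≡⟨ ≡.cong (_* (P * k + k * l)) (blockSize f≉0) ⟩
          k * (P * k + k * l) ∎
          where
          T : Carrierᴹ → ℕ
          T x = ∑ h (λ y → ρ y f * ∑ h (λ g → ρ x g * ρ y g))
          expand : ∑ h (λ g → meet g * meet g) ≡ ∑ h (λ x → ρ x f * T x)
          expand = begin
            ∑ h (λ g → meet g * meet g) ≡⟨ ∑-cong h (λ g → ∑-*ʳ h _ (meet g)) ⟨
            ∑ h (λ g → ∑ h (λ x → ρ x f * ρ x g * meet g)) ≡⟨ ∑-swap h h _ ⟩
            ∑ h (λ x → ∑ h (λ g → ρ x f * ρ x g * meet g)) ≡⟨ ∑-cong h (λ x → begin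
               ∑ h (λ g → ρ x f * ρ x g * meet g) ≡⟨ ∑-cong h (λ g → ≡.trans (ℕ.*-assoc (ρ x f) _ _)
                   (≡.cong (ρ x f *_) (≡.sym (∑-*ˡ h (ρ x g) _)))) ⟩
               ∑ h (λ g → ρ x f * ∑ h (λ y → ρ x g * (ρ y f * ρ y g))) ≡⟨ ∑-*ˡ h (ρ x f) _ ⟩
               ρ x f * ∑ h (λ g → ∑ h (λ y → ρ x g * (ρ y f * ρ y g))) ≡⟨ ≡.cong (ρ x f *_) (∑-swap h h _) ⟩
               ρ x f * ∑ h (λ y → ∑ h (λ g → ρ x g * (ρ y f * ρ y g))) ≡⟨ ≡.cong (ρ x f *_)
                   (∑-cong h (λ y → ≡.trans (∑-cong h (λ g → solve 3 (λ a b c → a :* (b :* c) := b :* (a :* c)) ≡.refl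
                   (ρ x g) (ρ y f) (ρ y g))) (∑-*ˡ h (ρ y f) _))) ⟩
               ρ x f * T x ∎) ⟩
            ∑ h (λ x → ρ x f * T x) ∎

        off : Carrierᴹ → ℕ
        off g = 𝟙 (¬? (g ∈⟨ f ⟩?))

        X₀ X₁ X₂ : ℕ
        X₀ = ∑ h off
        X₁ = ∑ h (λ g → off g * meet g)
        X₂ = ∑ h (λ g → off g * (meet g * meet g))

        meet-self : ∀ {g} → g ∼ f → meet g ≡ k
        meet-self g∼f = ≡.trans (∑-cong h (λ x → ≡.trans (≡.cong (ρ x f *_) (ρ-classʳ x g∼f)) (idem x f)))
            (blockSize f≉0)

        -- `G` will be the identity or the square. The zero vector lies on the line of `f` but has
        -- `meet` 0, so `G 0 ≡ 0` removes it.
        on-class : (G : ℕ → ℕ) → G 0 ≡ 0 → ∑ h (λ g → 𝟙 (g ∈⟨ f ⟩?) * G (meet g)) ≡ P * G k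
        on-class G G0 = ≡.trans (∑-cong h pointwise) (≡.trans (∑-*ʳ h _ (G k)) (≡.cong (_* G k) (∑-∼ f≉0)))
          where
          pointwise : ∀ g → 𝟙 (g ∈⟨ f ⟩?) * G (meet g) ≡ 𝟙 (∼? g f) * G k
          pointwise g = go (g ≟ᴹ 0ᴹ)
            where
            go : Dec (g ≈ᴹ 0ᴹ) → 𝟙 (g ∈⟨ f ⟩?) * G (meet g) ≡ 𝟙 (∼? g f) * G k
            go (yes g≈0) = ≡.trans (≡.cong (𝟙 (g ∈⟨ f ⟩?) *_) (≡.trans (≡.cong G meet-zero) G0))
                (≡.trans (ℕ.*-zeroʳ (𝟙 (g ∈⟨ f ⟩?))) (≡.sym (≡.cong (_* G k) (𝟙-no (∼? g f) (λ p → proj₁ p g≈0)))))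
              where
              meet-zero : meet g ≡ 0
              meet-zero = ∑-zero h (λ x → ≡.trans (≡.cong (ρ x f *_) (≡.trans (ρ-cong ≈ᴹ-refl g≈0) (ρ-zeroʳ x)))
                  (ℕ.*-zeroʳ (ρ x f)))
            go (no g≉0) = ≡.trans (𝟙-guard (g ∈⟨ f ⟩?) (λ g∈ → ≡.cong G (meet-self (g≉0 , g∈))))
              (≡.cong (_* G k) (𝟙-⇔ (g≉0 ,_) proj₂ (g ∈⟨ f ⟩?) (∼? g f)))

        X₀-eq : X₀ ≡ suc P * k
        X₀-eq = ℕ.+-cancelˡ-≡ (suc P) _ _ (begin
          suc P + X₀ ≡⟨ ≡.cong (_+ X₀) (∑-⟨⟩′ f≉0) ⟨
          ∑ h (λ g → 𝟙 (g ∈⟨ f ⟩?)) + X₀ ≡⟨ ∑-+ h _ _ ⟨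
          ∑ h (λ g → 𝟙 (g ∈⟨ f ⟩?) + off g) ≡⟨ ∑-cong h (λ g → 𝟙-¬ (g ∈⟨ f ⟩?)) ⟩
          ∑ h (λ _ → 1) ≡⟨ ≡.trans (∑-const h 1) (ℕ.*-identityʳ N) ⟩
          N ≡⟨ N≡ ⟩
          suc P * k + suc P ≡⟨ ℕ.+-comm _ (suc P) ⟩
          suc P + suc P * k ∎)

        X₁-eq : X₁ ≡ suc P * k * l
        X₁-eq = ℕ.+-cancelˡ-≡ (P * k) _ _ (begin
          P * k + X₁ ≡⟨ ≡.cong (_+ X₁) (on-class id ≡.refl) ⟨
          ∑ h (λ g → 𝟙 (g ∈⟨ f ⟩?) * meet g) + X₁ ≡⟨ ∑-split h (_∈⟨ f ⟩?) meet ⟨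
          ∑ h meet ≡⟨ S₁ ⟩
          k * k ≡⟨ ≡.cong (k *_) k≡ ⟩
          k * (suc P * l + P) ≡⟨ solve 3 (λ p k l → k :* ((con 1 :+ p) :* l :+ p) := p :* k :+ (con 1 :+ p) :* k :* l)
              ≡.refl P k l ⟩
          P * k + suc P * k * l ∎)

        X₂-eq : X₂ ≡ suc P * k * l * l
        X₂-eq = ℕ.+-cancelˡ-≡ (P * (k * k) + k * (P * l)) _ _ (begin
          P * (k * k) + k * (P * l) + X₂ ≡⟨ solve 3 (λ a b c → a :+ b :+ c := a :+ c :+ b) ≡.refl (P * (k * k))
              (k * (P * l)) X₂ ⟩
          P * (k * k) + X₂ + k * (P * l) ≡⟨ ≡.cong (λ t → t + X₂ + k * (P * l)) (on-class (λ t → t * t) ≡.refl) ⟨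
          ∑ h (λ g → 𝟙 (g ∈⟨ f ⟩?) * (meet g * meet g)) + X₂ + k * (P * l) ≡⟨ ≡.cong (_+ k * (P * l))
              (∑-split h (_∈⟨ f ⟩?) (λ g → meet g * meet g)) ⟨
          ∑ h (λ g → meet g * meet g) + k * (P * l) ≡⟨ S₂ ⟩
          k * (P * k + k * l) ≡⟨ solve 3 (λ p k l → k :* (p :* k :+ k :* l) := p :* (k :* k) :+ k :* k :* l) ≡.refl P k
              l ⟩
          P * (k * k) + k * k * l ≡⟨ ≡.cong (λ t → P * (k * k) + k * t * l) k≡ ⟩
          P * (k * k) + k * (suc P * l + P) * l ≡⟨ solve 3 (λ p k l → p :* (k :* k) :+ k :* ((con 1 :+ p) :* l :+ p) :*
              l := p :* (k :* k) :+ k :* (p :* l) :+ (con 1 :+ p) :* k :* l :* l) ≡.refl P k l ⟩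
          P * (k * k) + k * (P * l) + suc P * k * l * l ∎)

        -- By X₀-eq and X₁-eq the numbers meet g, for g not proportional to f, have
        -- mean l; X₂-eq says that their variance is zero.
        variance : ∑ h (λ g → off g * (∣ meet g - l ∣ * ∣ meet g - l ∣)) ≡ 0
        variance = ℕ.+-cancelˡ-≡ (2 * l * X₁) _ _ (begin
          2 * l * X₁ + V ≡⟨ ≡.cong (_+ V) (∑-*ˡ h (2 * l) _) ⟨
          ∑ h (λ g → 2 * l * (off g * meet g)) + V ≡⟨ ∑-+ h _ _ ⟨
          ∑ h (λ g → 2 * l * (off g * meet g) + off g * (∣ meet g - l ∣ * ∣ meet g - l ∣)) ≡⟨ ∑-cong h (λ g →
              ≡.trans (solve 4 (λ o m l d → con 2 :* l :* (o :* m) :+ o :* d := o :* (con 2 :* m :* l :+ d)) ≡.refl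
                  (off g) (meet g) l (∣ meet g - l ∣ * ∣ meet g - l ∣))
              (≡.trans (≡.cong (off g *_) (≡.sym (square-diff (meet g) l)))
                (ℕ.*-distribˡ-+ (off g) _ _))) ⟩
          ∑ h (λ g → off g * (meet g * meet g) + off g * (l * l)) ≡⟨ ∑-+ h _ _ ⟩
          X₂ + ∑ h (λ g → off g * (l * l)) ≡⟨ ≡.cong (X₂ +_) (∑-*ʳ h off (l * l)) ⟩
          X₂ + X₀ * (l * l) ≡⟨ ≡.cong₂ (λ s t → s + t * (l * l)) X₂-eq X₀-eq ⟩
          suc P * k * l * l + suc P * k * (l * l) ≡⟨ solve 2 (λ a l → a :* l :* l :+ a :* (l :* l) := con 2 :* l :*
              (a :* l) :+ con 0) ≡.refl (suc P * k) l ⟩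
          2 * l * (suc P * k * l) + 0 ≡⟨ ≡.cong (λ t → 2 * l * t + 0) X₁-eq ⟨
          2 * l * X₁ + 0 ∎)
          where V = ∑ h (λ g → off g * (∣ meet g - l ∣ * ∣ meet g - l ∣))

    -- The dual of a symmetric design is a design with the same parameters: the squared deviations
    -- from the mean have sum 0, so each of them is 0. This will count the neighbours in U common to
    -- two vertices outside.
    intersection : ∀ {f g} → ¬ (f ≈ᴹ 0ᴹ) → ¬ (g ∈⟨ f ⟩) → ∑ h (λ x → ρ x f * ρ x g) ≡ l
    intersection {f} {g} f≉0 g∉⟨f⟩ = ℕ.∣m-n∣≡0⇒m≡n (square-zero (∣ meet g - l ∣)
      (≡.trans (≡.sym (ℕ.*-identityˡ _))
          (≡.trans (≡.cong (_* (∣ meet g - l ∣ * ∣ meet g - l ∣)) (≡.sym (𝟙-yes (¬? (g ∈⟨ f ⟩?)) g∉⟨f⟩)))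
        (≡.sym (∑-≤-≡ h {f = λ _ → 0} (λ _ → ≡.refl)
          (λ {x} {y} e → ≡.cong₂ (λ s t → s * (∣ t - l ∣ * ∣ t - l ∣))
            (𝟙-⇔ (_∘ ∈⟨⟩-resp (≈ᴹ-sym e) ≈ᴹ-refl) (_∘ ∈⟨⟩-resp e ≈ᴹ-refl) (¬? (x ∈⟨ f ⟩?)) (¬? (y ∈⟨ f ⟩?)))
                (meet-cong e))
          (λ _ → z≤n) (≡.trans (∑-zero h (λ _ → ≡.refl)) (≡.sym variance)) g)))))
      where
      open Intersections f≉0
      square-zero : ∀ n → n * n ≡ 0 → n ≡ 0
      square-zero zero _ = ≡.refl

-- Linear combinations and spans.

module Combinations (F : FiniteField c ℓ) (M : LeftModule (FiniteField.ring F) m ℓm) where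
  open FieldProperties F
  open LeftModule M
  open F using (Carrier; _≈_; 0#; 1#)
  open LinearAlgebra F M using (combination; LinearlyIndependent)
  private
    module R = RingProperties F.ring
    module S = CommutativeMonoidSum +ᴹ-commutativeMonoid
  open SetoidReasoning ≈ᴹ-setoid

  Span : ∀ {n} → Vector Carrierᴹ n → Carrierᴹ → Set _
  Span t x = ∃ λ a → combination a t ≈ᴹ x

  combination-cong : ∀ {n} {a b : Vector Carrier n} t → (∀ i → a i ≈ b i) → combination a t ≈ᴹ combination b t
  combination-cong t a≈b = S.sum-cong-≋ (λ i → *ₗ-cong (a≈b i) ≈ᴹ-refl)

  combination-+ : ∀ {n} (a b : Vector Carrier n) t → combination (λ i → a i F.+ b i) t ≈ᴹ combination a t +ᴹ combination
      b t
  combination-+ a b t = ≈ᴹ-trans (S.sum-cong-≋ (λ i → *ₗ-distribʳ (t i) (a i) (b i))) (S.∑-distrib-+ (λ i → a i *ₗ t i)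
      (λ i → b i *ₗ t i))

  combination-* : ∀ {n} e (a : Vector Carrier n) t → combination (λ i → e F.* a i) t ≈ᴹ e *ₗ combination a t
  combination-* {zero}  e a t = ≈ᴹ-sym (*ₗ-zeroʳ e)
  combination-* {suc n} e a t = ≈ᴹ-trans (+ᴹ-cong (*ₗ-assoc e _ _) (combination-* e (a ∘ suc) (t ∘ suc)))
      (≈ᴹ-sym (*ₗ-distribˡ e _ _))

  combination-0 : ∀ {n} (t : Vector Carrierᴹ n) → combination (λ _ → 0#) t ≈ᴹ 0ᴹ
  combination-0 {n} t = ≈ᴹ-trans (S.sum-cong-≋ (λ i → *ₗ-zeroˡ (t i))) (S.sum-replicate-zero n)

  combination-δ : ∀ {n} (t : Vector Carrierᴹ n) j → combination (λ i → if does (i Fin.≟ j) then 1# else 0#) t ≈ᴹ t j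
  combination-δ t j = ≈ᴹ-trans (sum-single +ᴹ-commutativeMonoid _ j off) on
    where
    off : ∀ i → i ≢ j → (if does (i Fin.≟ j) then 1# else 0#) *ₗ t i ≈ᴹ 0ᴹ
    off i i≢j with i Fin.≟ j
    ... | yes e = contradiction e i≢j
    ... | no _ = *ₗ-zeroˡ (t i)
    on : (if does (j Fin.≟ j) then 1# else 0#) *ₗ t j ≈ᴹ t j
    on with j Fin.≟ j
    ... | yes _ = *ₗ-identityˡ (t j)
    ... | no j≢j = contradiction ≡.refl j≢j

  span-resp : ∀ {n} (t : Vector Carrierᴹ n) {x y} → x ≈ᴹ y → Span t x → Span t y
  span-resp t x≈y (a , e) = a , ≈ᴹ-trans e x≈y

  span-+ : ∀ {n} (t : Vector Carrierᴹ n) {x y} → Span t x → Span t y → Span t (x +ᴹ y)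
  span-+ t (a , e) (b , f) = _ , ≈ᴹ-trans (combination-+ a b t) (+ᴹ-cong e f)

  span-* : ∀ {n} (t : Vector Carrierᴹ n) e {x} → Span t x → Span t (e *ₗ x)
  span-* t e (a , f) = _ , ≈ᴹ-trans (combination-* e a t) (*ₗ-cong F.refl f)

  span-0 : ∀ {n} (t : Vector Carrierᴹ n) → Span t 0ᴹ
  span-0 t = _ , combination-0 t

  span-basis : ∀ {n} (t : Vector Carrierᴹ n) i → Span t (t i)
  span-basis t i = _ , combination-δ t i

  span-⊆ : ∀ {n k} (t : Vector Carrierᴹ n) (s : Vector Carrierᴹ k) → (∀ i → Span s (t i)) → ∀ {x} → Span t x → Span s x
  span-⊆ t s t⊆s (a , e) = span-resp s e (go t t⊆s a)
    where
    go : ∀ {n} (t : Vector Carrierᴹ n) → (∀ i → Span s (t i)) → ∀ a → Span s (combination a t)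
    go {zero}  t t⊆s a = span-0 s
    go {suc n} t t⊆s a = span-+ s (span-* s (a zero) (t⊆s zero)) (go (t ∘ suc) (t⊆s ∘ suc) (a ∘ suc))

  combination-injective : ∀ {n} (t : Vector Carrierᴹ n) → LinearlyIndependent t →
                          ∀ {a b} → combination a t ≈ᴹ combination b t → ∀ i → a i ≈ b i
  combination-injective t ind {a} {b} e i = R.x∙y⁻¹≈ε⇒x≈y _ _ (F.trans (F.+-congˡ (F.sym (R.-1*x≈-x (b i))))
      (ind _ (begin
    combination (λ i → a i F.+ (F.- 1#) F.* b i) t        ≈⟨ combination-+ a _ t ⟩
    combination a t +ᴹ combination (λ i → (F.- 1#) F.* b i) t ≈⟨ +ᴹ-cong e (combination-* (F.- 1#) b t) ⟩
    combination b t +ᴹ (F.- 1#) *ₗ combination b t        ≈⟨ +ᴹ-cong (*ₗ-identityˡ _) ≈ᴹ-refl ⟨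
    1# *ₗ combination b t +ᴹ (F.- 1#) *ₗ combination b t   ≈⟨ *ₗ-distribʳ _ 1# (F.- 1#) ⟨
    (1# F.- 1#) *ₗ combination b t                        ≈⟨ *ₗ-cong (F.-‿inverseʳ 1#) ≈ᴹ-refl ⟩
    0# *ₗ combination b t                                 ≈⟨ *ₗ-zeroˡ _ ⟩
    0ᴹ                                                    ∎) i))

  independent-∷ : ∀ {n} (t : Vector Carrierᴹ n) → LinearlyIndependent t → ∀ {x} → ¬ Span t x → LinearlyIndependent
      (x ∷ t)
  independent-∷ t ind {x} x∉t a e = λ
      { zero    → a₀≈0
      ; (suc i) → ind (a ∘ suc) (≈ᴹ-trans
          (≈ᴹ-sym (≈ᴹ-trans (+ᴹ-cong (≈ᴹ-trans (*ₗ-cong a₀≈0 ≈ᴹ-refl) (*ₗ-zeroˡ x)) ≈ᴹ-refl) (+ᴹ-identityˡ _))) e) i }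
    where
    rest = combination (a ∘ suc) t
    a₀≈0 : a zero ≈ 0#
    a₀≈0 = decidable-stable (a zero ≟ 0#) λ a₀≉0 → x∉t (span-resp t (begin
      (a₀≉0 ⁻¹ F.* (F.- 1#)) *ₗ rest            ≈⟨ *ₗ-assoc _ _ _ ⟩
      a₀≉0 ⁻¹ *ₗ ((F.- 1#) *ₗ rest)             ≈⟨ *ₗ-cong F.refl (begin
        (F.- 1#) *ₗ rest                              ≈⟨ +ᴹ-identityˡ _ ⟨
        0ᴹ +ᴹ (F.- 1#) *ₗ rest                        ≈⟨ +ᴹ-cong e ≈ᴹ-refl ⟨
        (a zero *ₗ x +ᴹ rest) +ᴹ (F.- 1#) *ₗ rest     ≈⟨ +ᴹ-assoc _ _ _ ⟩
        a zero *ₗ x +ᴹ (rest +ᴹ (F.- 1#) *ₗ rest)     ≈⟨ +ᴹ-cong ≈ᴹ-refl (+ᴹ-cong (*ₗ-identityˡ _) ≈ᴹ-refl) ⟨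
        a zero *ₗ x +ᴹ (1# *ₗ rest +ᴹ (F.- 1#) *ₗ rest) ≈⟨ +ᴹ-cong ≈ᴹ-refl
            (≈ᴹ-trans (≈ᴹ-sym (*ₗ-distribʳ _ 1# (F.- 1#))) (≈ᴹ-trans (*ₗ-cong (F.-‿inverseʳ 1#) ≈ᴹ-refl) (*ₗ-zeroˡ _)))
            ⟩
        a zero *ₗ x +ᴹ 0ᴹ                             ≈⟨ +ᴹ-identityʳ _ ⟩
        a zero *ₗ x                                   ∎) ⟩
      a₀≉0 ⁻¹ *ₗ (a zero *ₗ x)                  ≈⟨ *ₗ-assoc _ _ _ ⟨
      (a₀≉0 ⁻¹ F.* a zero) *ₗ x                 ≈⟨ *ₗ-cong (F.trans (F.*-comm _ _) (proj₂ (F.inverse _ a₀≉0))) ≈ᴹ-refl ⟩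
      1# *ₗ x                                   ≈⟨ *ₗ-identityˡ x ⟩
      x                                         ∎) (span-* t _ (a ∘ suc , ≈ᴹ-refl)))

module Spans (F : FiniteField c ℓ) (M : LeftModule (FiniteField.ring F) m ℓm)
             {N : ℕ} (h : HasCard (LeftModule.≈ᴹ-setoid M) N) where
  open FiniteModule F M h
  open Combinations F M public
  open F using (_≈_; 0#; 1#)
  open LinearAlgebra F M using (combination; LinearlyIndependent)

  opaque
    span? : ∀ {n} (t : Vector Carrierᴹ n) x → Dec (Span t x)
    span? {n} t x = card-∃? (Fⁿ-card n) (λ a≈b e → ≈ᴹ-trans (combination-cong t (λ i → F.sym (a≈b i))) e)
                                        (λ a → combination a t ≟ᴹ x)

  span₁⇒∈⟨⟩ : ∀ (t : Vector Carrierᴹ 1) {z} → Span t z → z ∈⟨ t zero ⟩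
  span₁⇒∈⟨⟩ t (a , e) = a zero , ≈ᴹ-trans (≈ᴹ-sym e) (+ᴹ-identityʳ _)

  ∈⟨⟩⇒span₁ : ∀ (t : Vector Carrierᴹ 1) {z} → z ∈⟨ t zero ⟩ → Span t z
  ∈⟨⟩⇒span₁ t (a , e) = (λ _ → a) , ≈ᴹ-trans (+ᴹ-identityʳ _) (≈ᴹ-sym e)

  independent₁ : ∀ {x} → ¬ (x ≈ᴹ 0ᴹ) → LinearlyIndependent (x ∷ [])
  independent₁ x≉0 = independent-∷ [] (λ _ _ ()) (λ (_ , e) → x≉0 (≈ᴹ-sym e))

  independent₂ : ∀ {x y} → ¬ (y ≈ᴹ 0ᴹ) → ¬ (x ∈⟨ y ⟩) → LinearlyIndependent (x ∷ y ∷ [])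
  independent₂ {x} {y} y≉0 x∉y = independent-∷ (y ∷ []) (independent₁ y≉0) (x∉y ∘ span₁⇒∈⟨⟩ (y ∷ []))

  basis≉0 : ∀ {n} (t : Vector Carrierᴹ n) → LinearlyIndependent t → ∀ i → ¬ (t i ≈ᴹ 0ᴹ)
  basis≉0 t ind i tᵢ≈0 = F.0≉1 (F.sym (F.trans (F.sym one) (ind _ (≈ᴹ-trans (combination-δ t i) tᵢ≈0) i)))
    where
    one : (if does (i Fin.≟ i) then 1# else 0#) ≈ 1#
    one with i Fin.≟ i
    ... | yes _ = F.refl
    ... | no i≢i = contradiction ≡.refl i≢i

  -- Independence makes coordinates unique. Sums over U thereby become sums over the coordinate
  -- space on which the vector designs live.
  ∑-span : ∀ {n} (t : Vector Carrierᴹ n) → LinearlyIndependent t → {g : Carrierᴹ → ℕ} → (∀ {x y} → x ≈ᴹ y → g x ≡ g y) →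
           ∑ h (λ x → 𝟙 (span? t x) * g x) ≡ ∑ (Fⁿ-card n) (λ a → g (combination a t))
  ∑-span {n} t ind {g} g-cong = ≡.trans (∑-cong h row) (≡.trans (∑-swap h k _)
      (∑-cong k (λ a → ∑-point h (combination a t) (λ x → combination a t ≟ᴹ x) ≈ᴹ-sym ≈ᴹ-sym g g-cong)))
    where
    k = Fⁿ-card n
    row : ∀ x → 𝟙 (span? t x) * g x ≡ ∑ k (λ a → 𝟙 (combination a t ≟ᴹ x) * g x)
    row x = ≡.trans (≡.cong (_* g x) (count (span? t x))) (≡.sym (∑-*ʳ k _ (g x)))
      where
      count : Dec (Span t x) → 𝟙 (span? t x) ≡ ∑ k (λ a → 𝟙 (combination a t ≟ᴹ x))
      count (yes (a , e)) = ≡.trans (𝟙-yes _ (a , e)) (≡.sym (∑-unique k a (λ a → combination a t ≟ᴹ x)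
        (λ f → combination-injective t ind (≈ᴹ-trans f (≈ᴹ-sym e))) (λ b≈a → ≈ᴹ-trans (combination-cong t b≈a) e)))
      count (no ¬s) = ≡.trans (𝟙-no _ ¬s) (≡.sym (∑-zero k (λ a → 𝟙-no _ (λ e → ¬s (a , e)))))

  -- Both spans have as many vectors as there are coordinate tuples of length `n`, so an inclusion
  -- between them is an equality; counting takes the place of an exchange argument.
  span-dimension : ∀ {n} (t s : Vector Carrierᴹ n) → LinearlyIndependent t → LinearlyIndependent s →
                   (∀ {x} → Span t x → Span s x) → ∀ {x} → Span s x → Span t x
  span-dimension {n} t s t-ind s-ind t⊆s {x} x∈s = decidable-stable (span? t x) λ x∉t →
      contradiction (≡.trans (≡.sym (𝟙-no (span? t x) x∉t)) (≡.trans equal (𝟙-yes (span? s x) x∈s))) λ ()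
    where
    size : ∀ (r : Vector Carrierᴹ n) → LinearlyIndependent r → ∑ h (λ x → 𝟙 (span? r x)) ≡ ∑ (Fⁿ-card n) (λ _ → 1)
    size r r-ind = ≡.trans (∑-cong h (λ x → ≡.sym (ℕ.*-identityʳ _))) (∑-span r r-ind (λ _ → ≡.refl))
    span-𝟙 : ∀ (r : Vector Carrierᴹ n) {x y} → x ≈ᴹ y → 𝟙 (span? r x) ≡ 𝟙 (span? r y)
    span-𝟙 r e = 𝟙-⇔ (span-resp r e) (span-resp r (≈ᴹ-sym e)) _ _
    equal : 𝟙 (span? t x) ≡ 𝟙 (span? s x)
    equal = ∑-≤-≡ h (span-𝟙 t) (span-𝟙 s) (λ x → 𝟙-≤ t⊆s (span? t x) (span? s x))
        (≡.trans (size t t-ind) (≡.sym (size s s-ind))) x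

-- The dot product, kernels of functionals and the design of hyperplanes.

module Dot (F : FiniteField c ℓ) where
  open FieldProperties F
  open F using (Carrier; _≈_; 0#; 1#)
  open SemiringSum F.semiring using (sum; sum-cong-≋; *-distribˡ-sum; *-distribʳ-sum; ∑-distrib-+; sum-replicate-zero)

  infix 7 _·_
  opaque
    _·_ : ∀ {n} → Vector Carrier n → Vector Carrier n → Carrier
    x · y = sum (λ i → x i F.* y i)

  opaque
    unfolding _·_

    ·-comm : ∀ {n} (x y : Vector Carrier n) → x · y ≈ y · x
    ·-comm x y = sum-cong-≋ (λ i → F.*-comm (x i) (y i))

    ·-sesquilinear : ∀ n → LinearAlgebra.IsSesquilinear F (Fⁿ n) id _·_
    ·-sesquilinear n = record
      { cong = λ x≈ y≈ → sum-cong-≋ (λ i → F.*-cong (x≈ i) (y≈ i))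
      ; additiveˡ = addˡ
      ; additiveʳ = λ x y z → F.trans (·-comm x _) (F.trans (addˡ y z x) (F.+-cong (·-comm y x) (·-comm z x)))
      ; scalarˡ = scaleˡ
      ; scalarʳ = λ a x y → F.trans (·-comm x _) (F.trans (scaleˡ a y x) (F.*-congˡ (·-comm y x)))
      }
      where
      addˡ : ∀ (x y z : Vector Carrier n) → (λ i → x i F.+ y i) · z ≈ x · z F.+ y · z
      addˡ x y z = F.trans (sum-cong-≋ {n} (λ i → F.distribʳ (z i) (x i) (y i))) (∑-distrib-+ {n} (λ i → x i F.* z i)
          (λ i → y i F.* z i))
      scaleˡ : ∀ a (x y : Vector Carrier n) → (λ i → a F.* x i) · y ≈ a F.* (x · y)
      scaleˡ a x y = F.trans (sum-cong-≋ {n} (λ i → F.*-assoc a (x i) (y i)))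
          (F.sym (*-distribˡ-sum {n} a (λ i → x i F.* y i)))

    ·-radical : ∀ {n} (x : Vector Carrier n) → (∀ z → x · z ≈ 0#) → ∀ i → x i ≈ 0#
    ·-radical {n} x x⊥ j = F.trans (F.sym (F.trans (sum-single F.+-commutativeMonoid _ j off) on))
        (x⊥ (λ i → if does (i Fin.≟ j) then 1# else 0#))
      where
      off : ∀ i → i ≢ j → x i F.* (if does (i Fin.≟ j) then 1# else 0#) ≈ 0#
      off i i≢j with i Fin.≟ j
      ... | yes e = contradiction e i≢j
      ... | no _ = F.zeroʳ _
      on : x j F.* (if does (j Fin.≟ j) then 1# else 0#) ≈ x j
      on with j Fin.≟ j
      ... | yes _ = F.*-identityʳ _
      ... | no j≢j = contradiction ≡.refl j≢j

  -- The kernel of the functional with coordinates b, b j ≉ 0, has the basis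
  -- uᵢ − (bᵢ / bⱼ) uⱼ for i ≠ j.
  module Kernel (M : LeftModule F.ring m ℓm) {k : ℕ} (u : Vector (LeftModule.Carrierᴹ M) (suc k))
                (independent : LinearAlgebra.LinearlyIndependent F M u)
                (b : Vector Carrier (suc k)) (j : Fin (suc k)) (bⱼ≉0 : ¬ (b j ≈ 0#)) where
    open LeftModule M
    open Combinations F M
    open LinearAlgebra F M using (combination; LinearlyIndependent)
    private
      module R = RingProperties F.ring
      module S = CommutativeMonoidSum +ᴹ-commutativeMonoid
      module SF = CommutativeMonoidSum F.+-commutativeMonoid

      e : Vector Carrier k
      e i = (F.- b (Fin.punchIn j i)) F.* bⱼ≉0 ⁻¹

      -- The coordinates with respect to `u` of a vector given in `basis`: entry `j` is forced by
      -- the others, because the functional has to vanish.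
      extend : Vector Carrier k → Vector Carrier (suc k)
      extend a = Vector.insertAt a j (sum (λ i → a i F.* e i))

    basis : Vector Carrierᴹ k
    basis i = u (Fin.punchIn j i) +ᴹ e i *ₗ u j

    private
      sum-*ₗ : ∀ {n} (a : Vector Carrier n) x → S.sum (λ i → a i *ₗ x) ≈ᴹ sum a *ₗ x
      sum-*ₗ {zero}  a x = ≈ᴹ-sym (*ₗ-zeroˡ x)
      sum-*ₗ {suc n} a x = ≈ᴹ-trans (+ᴹ-cong ≈ᴹ-refl (sum-*ₗ (a ∘ suc) x)) (≈ᴹ-sym (*ₗ-distribʳ x _ _))

      combination-basis : ∀ a → combination a basis ≈ᴹ combination (extend a) u
      combination-basis a = begin
        combination a basis ≈⟨ S.sum-cong-≋ {k} (λ i → ≈ᴹ-trans (*ₗ-distribˡ (a i) _ _)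
            (+ᴹ-cong ≈ᴹ-refl (≈ᴹ-sym (*ₗ-assoc (a i) (e i) (u j))))) ⟩
        S.sum (λ i → a i *ₗ u (Fin.punchIn j i) +ᴹ (a i F.* e i) *ₗ u j) ≈⟨ S.∑-distrib-+
            (λ i → a i *ₗ u (Fin.punchIn j i)) (λ i → (a i F.* e i) *ₗ u j) ⟩
        combination a (u ∘ Fin.punchIn j) +ᴹ S.sum (λ i → (a i F.* e i) *ₗ u j) ≈⟨ ≈ᴹ-trans (+ᴹ-comm _ _)
            (+ᴹ-cong (sum-*ₗ (λ i → a i F.* e i) (u j)) ≈ᴹ-refl) ⟩
        sum (λ i → a i F.* e i) *ₗ u j +ᴹ combination a (u ∘ Fin.punchIn j) ≈⟨ +ᴹ-cong
            (*ₗ-cong (F.reflexive (Vector.insertAt-lookup a j _)) ≈ᴹ-refl)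
                (S.sum-cong-≋ {k} (λ i → *ₗ-cong (F.reflexive (Vector.insertAt-punchIn a j _ i)) ≈ᴹ-refl)) ⟨
        extend a j *ₗ u j +ᴹ combination (Vector.removeAt (extend a) j) (u ∘ Fin.punchIn j) ≈⟨ S.sum-remove {k} {j}
            (λ i → extend a i *ₗ u i) ⟨
        combination (extend a) u ∎
        where open SetoidReasoning ≈ᴹ-setoid

      opaque
        unfolding _·_

        ·-remove : ∀ α → α · b ≈ α j F.* b j F.+ sum (λ i → α (Fin.punchIn j i) F.* b (Fin.punchIn j i))
        ·-remove α = SF.sum-remove {k} {j} (λ i → α i F.* b i)

      extend-j : ∀ a → extend a j F.* b j ≈ F.- sum (λ i → a i F.* b (Fin.punchIn j i))
      extend-j a = R.+-inverseˡ-unique _ _ (begin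
        extend a j F.* b j F.+ sum (λ i → a i F.* b (Fin.punchIn j i)) ≈⟨ F.+-congʳ
            (F.trans (F.*-congʳ (F.reflexive (Vector.insertAt-lookup a j _)))
            (*-distribʳ-sum {k} (b j) (λ i → a i F.* e i))) ⟩
        sum (λ i → a i F.* e i F.* b j) F.+ sum (λ i → a i F.* b (Fin.punchIn j i)) ≈⟨ ∑-distrib-+ {k}
            (λ i → a i F.* e i F.* b j) (λ i → a i F.* b (Fin.punchIn j i)) ⟨
        sum (λ i → a i F.* e i F.* b j F.+ a i F.* b (Fin.punchIn j i)) ≈⟨ sum-cong-≋ {k}
            (λ i → F.trans (F.+-congʳ (F.trans (F.*-assoc _ _ _) (F.*-congˡ (div-*ʳ bⱼ≉0 _))))
             (F.trans (F.sym (F.distribˡ (a i) _ _)) (F.trans (F.*-congˡ (F.-‿inverseˡ _)) (F.zeroʳ _)))) ⟩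
        sum {k} (λ i → 0#) ≈⟨ sum-replicate-zero k ⟩
        0# ∎)
        where open SetoidReasoning F.setoid

    basis-independent : LinearlyIndependent basis
    basis-independent a a≈0 i = F.trans (F.sym (F.reflexive (Vector.insertAt-punchIn a j _ i)))
      (independent (extend a) (≈ᴹ-trans (≈ᴹ-sym (combination-basis a)) a≈0) (Fin.punchIn j i))

    kernel⇒ : ∀ {x} → Span basis x → ∃ λ α → combination α u ≈ᴹ x × α · b ≈ 0#
    kernel⇒ (a , a≈x) = extend a , ≈ᴹ-trans (≈ᴹ-sym (combination-basis a)) a≈x ,
      F.trans (·-remove (extend a)) (F.trans
          (F.+-cong (extend-j a) (sum-cong-≋ {k} (λ i → F.*-congʳ (F.reflexive (Vector.insertAt-punchIn a j _ i)))))
          (F.-‿inverseˡ _))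

    ⇒kernel : ∀ {α x} → combination α u ≈ᴹ x → α · b ≈ 0# → Span basis x
    ⇒kernel {α} {x} α≈x αb≈0 = a , ≈ᴹ-trans (combination-basis a) (≈ᴹ-trans (combination-cong u agree) α≈x)
      where
      a : Vector Carrier k
      a = Vector.removeAt α j
      agree-j : extend a j ≈ α j
      agree-j = cancel-*ʳ bⱼ≉0 (F.trans (extend-j a)
          (F.sym (R.+-inverseˡ-unique _ _ (F.trans (F.sym (·-remove α)) αb≈0))))
      agree : ∀ i → extend a i ≈ α i
      agree i with j Fin.≟ i
      ... | yes ≡.refl = agree-j
      ... | no j≢i = ≡.subst (λ i → extend a i ≈ α i) (Fin.punchIn-punchOut j≢i)
          (F.reflexive (Vector.insertAt-punchIn a j _ (Fin.punchOut j≢i)))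

  module HyperplaneDesign (d : ℕ) where
    n = 3 ℕ.+ d
    h = Fⁿ-card n
    open FiniteModule F (Fⁿ n) h using (Carrierᴹ; _≈ᴹ_; 0ᴹ; ≈ᴹ-refl; ≈ᴹ-sym; ≈ᴹ-trans; _≟ᴹ_; *ₗ-zeroˡ; _∈⟨_⟩; ∑-0)
    open VectorDesign F (Fⁿ n) h
    open Spans F (Fⁿ n) h
    open SesquilinearForm F (Fⁿ n) h id id (λ _ → F.refl) _·_ (·-sesquilinear n)
    open LinearAlgebra F (Fⁿ n) using (LinearlyIndependent; combination)

    nonzero-perp? : ∀ x f → Dec (¬ (x ≈ᴹ 0ᴹ) × ¬ (f ≈ᴹ 0ᴹ) × x · f ≈ 0#)
    nonzero-perp? x f = ¬? (x ≟ᴹ 0ᴹ) ×-dec ¬? (f ≟ᴹ 0ᴹ) ×-dec (x · f ≟ 0#)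

    ρ₀ : Carrierᴹ → Carrierᴹ → ℕ
    ρ₀ x f = 𝟙 (nonzero-perp? x f)

    ·-nondegenerate : ∀ {k} {t : Vector Carrierᴹ k} → LinearlyIndependent t → Nondegenerate t
    ·-nondegenerate {t = t} ind a a⊥ = ind a (·-radical (combination a t) a⊥)

    -- The numbers of nonzero vectors in a hyperplane of Fⁿ and in the intersection of two
    -- hyperplanes, qⁿ⁻¹ - 1 and qⁿ⁻² - 1.
    k l : ℕ
    k = F.θ (2 ℕ.+ d) * q∸1
    l = F.θ (1 ℕ.+ d) * q∸1

    private
      drop-0 : (g : Carrierᴹ → ℕ) (cong : ∀ {x y} → x ≈ᴹ y → g x ≡ g y) → g 0ᴹ ≡ 1 → ∀ e → ∑ h g ≡ F.q ^ e →
               ∑ h (λ x → 𝟙 (¬? (x ≟ᴹ 0ᴹ)) * g x) ≡ F.θ e * q∸1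
      drop-0 g cong g0 e eq = ℕ.suc-injective
          (≡.trans (≡.sym (≡.trans (∑-0 cong) (≡.cong (_+ ∑ h (λ x → 𝟙 (¬? (x ≟ᴹ 0ᴹ)) * g x)) g0)))
        (≡.trans eq (≡.trans (q^ e) (ℕ.+-comm _ 1))))

      perp-scale : ∀ {x y} f → x ∼ y → y · f ≈ 0# → x · f ≈ 0#
      perp-scale f (_ , a , e) yf = F.trans (B-cong e ≈ᴹ-refl)
          (F.trans (scalarˡ a _ f) (F.trans (F.*-congˡ yf) (F.zeroʳ a)))

      ∼-sym : ∀ {x y} → x ∼ y → y ∼ x
      ∼-sym {x} {y} (x≉0 , x∈) = (λ y≈0 → x≉0 (≈ᴹ-trans (proj₂ x∈) (≈ᴹ-trans (λ i → F.*-congˡ (y≈0 i))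
          (λ i → F.zeroʳ _)))) , ∈⟨⟩-sym x≉0 x∈
        where open FiniteModule F (Fⁿ n) h using (∈⟨⟩-sym)

      classˡ : ∀ {x y} f → x ∼ y → ¬ (x ≈ᴹ 0ᴹ) × ¬ (f ≈ᴹ 0ᴹ) × x · f ≈ 0# → ¬ (y ≈ᴹ 0ᴹ) × ¬ (f ≈ᴹ 0ᴹ) × y · f ≈ 0#
      classˡ f x∼y (_ , f≉0 , xf) = proj₁ (∼-sym x∼y) , f≉0 , perp-scale f (∼-sym x∼y) xf

      swap : ∀ {x y} → ¬ (x ≈ᴹ 0ᴹ) × ¬ (y ≈ᴹ 0ᴹ) × x · y ≈ 0# → ¬ (y ≈ᴹ 0ᴹ) × ¬ (x ≈ᴹ 0ᴹ) × y · x ≈ 0#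
      swap {x} {y} (p , r , s) = r , p , F.trans (·-comm y x) s

    -- The two counts are those of the nonzero solutions of one, respectively two, independent
    -- homogeneous equations.
    ρ₀-isVectorDesign : IsVectorDesign k l ρ₀
    ρ₀-isVectorDesign = record
      { idem = λ x f → 𝟙-idem (nonzero-perp? x f)
      ; ρ-cong = λ {x} {y} {f} {g} e e′ → 𝟙-⇔
          (λ (p , r , s) → (λ z → p (≈ᴹ-trans e z)) , (λ z → r (≈ᴹ-trans e′ z)) , F.trans
              (B-cong (≈ᴹ-sym e) (≈ᴹ-sym e′)) s)
          (λ (p , r , s) → (λ z → p (≈ᴹ-trans (≈ᴹ-sym e) z)) , (λ z → r (≈ᴹ-trans (≈ᴹ-sym e′) z)) , F.trans
              (B-cong e e′) s)
          (nonzero-perp? x f) (nonzero-perp? y g)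
      ; ρ-zeroˡ = λ f → 𝟙-no (nonzero-perp? 0ᴹ f) (λ p → proj₁ p ≈ᴹ-refl)
      ; ρ-zeroʳ = λ x → 𝟙-no (nonzero-perp? x 0ᴹ) (λ p → proj₁ (proj₂ p) ≈ᴹ-refl)
      ; ρ-classˡ = λ {x} {y} f x∼y → 𝟙-⇔ (classˡ f x∼y) (classˡ f (∼-sym x∼y)) (nonzero-perp? x f) (nonzero-perp? y f)
      ; ρ-classʳ = λ {f} {g} x f∼g → 𝟙-⇔ (swap ∘ classˡ x f∼g ∘ swap) (swap ∘ classˡ x (∼-sym f∼g) ∘ swap)
          (nonzero-perp? x f) (nonzero-perp? x g)
      ; blockSize = size
      ; pairCount = pairs
      }
      where
      size : ∀ {f} → ¬ (f ≈ᴹ 0ᴹ) → ∑ h (λ x → ρ₀ x f) ≡ k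
      size {f} f≉0 = ≡.trans (∑-cong h row) (drop-0 g g-cong (𝟙-yes (tuple 0ᴹ ≟ⁿ _) (λ i → zeroʳ (t i))) (2 ℕ.+ d)
          (ℕ.*-cancelˡ-≡ _ _ F.q {{q-nonZero}} (≡.trans (≡.cong (_* ∑ h g) (≡.sym (ℕ.*-identityʳ F.q)))
              (∑-solutions t (·-nondegenerate {t = t} (independent₁ f≉0)) (λ _ → 0#)))))
        where
        t : Vector Carrierᴹ 1
        t = f ∷ []
        tuple : Carrierᴹ → Vector Carrier 1
        tuple z i = t i · z
        g : Carrierᴹ → ℕ
        g z = 𝟙 (tuple z ≟ⁿ (λ _ → 0#))
        g-cong : ∀ {x y} → x ≈ᴹ y → g x ≡ g y
        g-cong x≈y = 𝟙-⇔ (λ e i → F.trans (B-cong ≈ᴹ-refl (≈ᴹ-sym x≈y)) (e i)) (λ e i → F.trans (B-cong ≈ᴹ-refl x≈y)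
            (e i)) _ _
        row : ∀ x → ρ₀ x f ≡ 𝟙 (¬? (x ≟ᴹ 0ᴹ)) * g x
        row x = ≡.trans (𝟙-× (¬? (x ≟ᴹ 0ᴹ)) (¬? (f ≟ᴹ 0ᴹ) ×-dec (x · f ≟ 0#)))
          (≡.cong (𝟙 (¬? (x ≟ᴹ 0ᴹ)) *_) (𝟙-⇔ {𝒫 = ¬ (f ≈ᴹ 0ᴹ) × x · f ≈ 0#} {𝒬 = ∀ i → tuple x i ≈ 0#}
             (λ { (_ , e) zero → F.trans (·-comm f x) e }) (λ e → f≉0 , F.trans (·-comm x f) (e zero)) _ _))
      pairs : ∀ {x y} → ¬ (x ≈ᴹ 0ᴹ) → ¬ (y ∈⟨ x ⟩) → ∑ h (λ f → ρ₀ x f * ρ₀ y f) ≡ l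
      pairs {x} {y} x≉0 y∉ = ≡.trans (∑-cong h row) (drop-0 g g-cong (𝟙-yes (tuple 0ᴹ ≟ⁿ _) (λ i → zeroʳ (t i)))
          (1 ℕ.+ d)
          (ℕ.*-cancelˡ-≡ _ _ F.q {{q-nonZero}} (ℕ.*-cancelˡ-≡ _ _ F.q {{q-nonZero}}
            (≡.trans (≡.sym (ℕ.*-assoc F.q F.q _)) (≡.trans (≡.cong (λ u → F.q * u * ∑ h g) (≡.sym (ℕ.*-identityʳ F.q)))
              (∑-solutions t (·-nondegenerate {t = t} (independent₂ x≉0 y∉)) (λ _ → 0#)))))))
        where
        t : Vector Carrierᴹ 2
        t = y ∷ x ∷ []
        tuple : Carrierᴹ → Vector Carrier 2
        tuple z i = t i · z
        g : Carrierᴹ → ℕ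
        g z = 𝟙 (tuple z ≟ⁿ (λ _ → 0#))
        g-cong : ∀ {x y} → x ≈ᴹ y → g x ≡ g y
        g-cong x≈y = 𝟙-⇔ (λ e i → F.trans (B-cong ≈ᴹ-refl (≈ᴹ-sym x≈y)) (e i)) (λ e i → F.trans (B-cong ≈ᴹ-refl x≈y)
            (e i)) _ _
        y≉0 : ¬ (y ≈ᴹ 0ᴹ)
        y≉0 y≈0 = y∉ (0# , ≈ᴹ-trans y≈0 (≈ᴹ-sym (*ₗ-zeroˡ x)))
        row : ∀ f → ρ₀ x f * ρ₀ y f ≡ 𝟙 (¬? (f ≟ᴹ 0ᴹ)) * g f
        row f = ≡.trans (≡.sym (𝟙-× (nonzero-perp? x f) (nonzero-perp? y f)))
          (≡.trans (𝟙-⇔ {𝒬 = ¬ (f ≈ᴹ 0ᴹ) × (∀ i → tuple f i ≈ 0#)}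
              (λ ((_ , f≉0 , xf) , (_ , _ , yf)) → f≉0 , λ { zero → yf ; (suc zero) → xf })
              (λ (f≉0 , e) → (x≉0 , f≉0 , e (suc zero)) , (y≉0 , f≉0 , e zero))
              (nonzero-perp? x f ×-dec nonzero-perp? y f) (¬? (f ≟ᴹ 0ᴹ) ×-dec (tuple f ≟ⁿ (λ _ → 0#))))
            (𝟙-× (¬? (f ≟ᴹ 0ᴹ)) (tuple f ≟ⁿ (λ _ → 0#))))

-- The symplectic, quadratic and hermitian forms under one interface.

module PolarForms (F : FiniteField c ℓ) (V : LeftModule (FiniteField.ring F) m ℓm)
                  {N : ℕ} (h : HasCard (LeftModule.≈ᴹ-setoid V) N) where
  open FiniteModule F V h
  open Spans F V h
  open F using (Carrier; _≈_; 0#; 1#)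
  open LinearAlgebra F V
  private module R = RingProperties F.ring
  open SetoidReasoning F.setoid

  -- What the counting arguments use of a symplectic, quadratic or hermitian
  -- form: s is the number of singular vectors on an affine line y + ⟨v⟩ with
  -- v singular and y not orthogonal to v.
  record PolarForm : Set (Level.suc (c ⊔ ℓ ⊔ m ⊔ ℓm)) where
    field
      σ             : Carrier → Carrier
      σ-cong        : ∀ {x y} → x ≈ y → σ x ≈ σ y
      σ-involutive  : ∀ x → σ (σ x) ≈ x
      B             : Carrierᴹ → Carrierᴹ → Carrier
      sesquilinear  : IsSesquilinear σ B
      reflexive     : ∀ {x y} → B x y ≈ 0# → B y x ≈ 0#
      Sing          : Carrierᴹ → Set ℓ
      Sing?         : ∀ x → Dec (Sing x)
      Sing-resp     : ∀ {x y} → x ≈ᴹ y → Sing x → Sing y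
      Sing-*        : ∀ a {x} → Sing x → Sing (a *ₗ x)
      Sing-+        : ∀ {x y} → Sing x → Sing y → B x y ≈ 0# → Sing (x +ᴹ y)
      isotropic     : ∀ {x} → Sing x → B x x ≈ 0#
      nondegenerate : ∀ {x} → Sing x → (∀ y → B x y ≈ 0#) → x ≈ᴹ 0ᴹ
      s             : ℕ
      s-nonZero     : NonZero s
      ∑-Sing-line   : ∀ {v y} → Sing v → ¬ (B v y ≈ 0#) → ∑ F.hasCard (λ a → 𝟙 (Sing? (y +ᴹ a *ₗ v))) ≡ s

  private
    0≈ : ∀ {x y z} → x ≈ 0# → y ≈ 0# → x F.+ y ≈ z → z ≈ 0#
    0≈ x≈0 y≈0 e = F.trans (F.sym e) (F.trans (F.+-cong x≈0 y≈0) (F.+-identityˡ 0#))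

    sum≈0ʳ : ∀ {x y} → x F.+ y ≈ 0# → x ≈ 0# → y ≈ 0#
    sum≈0ʳ e x≈0 = F.trans (F.sym (F.+-identityˡ _)) (F.trans (F.+-congʳ (F.sym x≈0)) e)

  -- Every vector is singular, so an affine line has q singular vectors.
  symplecticPolarForm : SymplecticForm → PolarForm
  symplecticPolarForm f = record
    { σ = id ; σ-cong = id ; σ-involutive = λ _ → F.refl
    ; B = B ; sesquilinear = bilinear
    ; reflexive = λ {x} {y} xy≈0 → sum≈0ʳ (F.trans (F.sym (antisymmetric x y)) (alternating (x +ᴹ y))) xy≈0
    ; Sing = λ x → B x x ≈ 0# ; Sing? = λ x → B x x ≟ 0#
    ; Sing-resp = λ _ _ → alternating _ ; Sing-* = λ _ _ → alternating _ ; Sing-+ = λ _ _ _ → alternating _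
    ; isotropic = id ; nondegenerate = λ {x} _ → nondegenerate x
    ; s = F.q ; s-nonZero = q-nonZero
    ; ∑-Sing-line = λ _ _ → ≡.trans (∑-cong F.hasCard (λ a → 𝟙-yes (B _ _ ≟ 0#) (alternating _)))
        (≡.trans (∑-const F.hasCard 1) (ℕ.*-identityʳ _))
    }
    where
    open SymplecticForm f
    open IsSesquilinear bilinear
    antisymmetric : ∀ x y → B (x +ᴹ y) (x +ᴹ y) ≈ B x y F.+ B y x
    antisymmetric x y = F.trans (additiveˡ x y _) (F.+-cong
      (F.trans (additiveʳ x x y) (F.trans (F.+-congʳ (alternating x)) (F.+-identityˡ _)))
      (F.trans (additiveʳ y x y) (F.trans (F.+-congˡ (alternating y)) (F.+-identityʳ _))))

  module QuadraticPolar (f : QuadraticForm) where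
    open QuadraticForm f

    Q-+ : ∀ x y → Q (x +ᴹ y) ≈ polar x y F.+ Q x F.+ Q y
    Q-+ x y = begin
      Q (x +ᴹ y)                                             ≈⟨ F.+-identityʳ _ ⟨
      Q (x +ᴹ y) F.+ 0#                                      ≈⟨ F.+-congˡ (F.-‿inverseˡ (Q x)) ⟨
      Q (x +ᴹ y) F.+ (F.- Q x F.+ Q x)                       ≈⟨ F.+-assoc _ _ _ ⟨
      Q (x +ᴹ y) F.- Q x F.+ Q x ≈⟨ F.+-congʳ (F.trans (F.+-assoc _ _ _) (F.trans (F.+-congˡ (F.-‿inverseˡ (Q y)))
          (F.+-identityʳ _))) ⟨
      Q (x +ᴹ y) F.- Q x F.- Q y F.+ Q y F.+ Q x ≈⟨ F.trans (F.+-assoc _ _ _) (F.trans (F.+-congˡ (F.+-comm _ _))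
          (F.sym (F.+-assoc _ _ _))) ⟩
      Q (x +ᴹ y) F.- Q x F.- Q y F.+ Q x F.+ Q y             ∎

    Q-+-0 : ∀ {x y} → Q x ≈ 0# → Q y ≈ 0# → Q (x +ᴹ y) ≈ polar x y
    Q-+-0 {x} {y} Qx≈0 Qy≈0 = F.trans (Q-+ x y) (F.trans (F.+-cong (F.trans (F.+-congˡ Qx≈0) (F.+-identityʳ _)) Qy≈0)
        (F.+-identityʳ _))

  -- For singular v, Q (y + a v) = a B (v, y) + Q y is linear in a, so one vector of the line is
  -- singular.
  quadraticPolarForm : QuadraticForm → PolarForm
  quadraticPolarForm f = record
    { σ = id ; σ-cong = id ; σ-involutive = λ _ → F.refl
    ; B = polar ; sesquilinear = bilinear
    ; reflexive = λ {x} {y} xy≈0 → F.trans (polar-comm y x) xy≈0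
    ; Sing = λ x → Q x ≈ 0# ; Sing? = λ x → Q x ≟ 0#
    ; Sing-resp = λ x≈y Qx≈0 → F.trans (cong (≈ᴹ-sym x≈y)) Qx≈0
    ; Sing-* = λ a Qx≈0 → F.trans (homogeneous a _) (F.trans (F.*-congˡ Qx≈0) (F.zeroʳ _))
    ; Sing-+ = λ x y e → F.trans (Q-+-0 x y) e
    -- The value B (x, x) equals Q (x + x), a multiple of Q x; this covers every characteristic.
    ; isotropic = λ {x} Qx≈0 → F.trans (F.sym (Q-+-0 Qx≈0 Qx≈0))
        (F.trans (cong (double x)) (F.trans (homogeneous _ x) (F.trans (F.*-congˡ Qx≈0) (F.zeroʳ _))))
    ; nondegenerate = λ {x} → nondegenerate x
    ; s = 1 ; s-nonZero = _
    ; ∑-Sing-line = λ {v} {y} Qv≈0 vy≉0 → ∑-unique F.hasCard (root v y vy≉0) (λ a → Q (y +ᴹ a *ₗ v) ≟ 0#)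
        (λ {a} e → cancel-*ʳ vy≉0 (F.trans (sum≈-Q v y Qv≈0 a e) (F.sym (div-*ʳ vy≉0 _))))
        (λ {a} a≈ → F.trans (expand v y Qv≈0 a) (F.trans (F.+-congʳ (F.trans (F.*-congʳ a≈) (div-*ʳ vy≉0 _)))
            (F.-‿inverseˡ (Q y))))
    }
    where
    open QuadraticForm f
    open QuadraticPolar f
    open IsSesquilinear bilinear using (scalarʳ)
    double : ∀ x → x +ᴹ x ≈ᴹ (1# F.+ 1#) *ₗ x
    double x = ≈ᴹ-sym (≈ᴹ-trans (*ₗ-distribʳ x 1# 1#) (+ᴹ-cong (*ₗ-identityˡ x) (*ₗ-identityˡ x)))
    polar-comm : ∀ x y → polar x y ≈ polar y x
    polar-comm x y = F.trans (F.+-assoc _ _ _) (F.trans (F.+-cong (cong (+ᴹ-comm x y)) (F.+-comm _ _))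
        (F.sym (F.+-assoc _ _ _)))
    root : ∀ v y → ¬ (polar v y ≈ 0#) → Carrier
    root v y vy≉0 = (F.- Q y) F.* vy≉0 ⁻¹
    expand : ∀ v y → Q v ≈ 0# → ∀ a → Q (y +ᴹ a *ₗ v) ≈ a F.* polar v y F.+ Q y
    expand v y Qv≈0 a = F.trans (Q-+ y (a *ₗ v))
        (F.trans (F.+-congˡ (F.trans (homogeneous a v) (F.trans (F.*-congˡ Qv≈0) (F.zeroʳ _))))
      (F.trans (F.+-identityʳ _) (F.+-congʳ (F.trans (scalarʳ a y v) (F.*-congˡ (polar-comm y v))))))
    sum≈-Q : ∀ v y → Q v ≈ 0# → ∀ a → Q (y +ᴹ a *ₗ v) ≈ 0# → a F.* polar v y ≈ F.- Q y
    sum≈-Q v y Qv≈0 a e = R.+-inverseˡ-unique _ _ (F.trans (F.sym (expand v y Qv≈0 a)) e)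

  module HermitianTrace (f : HermitianForm) where
    open HermitianForm f
    open import Algebra.Morphism.Structures using (module RingMorphisms)
    open RingMorphisms.IsRingHomomorphism homomorphism public
      using (0#-homo; 1#-homo; +-homo; *-homo) renaming (⟦⟧-cong to σ-cong)

    -- If all traces vanished, the trace of 1 would give 2 = 0, and then σ a = - a = a for every a,
    -- against `nontrivial`.
    trace≉0 : ∃ λ t → ¬ (t F.+ σ t ≈ 0#)
    trace≉0 = decidable-stable (card-∃? F.hasCard (λ x≈y p e → p (F.trans (F.+-cong x≈y (σ-cong x≈y)) e))
        (λ t → ¬? (t F.+ σ t ≟ 0#)))
      λ none → nontrivial λ a → let
        tr : ∀ t → t F.+ σ t ≈ 0#
        tr t = decidable-stable (t F.+ σ t ≟ 0#) (λ ≉0 → none (t , ≉0))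
        2≈0 : 1# F.+ 1# ≈ 0#
        2≈0 = F.trans (F.+-congˡ (F.sym 1#-homo)) (tr 1#)
        a+a≈0 : a F.+ a ≈ 0#
        a+a≈0 = F.trans (F.+-cong (F.sym (F.*-identityˡ a)) (F.sym (F.*-identityˡ a)))
          (F.trans (F.sym (F.distribʳ a 1# 1#)) (F.trans (F.*-congʳ 2≈0) (F.zeroˡ a)))
        in R.+-cancelˡ a _ _ (F.trans (tr a) (F.sym a+a≈0))

    -- An element t of nonzero trace T is rescaled by g / T, which `σ` fixes because it fixes both g
    -- and T.
    trace-surjective : ∀ g → σ g ≈ g → ∃ λ b → b F.+ σ b ≈ g
    trace-surjective g σg≈g = g F.* T⁻¹ F.* t , (begin
      g F.* T⁻¹ F.* t F.+ σ (g F.* T⁻¹ F.* t) ≈⟨ F.+-congˡ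
          (F.trans (*-homo _ t) (F.*-congʳ (F.trans (*-homo g T⁻¹) (F.*-cong σg≈g σT⁻¹)))) ⟩
      g F.* T⁻¹ F.* t F.+ g F.* T⁻¹ F.* σ t       ≈⟨ F.distribˡ _ t (σ t) ⟨
      g F.* T⁻¹ F.* T                             ≈⟨ div-*ʳ T≉0 g ⟩
      g                                           ∎)
      where
      t = proj₁ trace≉0
      T = t F.+ σ t
      T≉0 = proj₂ trace≉0
      T⁻¹ = T≉0 ⁻¹
      σT : σ T ≈ T
      σT = F.trans (+-homo t (σ t)) (F.trans (F.+-congˡ (involutive t)) (F.+-comm _ _))
      σT⁻¹ : σ T⁻¹ ≈ T⁻¹
      σT⁻¹ = cancel-*ʳ T≉0 (F.trans (F.*-congˡ (F.sym σT)) (F.trans (F.sym (*-homo _ _))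
          (F.trans (σ-cong inv) (F.trans 1#-homo (F.sym inv)))))
        where
        inv : T⁻¹ F.* T ≈ 1#
        inv = F.trans (F.*-comm _ _) (proj₂ (F.inverse T T≉0))

    trace0? : ∀ b → Dec (b F.+ σ b ≈ 0#)
    trace0? b = b F.+ σ b ≟ 0#

    -- The number of elements of trace 0 over the fixed field, which is √q.
    kernelSize : ℕ
    kernelSize = ∑ F.hasCard (λ b → 𝟙 (trace0? b))

    kernelSize≢0 : kernelSize ≢ 0
    kernelSize≢0 e = contradiction (≡.trans (≡.sym (𝟙-yes (trace0? 0#) (F.trans (F.+-identityˡ _) 0#-homo))) (≡.sym
      (∑-≤-≡ F.hasCard {f = λ _ → 0} (λ _ → ≡.refl)
          (λ {x} {y} x≈y → 𝟙-⇔ (F.trans (F.+-cong (F.sym x≈y) (F.sym (σ-cong x≈y))))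
          (F.trans (F.+-cong x≈y (σ-cong x≈y))) (trace0? x) (trace0? y))
      (λ _ → z≤n) (≡.trans (∑-zero F.hasCard (λ _ → ≡.refl)) (≡.sym e)) 0#))) λ ()

    -- Replacing a β by b, and then b by b + b₀ with b₀ of trace g, turns the equation into one for
    -- elements of trace 0.
    ∑-trace : ∀ g → σ g ≈ g → {β : Carrier} → ¬ (β ≈ 0#) → ∑ F.hasCard (λ a → 𝟙 (g F.+ (a F.* β F.+ σ (a F.* β)) ≟ 0#))
        ≡ kernelSize
    ∑-trace g σg≈g {β} β≉0 = ≡.trans
      (∑-reindex F.hasCard F.hasCard (F._* β) (F._* β≉0 ⁻¹)
        (λ e → F.trans (F.*-congʳ e) (div-*ʳ β≉0 _))
        (λ e → cancel-*ʳ β≉0 (F.trans e (F.sym (div-*ʳ β≉0 _))))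
        {f = λ b → 𝟙 (g F.+ (b F.+ σ b) ≟ 0#)}
            (λ {x} {y} e → 𝟙-⇔ (F.trans (F.+-congˡ (F.+-cong (F.sym e) (σ-cong (F.sym e)))))
            (F.trans (F.+-congˡ (F.+-cong e (σ-cong e)))) (_ ≟ 0#) (_ ≟ 0#)))
      (≡.trans (∑-cong F.hasCard (λ b → 𝟙-⇔ (F.trans (shift b)) (F.trans (F.sym (shift b))) (g F.+ (b F.+ σ b) ≟ 0#)
          (trace0? (b F.+ b₀))))
      (∑-reindex F.hasCard F.hasCard (F._+ b₀) (F._- b₀)
        (λ e → F.trans (F.+-congʳ e) (F.trans (F.+-assoc _ _ _) (F.trans (F.+-congˡ (F.-‿inverseˡ b₀))
            (F.+-identityʳ _))))
        (λ e → F.trans (F.sym (F.trans (F.+-assoc _ _ _) (F.trans (F.+-congˡ (F.-‿inverseʳ b₀)) (F.+-identityʳ _))))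
            (F.+-congʳ e))
        {f = λ b → 𝟙 (trace0? b)} (λ {x} {y} x≈y → 𝟙-⇔ (F.trans (F.+-cong (F.sym x≈y) (F.sym (σ-cong x≈y))))
            (F.trans (F.+-cong x≈y (σ-cong x≈y))) (trace0? x) (trace0? y))))
      where
      b₀ = proj₁ (trace-surjective g σg≈g)
      b₀-eq = proj₂ (trace-surjective g σg≈g)
      shift : ∀ b → (b F.+ b₀) F.+ σ (b F.+ b₀) ≈ g F.+ (b F.+ σ b)
      shift b = begin
        (b F.+ b₀) F.+ σ (b F.+ b₀)       ≈⟨ F.+-congˡ (+-homo b b₀) ⟩
        (b F.+ b₀) F.+ (σ b F.+ σ b₀)     ≈⟨ F.+-assoc _ _ _ ⟩
        b F.+ (b₀ F.+ (σ b F.+ σ b₀)) ≈⟨ F.+-congˡ (F.trans (F.+-congˡ (F.+-comm _ _))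
            (F.trans (F.sym (F.+-assoc _ _ _)) (F.+-congʳ b₀-eq))) ⟩
        b F.+ (g F.+ σ b) ≈⟨ F.trans (F.sym (F.+-assoc _ _ _)) (F.trans (F.+-congʳ (F.+-comm _ _)) (F.+-assoc _ _ _)) ⟩
        g F.+ (b F.+ σ b)                 ∎

  -- For singular v, B (y + a v, y + a v) is B (y, y) plus the trace of a B (v, y); the singular
  -- vectors of the line are the solutions of a trace equation.
  hermitianPolarForm : HermitianForm → PolarForm
  hermitianPolarForm f = record
    { σ = σ ; σ-cong = σ-cong ; σ-involutive = involutive
    ; B = B ; sesquilinear = sesquilinear
    ; reflexive = λ {x} {y} xy≈0 → F.trans (conjugate x y) (F.trans (σ-cong xy≈0) 0#-homo)
    ; Sing = λ x → B x x ≈ 0# ; Sing? = λ x → B x x ≟ 0#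
    ; Sing-resp = λ x≈y xx≈0 → F.trans (cong (≈ᴹ-sym x≈y) (≈ᴹ-sym x≈y)) xx≈0
    ; Sing-* = λ a {x} xx≈0 → F.trans (scalarˡ a x _)
        (F.trans (F.*-congˡ (F.trans (scalarʳ a x x) (F.trans (F.*-congˡ xx≈0) (F.zeroʳ _)))) (F.zeroʳ _))
    ; Sing-+ = λ {x} {y} xx≈0 yy≈0 xy≈0 → 0≈ (0≈ xx≈0 xy≈0 (F.sym (additiveʳ x x y)))
                 (0≈ (F.trans (conjugate x y) (F.trans (σ-cong xy≈0) 0#-homo)) yy≈0 (F.sym (additiveʳ y x y)))
                     (F.sym (additiveˡ x y _))
    ; isotropic = id
    ; nondegenerate = λ {x} _ → nondegenerate x
    ; s = kernelSize ; s-nonZero = ℕ.≢-nonZero kernelSize≢0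
    ; ∑-Sing-line = λ {v} {y} vv≈0 vy≉0 → ≡.trans
        (∑-cong F.hasCard (λ a → 𝟙-⇔ (F.trans (F.sym (expand v y vv≈0 a))) (F.trans (expand v y vv≈0 a)) (B _ _ ≟ 0#)
            (B y y F.+ (a F.* B v y F.+ σ (a F.* B v y)) ≟ 0#)))
        (∑-trace (B y y) (F.sym (conjugate y y)) vy≉0)
    }
    where
    open HermitianForm f renaming (hermitian to conjugate)
    open HermitianTrace f
    open IsSesquilinear sesquilinear
    expand : ∀ v y → B v v ≈ 0# → ∀ a → B (y +ᴹ a *ₗ v) (y +ᴹ a *ₗ v) ≈ B y y F.+ (a F.* B v y F.+ σ (a F.* B v y))
    expand v y vv≈0 a = begin
      B (y +ᴹ a *ₗ v) (y +ᴹ a *ₗ v)                                              ≈⟨ additiveˡ y _ _ ⟩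
      B y (y +ᴹ a *ₗ v) F.+ B (a *ₗ v) (y +ᴹ a *ₗ v)                             ≈⟨ F.+-cong
          (F.trans (additiveʳ y y _) (F.+-congˡ (F.trans (scalarʳ a y v) (F.trans (F.*-congˡ (conjugate v y))
              (F.sym (*-homo a _))))))
          (F.trans (scalarˡ a v _) (F.*-congˡ
              (F.trans (additiveʳ v y _) (F.trans
              (F.+-congˡ (F.trans (scalarʳ a v v) (F.trans (F.*-congˡ vv≈0) (F.zeroʳ _)))) (F.+-identityʳ _))))) ⟩
      (B y y F.+ σ (a F.* B v y)) F.+ a F.* B v y ≈⟨ F.trans (F.+-assoc _ _ _) (F.+-congˡ (F.+-comm _ _)) ⟩
      B y y F.+ (a F.* B v y F.+ σ (a F.* B v y))                                ∎

  polarForm : Form → PolarForm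
  polarForm (symplectic f) = symplecticPolarForm f
  polarForm (quadratic f)  = quadraticPolarForm f
  polarForm (hermitian f)  = hermitianPolarForm f

  module _ (form : Form) where
    open PolarForm (polarForm form)

    -- For a quadratic form the hypothesis speaks of `Q` only; orthogonality of x and y follows
    -- because x + y is singular as well.
    totallyIsotropic⇒ : ∀ {k} (W : Subspace k) → TotallyIsotropic form W →
                        (∀ {x} → ⟦ W ⟧ x → Sing x) × (∀ {x y} → ⟦ W ⟧ x → ⟦ W ⟧ y → B x y ≈ 0#)
    totallyIsotropic⇒ = go form
      where
      go : ∀ form {k} (W : Subspace k) → TotallyIsotropic form W →
           (∀ {x} → ⟦ W ⟧ x → PolarForm.Sing (polarForm form) x) × (∀ {x y} → ⟦ W ⟧ x → ⟦ W ⟧ y → PolarForm.B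
               (polarForm form) x y ≈ 0#)
      go (symplectic f) W ti = (λ x∈ → ti _ _ x∈ x∈) , (λ x∈ y∈ → ti _ _ x∈ y∈)
      go (hermitian f)  W ti = (λ x∈ → ti _ _ x∈ x∈) , (λ x∈ y∈ → ti _ _ x∈ y∈)
      go (quadratic f) W ti = (λ x∈ → ti _ x∈) , (λ x∈ y∈ → F.trans (F.sym (QuadraticPolar.Q-+-0 f (ti _ x∈) (ti _ y∈)))
          (ti _ (span-+ (proj₁ W) x∈ y∈)))

    ⇒totallyIsotropic : ∀ {k} (W : Subspace k) → (∀ {x} → ⟦ W ⟧ x → Sing x) → (∀ {x y} → ⟦ W ⟧ x → ⟦ W ⟧ y → B x y ≈ 0#)
        →
                        TotallyIsotropic form W
    ⇒totallyIsotropic = go form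
      where
      go : ∀ form {k} (W : Subspace k) → (∀ {x} → ⟦ W ⟧ x → PolarForm.Sing (polarForm form) x)
          → (∀ {x y} → ⟦ W ⟧ x → ⟦ W ⟧ y → PolarForm.B (polarForm form) x y ≈ 0#) →
           TotallyIsotropic form W
      go (symplectic f) W _ perp = λ x y x∈ y∈ → perp x∈ y∈
      go (hermitian f)  W _ perp = λ x y x∈ y∈ → perp x∈ y∈
      go (quadratic f)  W sing _ = λ x x∈ → sing x∈

-- Counting singular vectors; the parameters of the collinearity graph.

module SingularVectors (F : FiniteField c ℓ) (V : LeftModule (FiniteField.ring F) m ℓm)
                       {N : ℕ} (h : HasCard (LeftModule.≈ᴹ-setoid V) N)
                       (𝐁 : PolarForms.PolarForm F V h) where
  open FiniteModule F V h
  open Spans F V h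
  open F using (_≈_; 0#; 1#)
  open LinearAlgebra F V using (combination; LinearlyIndependent)
  open PolarForms.PolarForm 𝐁 public
  open SesquilinearForm F V h σ σ-cong σ-involutive B sesquilinear public
  open +-*-Solver using (solve; _:+_; _:*_; _:=_)

  infix 4 _⊥?_
  _⊥?_ : ∀ x z → Dec (B x z ≈ 0#)
  x ⊥? z = B x z ≟ 0#

  Sing-0 : ∀ {x} → Sing x → Sing 0ᴹ
  Sing-0 {x} sx = Sing-resp (*ₗ-zeroˡ x) (Sing-* 0# sx)

  Sing-cong : ∀ {x y} → x ≈ᴹ y → 𝟙 (Sing? x) ≡ 𝟙 (Sing? y)
  Sing-cong e = 𝟙-⇔ (Sing-resp e) (Sing-resp (≈ᴹ-sym e)) _ _

  ⊥-cong : ∀ x {y z} → y ≈ᴹ z → 𝟙 (x ⊥? y) ≡ 𝟙 (x ⊥? z)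
  ⊥-cong x e = 𝟙-⇔ (F.trans (B-cong ≈ᴹ-refl (≈ᴹ-sym e))) (F.trans (B-cong ≈ᴹ-refl e)) _ _

  ⊥-translate : ∀ {x u} → B x u ≈ 0# → ∀ a z → B x (z +ᴹ a *ₗ u) ≈ B x z
  ⊥-translate {x} {u} xu≈0 a z = F.trans (additiveʳ x z _)
      (F.trans (F.+-congˡ (F.trans (scalarʳ a x u) (F.trans (F.*-congˡ xu≈0) (F.zeroʳ _)))) (F.+-identityʳ _))

  translate-back : ∀ a u z → (z +ᴹ a *ₗ u) +ᴹ (F.- a) *ₗ u ≈ᴹ z
  translate-back a u z = ≈ᴹ-trans (+ᴹ-assoc _ _ _) (≈ᴹ-trans (+ᴹ-cong ≈ᴹ-refl
    (≈ᴹ-trans (≈ᴹ-sym (*ₗ-distribʳ u a (F.- a))) (≈ᴹ-trans (*ₗ-cong (F.-‿inverseʳ a) ≈ᴹ-refl) (*ₗ-zeroˡ u))))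
        (+ᴹ-identityʳ z))

  module _ {P : Carrierᴹ → Set ℓ₁} (P-resp : P Respects _≈ᴹ_) (P? : ∀ z → Dec (P z)) (u : Carrierᴹ)
           (P-invariant : ∀ a {z} → P z → P (z +ᴹ a *ₗ u)) where
    private
      P-cong : ∀ {x y} → x ≈ᴹ y → 𝟙 (P? x) ≡ 𝟙 (P? y)
      P-cong e = 𝟙-⇔ (P-resp e) (P-resp (≈ᴹ-sym e)) _ _
      P-inv : ∀ a z → 𝟙 (P? (z +ᴹ a *ₗ u)) ≡ 𝟙 (P? z)
      P-inv a z = 𝟙-⇔ (λ p → P-resp (translate-back a u z) (P-invariant (F.- a) p)) (P-invariant a) _ _

    -- `P` is a union of affine lines in direction `u`, none of whose vectors is orthogonal to `u`,
    -- so each of these lines carries `s` singular vectors.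
    singular-fibration : Sing u → (∀ {z} → P z → ¬ (B u z ≈ 0#)) →
                         F.q * ∑ h (λ z → 𝟙 (P? z) * 𝟙 (Sing? z)) ≡ s * ∑ h (λ z → 𝟙 (P? z))
    singular-fibration su ≉0 = ∑-fibration u s P-cong Sing-cong P-inv
        (λ z → 𝟙-guard (P? z) (λ pz → ∑-Sing-line su (≉0 pz)))

    functional-fibration : ∀ {x} → ¬ (B x u ≈ 0#) →
                           F.q * ∑ h (λ z → 𝟙 (P? z) * 𝟙 (x ⊥? z)) ≡ ∑ h (λ z → 𝟙 (P? z))
    functional-fibration {x} xu≉0 = ≡.trans (∑-fibration u 1 P-cong (⊥-cong x) P-inv
        (λ z → ≡.cong (𝟙 (P? z) *_) (∑-line x u xu≉0 0# z))) (ℕ.*-identityˡ _)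

  -- A combination that is orthogonal to everything is singular, and a singular vector in the
  -- radical is zero. This makes the equation count available although `B` itself may be degenerate.
  singular-nondegenerate : ∀ {n} {t : Vector Carrierᴹ n} → LinearlyIndependent t → (∀ a → Sing (combination a t))
      → Nondegenerate t
  singular-nondegenerate ind st a a⊥ = ind a (nondegenerate (st a) a⊥)

  record IsMaximalIsotropic {n : ℕ} (u : Vector Carrierᴹ n) : Set (c ⊔ ℓ ⊔ m ⊔ ℓm) where
    field
      independent : LinearlyIndependent u
      U-sing      : ∀ {x} → Span u x → Sing x
      U-perp      : ∀ {x y} → Span u x → Span u y → B x y ≈ 0#
      U-maximal   : ∀ {z} → Sing z → (∀ i → B (u i) z ≈ 0#) → Span u z

  adj₀ : Carrierᴹ → Carrierᴹ → ℕ
  adj₀ x z = 𝟙 (¬? (z ∈⟨ x ⟩?)) * 𝟙 (x ⊥? z)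

  degree₀ : Carrierᴹ → ℕ
  degree₀ x = ∑ h (λ z → 𝟙 (Sing? z) * adj₀ x z)

  common₀ : Carrierᴹ → Carrierᴹ → ℕ
  common₀ x y = ∑ h (λ z → 𝟙 (Sing? z) * (adj₀ x z * adj₀ y z))

  ∣X∣ : ℕ
  ∣X∣ = ∑ h (λ z → 𝟙 (Sing? z))

  ∣X∩_⊥∣ : Carrierᴹ → ℕ
  ∣X∩ x ⊥∣ = ∑ h (λ z → 𝟙 (Sing? z) * 𝟙 (x ⊥? z))

  ∣X∩_⊥∩_⊥∣ : Carrierᴹ → Carrierᴹ → ℕ
  ∣X∩ x ⊥∩ y ⊥∣ = ∑ h (λ z → 𝟙 (Sing? z) * (𝟙 (x ⊥? z) * 𝟙 (y ⊥? z)))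

  -- The vectors that represent points.
  Proper : Carrierᴹ → Set _
  Proper z = Sing z × ¬ (z ≈ᴹ 0ᴹ)

  proper? : ∀ z → Dec (Proper z)
  proper? z = Sing? z ×-dec ¬? (z ≟ᴹ 0ᴹ)

  proper-resp : ∀ {x y} → x ≈ᴹ y → Proper x → Proper y
  proper-resp e (p , r) = Sing-resp e p , λ y≈0 → r (≈ᴹ-trans e y≈0)

  proper-cong : ∀ {x y} → x ≈ᴹ y → 𝟙 (proper? x) ≡ 𝟙 (proper? y)
  proper-cong e = 𝟙-⇔ (proper-resp e) (proper-resp (≈ᴹ-sym e)) _ _

  -- These count vectors, hence are q - 1 times the numbers of points.
  degree : (Carrierᴹ → Carrierᴹ → ℕ) → Carrierᴹ → ℕ
  degree α x = ∑ h (λ z → 𝟙 (proper? z) * α x z)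

  common : (Carrierᴹ → Carrierᴹ → ℕ) → Carrierᴹ → Carrierᴹ → ℕ
  common α x y = ∑ h (λ z → 𝟙 (proper? z) * (α x z * α y z))

  ∈⟨⟩-perp : ∀ {x y z} → B y x ≈ 0# → z ∈⟨ x ⟩ → B y z ≈ 0#
  ∈⟨⟩-perp yx≈0 (a , e) = F.trans (B-cong ≈ᴹ-refl e) (F.trans (scalarʳ a _ _) (F.trans (F.*-congˡ yx≈0) (F.zeroʳ _)))

  ∈⟨⟩-sing : ∀ {x z} → Sing x → z ∈⟨ x ⟩ → Sing z
  ∈⟨⟩-sing sx (a , e) = Sing-resp (≈ᴹ-sym e) (Sing-* a sx)

  span-perp : ∀ {n} (t : Vector Carrierᴹ n) {x} → (∀ i → B x (t i) ≈ 0#) → ∀ {z} → Span t z → B x z ≈ 0#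
  span-perp t {x} x⊥t (a , e) = F.trans (B-cong ≈ᴹ-refl (≈ᴹ-sym e)) (go t x⊥t a)
    where
    go : ∀ {n} (t : Vector Carrierᴹ n) → (∀ i → B x (t i) ≈ 0#) → ∀ a → B x (combination a t) ≈ 0#
    go {zero}  t x⊥t a = zeroʳ x
    go {suc n} t x⊥t a = F.trans (additiveʳ x _ _)
        (F.trans (F.+-cong (F.trans (scalarʳ _ x _) (F.trans (F.*-congˡ (x⊥t zero)) (F.zeroʳ _)))
        (go (t ∘ suc) (x⊥t ∘ suc) (a ∘ suc))) (F.+-identityˡ _))

  spans-perp : ∀ {n} (t : Vector Carrierᴹ n) → (∀ i j → B (t i) (t j) ≈ 0#) → ∀ {x y} → Span t x → Span t y → B x y ≈ 0#
  spans-perp t t⊥t x∈ y∈ = span-perp t (λ i → reflexive (span-perp t (t⊥t i) x∈)) y∈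

  span-sing : ∀ {n} (t : Vector Carrierᴹ n) → Sing 0ᴹ → (∀ i → Sing (t i)) → (∀ i j → B (t i) (t j) ≈ 0#) → ∀ {x} → Span
      t x → Sing x
  span-sing t s0 st t⊥t (a , e) = Sing-resp e (go t st t⊥t a)
    where
    go : ∀ {n} (t : Vector Carrierᴹ n) → (∀ i → Sing (t i)) → (∀ i j → B (t i) (t j) ≈ 0#) → ∀ a → Sing
        (combination a t)
    go {zero}  t st t⊥t a = s0
    go {suc n} t st t⊥t a = Sing-+ (Sing-* _ (st zero)) (go (t ∘ suc) (st ∘ suc) (λ i j → t⊥t (suc i) (suc j))
        (a ∘ suc))
      (F.trans (scalarˡ _ _ _) (F.trans (F.*-congˡ (span-perp (t ∘ suc) (λ i → t⊥t zero (suc i)) (a ∘ suc , ≈ᴹ-refl)))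
          (F.zeroʳ _)))

  ∷-sing : ∀ {n} {t : Vector Carrierᴹ n} {z} → Sing z → (∀ i → Sing (t i)) → ∀ i → Sing ((z ∷ t) i)
  ∷-sing sz st zero    = sz
  ∷-sing sz st (suc i) = st i

  ∷-perp : ∀ {n} {t : Vector Carrierᴹ n} {z} → Sing z → (∀ i → B (t i) z ≈ 0#) → (∀ i j → B (t i) (t j) ≈ 0#)
      → ∀ i j → B ((z ∷ t) i) ((z ∷ t) j) ≈ 0#
  ∷-perp sz t⊥z t⊥t zero    zero    = isotropic sz
  ∷-perp sz t⊥z t⊥t zero    (suc j) = reflexive (t⊥z j)
  ∷-perp sz t⊥z t⊥t (suc i) zero    = t⊥z i
  ∷-perp sz t⊥z t⊥t (suc i) (suc j) = t⊥t i j

  non-perp : ∀ {x} → Sing x → ¬ (x ≈ᴹ 0ᴹ) → ∃ λ u → ¬ (B x u ≈ 0#)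
  non-perp {x} sx x≉0 = decidable-stable
    (card-∃? h (λ e p q → p (F.trans (B-cong ≈ᴹ-refl e) q)) (λ u → ¬? (x ⊥? u)))
    (λ none → x≉0 (nondegenerate sx (λ y → decidable-stable (x ⊥? y) (λ ≉0 → none (y , ≉0)))))

  ∑-⊥-split : ∀ x (g : Carrierᴹ → ℕ) → ∑ h (λ z → g z * 𝟙 (x ⊥? z)) + ∑ h (λ z → g z * 𝟙 (¬? (x ⊥? z))) ≡ ∑ h g
  ∑-⊥-split x g = ≡.trans (≡.sym (∑-+ h _ _)) (∑-cong h (λ z → ≡.trans (≡.sym (ℕ.*-distribˡ-+ (g z) _ _))
      (≡.trans (≡.cong (g z *_) (𝟙-¬ (x ⊥? z))) (ℕ.*-identityʳ (g z)))))

  module _ {x} (sx : Sing x) (x≉0 : ¬ (x ≈ᴹ 0ᴹ)) where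
    open ≡-Reasoning

    private
      a b e : ℕ
      a = ∑ h (λ z → 𝟙 (x ⊥? z))
      b = ∑ h (λ z → 𝟙 (¬? (x ⊥? z)))
      e = ∑ h (λ z → 𝟙 (Sing? z) * 𝟙 (¬? (x ⊥? z)))

    ∣x⊥∣ : F.q * ∑ h (λ z → 𝟙 (x ⊥? z)) ≡ N
    ∣x⊥∣ = begin
      F.q * ∑ h (λ z → 𝟙 (x ⊥? z)) ≡⟨ ≡.cong (F.q *_)
          (∑-cong h (λ z → ≡.trans (≡.cong (_* 𝟙 (x ⊥? z)) (𝟙-yes (yes tt) tt)) (ℕ.*-identityˡ _))) ⟨
      F.q * ∑ h (λ z → 𝟙 (yes tt) * 𝟙 (x ⊥? z)) ≡⟨ functional-fibration {P = λ _ → ⊤} _ (λ _ → yes tt)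
          (proj₁ (non-perp sx x≉0)) _ (proj₂ (non-perp sx x≉0)) ⟩
      ∑ h (λ z → 𝟙 (yes tt)) ≡⟨ ≡.trans (∑-cong h (λ _ → 𝟙-yes (yes tt) tt)) (≡.trans (∑-const h 1) (ℕ.*-identityʳ N)) ⟩
      N                                                 ∎

    -- Off x⊥ there are N - N / q vectors, of which the fraction s / q is singular, by averaging in
    -- direction x. Denominators and subtractions are cleared.
    ∣X∩x⊥∣-eq : F.q * F.q * ∣X∩ x ⊥∣ + s * (F.q * N) ≡ F.q * F.q * ∣X∣ + s * N
    ∣X∩x⊥∣-eq = begin
      q * q * A + s * (q * N) ≡⟨ ≡.cong (λ t → q * q * A + s * (q * t)) (≡.trans (≡.sym (∑-const-1)) (≡.sym a+b)) ⟩
      q * q * A + s * (q * (a + b)) ≡⟨ solve 5 (λ q A s a b → q :* q :* A :+ s :* (q :* (a :+ b)) := q :* q :* A :+ q :*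
          (s :* b) :+ s :* (q :* a)) ≡.refl q A s a b ⟩
      q * q * A + q * (s * b) + s * (q * a) ≡⟨ ≡.cong₂ (λ t u → q * q * A + q * t + s * u) (≡.sym qe) ∣x⊥∣ ⟩
      q * q * A + q * (q * e) + s * N ≡⟨ solve 4 (λ q A e s → q :* q :* A :+ q :* (q :* e) :+ s := q :* q :*
          (A :+ e) :+ s) ≡.refl q A e (s * N) ⟩
      q * q * (A + e) + s * N ≡⟨ ≡.cong (λ t → q * q * t + s * N) (∑-⊥-split x _) ⟩
      q * q * ∣X∣ + s * N ∎
      where
      q = F.q
      A = ∣X∩ x ⊥∣
      ∑-const-1 : ∑ h (λ _ → 1) ≡ N
      ∑-const-1 = ≡.trans (∑-const h 1) (ℕ.*-identityʳ N)
      a+b : a + b ≡ ∑ h (λ _ → 1)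
      a+b = ≡.trans (≡.sym (∑-+ h _ _)) (∑-cong h (λ z → 𝟙-¬ (x ⊥? z)))
      qe : q * e ≡ s * b
      qe = ≡.trans (≡.cong (q *_) (∑-cong h (λ z → ℕ.*-comm (𝟙 (Sing? z)) _)))
        (singular-fibration {P = λ z → ¬ (B x z ≈ 0#)} (λ e p r → p (F.trans (B-cong ≈ᴹ-refl e) r)) (λ z → ¬? (x ⊥? z))
            x
          (λ α p r → p (F.trans (F.sym (⊥-translate (isotropic sx) α _)) r)) sx id)

    -- The vectors of ⟨x⟩ are singular and orthogonal to x, but not adjacent to x; there are q of
    -- them.
    ∣X∩x⊥∣-degree : degree₀ x + F.q ≡ ∣X∩ x ⊥∣
    ∣X∩x⊥∣-degree = begin
      degree₀ x + F.q ≡⟨ ≡.cong₂ _+_ (∑-cong h (λ z → solve 3 (λ a b c → a :* (b :* c) := b :* (a :* c)) ≡.refl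
          (𝟙 (Sing? z)) (𝟙 (¬? (z ∈⟨ x ⟩?))) (𝟙 (x ⊥? z))))
           (≡.trans (≡.sym (∑-⟨⟩ x≉0)) (∑-cong h (λ z → ≡.trans (≡.sym (ℕ.*-identityʳ _))
               (𝟙-guard (z ∈⟨ x ⟩?) (λ z∈ → ≡.sym (≡.cong₂ _*_ (𝟙-yes (Sing? z) (∈⟨⟩-sing sx z∈))
               (𝟙-yes (x ⊥? z) (∈⟨⟩-perp (isotropic sx) z∈)))))))) ⟩
      ∑ h (λ z → 𝟙 (¬? (z ∈⟨ x ⟩?)) * W z) + ∑ h (λ z → 𝟙 (z ∈⟨ x ⟩?) * W z) ≡⟨ ℕ.+-comm
          (∑ h (λ z → 𝟙 (¬? (z ∈⟨ x ⟩?)) * W z)) _ ⟩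
      ∑ h (λ z → 𝟙 (z ∈⟨ x ⟩?) * W z) + ∑ h (λ z → 𝟙 (¬? (z ∈⟨ x ⟩?)) * W z) ≡⟨ ∑-split h (_∈⟨ x ⟩?) W ⟨
      ∣X∩ x ⊥∣ ∎
      where
      W : Carrierᴹ → ℕ
      W z = 𝟙 (Sing? z) * 𝟙 (x ⊥? z)

    module _ {y} (sy : Sing y) (y≉0 : ¬ (y ≈ᴹ 0ᴹ)) where
      -- Every line in direction x of X ∩ x⊥ meets y⊥ in one vector.
      ∣X∩x⊥∩y⊥∣-noncollinear : ¬ (B x y ≈ 0#) → F.q * ∣X∩ x ⊥∩ y ⊥∣ ≡ ∣X∩ x ⊥∣
      ∣X∩x⊥∩y⊥∣-noncollinear xy≉0 = begin
        F.q * ∣X∩ x ⊥∩ y ⊥∣ ≡⟨ ≡.cong (F.q *_) (∑-cong h (λ z → ≡.trans (≡.sym (ℕ.*-assoc (𝟙 (Sing? z)) _ _))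
            (≡.cong (_* 𝟙 (y ⊥? z)) (≡.sym (𝟙-× (Sing? z) (x ⊥? z)))))) ⟩
        F.q * ∑ h (λ z → 𝟙 (Sing? z ×-dec (x ⊥? z)) * 𝟙 (y ⊥? z)) ≡⟨ functional-fibration
             (λ e (p , r) → Sing-resp e p , F.trans (B-cong ≈ᴹ-refl (≈ᴹ-sym e)) r) (λ z → Sing? z ×-dec (x ⊥? z)) x
             (λ α {z} (p , r) → Sing-+ p (Sing-* α sx)
                 (reflexive (F.trans (scalarˡ α x z) (F.trans (F.*-congˡ r) (F.zeroʳ α)))) , F.trans
                 (⊥-translate (isotropic sx) α z) r)
             (xy≉0 ∘ reflexive) ⟩
        ∑ h (λ z → 𝟙 (Sing? z ×-dec (x ⊥? z))) ≡⟨ ∑-cong h (λ z → 𝟙-× (Sing? z) (x ⊥? z)) ⟩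
        ∣X∩ x ⊥∣ ∎

      -- A vector of ⟨x⟩ orthogonal to y is zero, and so is one of ⟨y⟩ orthogonal to x. The zero
      -- vector is the only one to be removed.
      common₀-noncollinear : ¬ (B x y ≈ 0#) → common₀ x y + 1 ≡ ∣X∩ x ⊥∩ y ⊥∣
      common₀-noncollinear xy≉0 = ≡.trans (≡.cong (common₀ x y +_) (≡.sym (∑-unique h 0ᴹ (_≟ᴹ 0ᴹ) id id)))
        (≡.trans (≡.sym (∑-+ h _ _)) (∑-cong h pointwise))
        where
        pointwise : ∀ z → 𝟙 (Sing? z) * (adj₀ x z * adj₀ y z) + 𝟙 (z ≟ᴹ 0ᴹ) ≡ 𝟙 (Sing? z) * (𝟙 (x ⊥? z) * 𝟙 (y ⊥? z))
        pointwise z = go (z ≟ᴹ 0ᴹ) (x ⊥? z) (y ⊥? z)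
          where
          go : Dec (z ≈ᴹ 0ᴹ) → Dec (B x z ≈ 0#) → Dec (B y z ≈ 0#) → 𝟙 (Sing? z) * (adj₀ x z * adj₀ y z) + 𝟙
              (z ≟ᴹ 0ᴹ) ≡ 𝟙 (Sing? z) * (𝟙 (x ⊥? z) * 𝟙 (y ⊥? z))
          go (yes z≈0) _ _
            rewrite 𝟙-yes (z ≟ᴹ 0ᴹ) z≈0 | 𝟙-yes (Sing? z) (Sing-resp (≈ᴹ-sym z≈0) (Sing-0 sx))
                  | 𝟙-no (¬? (z ∈⟨ x ⟩?)) (λ z∉ → z∉ (∈⟨⟩-resp (≈ᴹ-sym z≈0) ≈ᴹ-refl 0∈⟨ x ⟩))
                  | 𝟙-yes (x ⊥? z) (F.trans (B-cong ≈ᴹ-refl z≈0) (zeroʳ x)) | 𝟙-yes (y ⊥? z)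
                      (F.trans (B-cong ≈ᴹ-refl z≈0) (zeroʳ y)) = ≡.refl
          go (no z≉0) (no xz≉0) _ rewrite 𝟙-no (z ≟ᴹ 0ᴹ) z≉0 | 𝟙-no (x ⊥? z) xz≉0 | ℕ.*-zeroʳ (𝟙 (¬? (z ∈⟨ x ⟩?))) |
              ℕ.*-zeroʳ (𝟙 (Sing? z)) = ≡.refl
          go (no z≉0) (yes _) (no yz≉0) rewrite 𝟙-no (z ≟ᴹ 0ᴹ) z≉0 | 𝟙-no (y ⊥? z) yz≉0 | ℕ.*-zeroʳ (𝟙 (¬? (z ∈⟨ y ⟩?)))
              | ℕ.*-zeroʳ (adj₀ x z) | ℕ.*-zeroʳ (𝟙 (x ⊥? z)) | ℕ.*-zeroʳ (𝟙 (Sing? z)) = ≡.refl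
          go (no z≉0) (yes xz≈0) (yes yz≈0)
            rewrite 𝟙-no (z ≟ᴹ 0ᴹ) z≉0
                  | 𝟙-yes (¬? (z ∈⟨ x ⟩?)) (λ z∈ → xy≉0 (reflexive (∈⟨⟩-perp yz≈0 (∈⟨⟩-sym z≉0 z∈))))
                  | 𝟙-yes (¬? (z ∈⟨ y ⟩?)) (λ z∈ → xy≉0 (∈⟨⟩-perp xz≈0 (∈⟨⟩-sym z≉0 z∈)))
                  | 𝟙-yes (x ⊥? z) xz≈0 | 𝟙-yes (y ⊥? z) yz≈0 = ℕ.+-identityʳ _

      module _ (xy≈0 : B x y ≈ 0#) (x∉⟨y⟩ : ¬ (x ∈⟨ y ⟩)) where
        singular-pair : ∀ α → Sing (combination α (x ∷ y ∷ []))
        singular-pair α = span-sing (x ∷ y ∷ []) (Sing-0 sx) (∷-sing sx (∷-sing {t = []} sy λ ()))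
          (∷-perp sx (λ { zero → reflexive xy≈0 }) (∷-perp {t = []} sy (λ ()) λ ())) (α , ≈ᴹ-refl)

        private
          -- A direction inside x⊥ along which `B y` is not constant; it shows that y⊥ contains the
          -- fraction 1 / q of x⊥.
          separate = solvable (x ∷ y ∷ []) (singular-nondegenerate {t = x ∷ y ∷ []} (independent₂ y≉0 x∉⟨y⟩)
              singular-pair) (0# ∷ 1# ∷ [])
          w : Carrierᴹ
          w = proj₁ separate
          yw≉0 : ¬ (B y w ≈ 0#)
          yw≉0 e = F.0≉1 (F.trans (F.sym e) (proj₂ separate (suc zero)))

        -- Inside x⊥ but off y⊥ there are N / q - N / q² vectors. The direction y stays in x⊥, so
        -- averaging along it makes the fraction s / q of them singular.
        ∣X∩x⊥∩y⊥∣-collinear : F.q * F.q * F.q * ∣X∩ x ⊥∩ y ⊥∣ + s * (F.q * N) ≡ F.q * F.q * F.q * ∣X∩ x ⊥∣ + s * N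
        ∣X∩x⊥∩y⊥∣-collinear = begin
          q * q * q * A₂ + s * (q * N)                            ≡⟨ ≡.cong (λ t → q * q * q * A₂ + s * (q * t)) ∣x⊥∣ ⟨
          q * q * q * A₂ + s * (q * (q * a)) ≡⟨ ≡.cong (λ t → q * q * q * A₂ + s * (q * (q * t))) C+D ⟨
          q * q * q * A₂ + s * (q * (q * (C + D))) ≡⟨ solve 5 (λ q A s C D → q :* q :* q :* A :+ s :*
              (q :* (q :* (C :+ D))) := q :* q :* q :* A :+ q :* q :* (s :* D) :+ s :* (q :* (q :* C))) ≡.refl q A₂ s C
              D ⟩
          q * q * q * A₂ + q * q * (s * D) + s * (q * (q * C)) ≡⟨ ≡.cong₂
              (λ t u → q * q * q * A₂ + q * q * t + s * (q * u)) (≡.sym qE) qC ⟩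
          q * q * q * A₂ + q * q * (q * E) + s * (q * a) ≡⟨ ≡.cong (λ t → q * q * q * A₂ + q * q * (q * E) + s * t) ∣x⊥∣
              ⟩
          q * q * q * A₂ + q * q * (q * E) + s * N ≡⟨ solve 4 (λ q A E n → q :* q :* q :* A :+ q :* q :* (q :* E) :+ n
              := q :* q :* q :* (A :+ E) :+ n) ≡.refl q A₂ E (s * N) ⟩
          q * q * q * (A₂ + E) + s * N                            ≡⟨ ≡.cong (λ t → q * q * q * t + s * N) A₂+E ⟩
          q * q * q * ∣X∩ x ⊥∣ + s * N                            ∎
          where
          q = F.q
          A₂ = ∣X∩ x ⊥∩ y ⊥∣
          C D E : ℕ
          C = ∑ h (λ z → 𝟙 (x ⊥? z) * 𝟙 (y ⊥? z))
          D = ∑ h (λ z → 𝟙 (x ⊥? z) * 𝟙 (¬? (y ⊥? z)))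
          E = ∑ h (λ z → 𝟙 (Sing? z) * 𝟙 (x ⊥? z) * 𝟙 (¬? (y ⊥? z)))
          C+D : C + D ≡ a
          C+D = ∑-⊥-split y _
          qC : q * C ≡ a
          qC = functional-fibration (λ e → F.trans (B-cong ≈ᴹ-refl (≈ᴹ-sym e))) (x ⊥?_) w
              (λ α r → F.trans (⊥-translate (proj₂ separate zero) α _) r) yw≉0
          A₂+E : A₂ + E ≡ ∣X∩ x ⊥∣
          A₂+E = ≡.trans (≡.cong (_+ E) (∑-cong h (λ z → ≡.sym (ℕ.*-assoc (𝟙 (Sing? z)) _ _)))) (∑-⊥-split y _)
          qE : q * E ≡ s * D
          qE = ≡.trans (≡.cong (q *_) (∑-cong h (λ z → ≡.trans (solve 3 (λ a b c → a :* b :* c := b :* c :* a) ≡.refl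
              (𝟙 (Sing? z)) (𝟙 (x ⊥? z)) (𝟙 (¬? (y ⊥? z))))
                (≡.cong (_* 𝟙 (Sing? z)) (≡.sym (𝟙-× (x ⊥? z) (¬? (y ⊥? z))))))))
            (≡.trans (singular-fibration (λ e (p , r) → F.trans (B-cong ≈ᴹ-refl (≈ᴹ-sym e)) p , λ t → r
                (F.trans (B-cong ≈ᴹ-refl e) t)) (λ z → (x ⊥? z) ×-dec ¬? (y ⊥? z)) y
                (λ α (p , r) → F.trans (⊥-translate xy≈0 α _) p , λ t → r
                    (F.trans (F.sym (⊥-translate (isotropic sy) α _)) t)) sy proj₂)
              (≡.cong (s *_) (∑-cong h (λ z → 𝟙-× (x ⊥? z) (¬? (y ⊥? z))))))

        -- The vectors to be removed are those of ⟨x⟩ and ⟨y⟩, two lines that share only the zero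
        -- vector: 2 q - 1 in all.
        common₀-collinear : common₀ x y + (F.q + F.q) ≡ ∣X∩ x ⊥∩ y ⊥∣ + 1
        common₀-collinear = begin
          common₀ x y + (F.q + F.q) ≡⟨ ≡.cong (common₀ x y +_) (≡.cong₂ _+_ (∑-⟨⟩ x≉0) (∑-⟨⟩ y≉0)) ⟨
          common₀ x y + (∑ h (λ z → 𝟙 (z ∈⟨ x ⟩?)) + ∑ h (λ z → 𝟙 (z ∈⟨ y ⟩?))) ≡⟨ ≡.cong (common₀ x y +_) (∑-+ h _ _) ⟨
          common₀ x y + ∑ h (λ z → 𝟙 (z ∈⟨ x ⟩?) + 𝟙 (z ∈⟨ y ⟩?)) ≡⟨ ∑-+ h _ _ ⟨
          ∑ h (λ z → 𝟙 (Sing? z) * (adj₀ x z * adj₀ y z) + (𝟙 (z ∈⟨ x ⟩?) + 𝟙 (z ∈⟨ y ⟩?))) ≡⟨ ∑-cong h pointwise ⟩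
          ∑ h (λ z → 𝟙 (Sing? z) * (𝟙 (x ⊥? z) * 𝟙 (y ⊥? z)) + 𝟙 (z ≟ᴹ 0ᴹ)) ≡⟨ ∑-+ h _ _ ⟩
          ∣X∩ x ⊥∩ y ⊥∣ + ∑ h (λ z → 𝟙 (z ≟ᴹ 0ᴹ)) ≡⟨ ≡.cong (∣X∩ x ⊥∩ y ⊥∣ +_) (∑-unique h 0ᴹ (_≟ᴹ 0ᴹ) id id) ⟩
          ∣X∩ x ⊥∩ y ⊥∣ + 1 ∎
          where
          pointwise : ∀ z → 𝟙 (Sing? z) * (adj₀ x z * adj₀ y z) + (𝟙 (z ∈⟨ x ⟩?) + 𝟙 (z ∈⟨ y ⟩?)) ≡ 𝟙
              (Sing? z) * (𝟙 (x ⊥? z) * 𝟙 (y ⊥? z)) + 𝟙 (z ≟ᴹ 0ᴹ)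
          pointwise z = go (z ∈⟨ x ⟩?) (z ∈⟨ y ⟩?)
            where
            W : ∀ {v} → Sing v → B x v ≈ 0# → B y v ≈ 0# → z ∈⟨ v ⟩ → 𝟙 (Sing? z) * (𝟙 (x ⊥? z) * 𝟙 (y ⊥? z)) ≡ 1
            W sv xv yv z∈ rewrite 𝟙-yes (Sing? z) (∈⟨⟩-sing sv z∈) | 𝟙-yes (x ⊥? z) (∈⟨⟩-perp xv z∈) | 𝟙-yes (y ⊥? z)
                (∈⟨⟩-perp yv z∈) = ≡.refl
            go : Dec (z ∈⟨ x ⟩) → Dec (z ∈⟨ y ⟩) → 𝟙 (Sing? z) * (adj₀ x z * adj₀ y z) + (𝟙 (z ∈⟨ x ⟩?) + 𝟙 (z ∈⟨ y ⟩?))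
                ≡ 𝟙 (Sing? z) * (𝟙 (x ⊥? z) * 𝟙 (y ⊥? z)) + 𝟙 (z ≟ᴹ 0ᴹ)
            go (yes z∈x) (yes z∈y)
              rewrite W sx (isotropic sx) (reflexive xy≈0) z∈x | 𝟙-yes (z ∈⟨ x ⟩?) z∈x | 𝟙-yes (z ∈⟨ y ⟩?) z∈y
                    | 𝟙-no (¬? (z ∈⟨ x ⟩?)) (λ z∉ → z∉ z∈x) | ℕ.*-zeroʳ (𝟙 (Sing? z))
                    | 𝟙-yes (z ≟ᴹ 0ᴹ) (decidable-stable (z ≟ᴹ 0ᴹ) (λ z≉0 → x∉⟨y⟩ (∈⟨⟩-trans (∈⟨⟩-sym z≉0 z∈x) z∈y)))
                        = ≡.refl
            go (yes z∈x) (no z∉y)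
              rewrite W sx (isotropic sx) (reflexive xy≈0) z∈x | 𝟙-yes (z ∈⟨ x ⟩?) z∈x | 𝟙-no (z ∈⟨ y ⟩?) z∉y
                    | 𝟙-no (¬? (z ∈⟨ x ⟩?)) (λ z∉ → z∉ z∈x) | ℕ.*-zeroʳ (𝟙 (Sing? z))
                    | 𝟙-no (z ≟ᴹ 0ᴹ) (λ z≈0 → z∉y (∈⟨⟩-resp (≈ᴹ-sym z≈0) ≈ᴹ-refl 0∈⟨ y ⟩)) = ≡.refl
            go (no z∉x) (yes z∈y)
              rewrite W sy xy≈0 (isotropic sy) z∈y | 𝟙-yes (z ∈⟨ y ⟩?) z∈y | 𝟙-no (z ∈⟨ x ⟩?) z∉x
                    | 𝟙-no (¬? (z ∈⟨ y ⟩?)) (λ z∉ → z∉ z∈y) | ℕ.*-zeroʳ (adj₀ x z) | ℕ.*-zeroʳ (𝟙 (Sing? z))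
                    | 𝟙-no (z ≟ᴹ 0ᴹ) (λ z≈0 → z∉x (∈⟨⟩-resp (≈ᴹ-sym z≈0) ≈ᴹ-refl 0∈⟨ x ⟩)) = ≡.refl
            go (no z∉x) (no z∉y)
              rewrite 𝟙-no (z ∈⟨ x ⟩?) z∉x | 𝟙-no (z ∈⟨ y ⟩?) z∉y | 𝟙-yes (¬? (z ∈⟨ x ⟩?)) z∉x | 𝟙-yes (¬? (z ∈⟨ y ⟩?))
                  z∉y
                    | 𝟙-no (z ≟ᴹ 0ᴹ) (λ z≈0 → z∉x (∈⟨⟩-resp (≈ᴹ-sym z≈0) ≈ᴹ-refl 0∈⟨ x ⟩)) | ℕ.+-identityʳ (𝟙 (x ⊥? z))
                        | ℕ.+-identityʳ (𝟙 (y ⊥? z)) = ≡.refl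

  private
    adj₀-0 : ∀ x {z} → z ≈ᴹ 0ᴹ → adj₀ x z ≡ 0
    adj₀-0 x z≈0 = ≡.cong (_* 𝟙 (x ⊥? _)) (𝟙-no (¬? (_ ∈⟨ x ⟩?)) (λ z∉ → z∉ (∈⟨⟩-resp (≈ᴹ-sym z≈0) ≈ᴹ-refl 0∈⟨ x ⟩)))

    proper-sing : ∀ z {g} → (z ≈ᴹ 0ᴹ → g ≡ 0) → 𝟙 (proper? z) * g ≡ 𝟙 (Sing? z) * g
    proper-sing z {g} g≡0 = go (z ≟ᴹ 0ᴹ)
      where
      go : Dec (z ≈ᴹ 0ᴹ) → 𝟙 (proper? z) * g ≡ 𝟙 (Sing? z) * g
      go (yes e) rewrite g≡0 e = ≡.trans (ℕ.*-zeroʳ (𝟙 (proper? z))) (≡.sym (ℕ.*-zeroʳ (𝟙 (Sing? z))))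
      go (no ¬e) = ≡.cong (_* g) (𝟙-⇔ proj₁ (_, ¬e) (proper? z) (Sing? z))

  degree-adj₀ : ∀ x → degree adj₀ x ≡ degree₀ x
  degree-adj₀ x = ∑-cong h (λ z → proper-sing z (adj₀-0 x))

  common-adj₀ : ∀ x y → common adj₀ x y ≡ common₀ x y
  common-adj₀ x y = ∑-cong h (λ z → proper-sing z (λ z≈0 → ≡.cong (_* adj₀ y z) (adj₀-0 x z≈0)))

  private
    cancel-q : ∀ {m n} → F.q * m ≡ F.q * n → m ≡ n
    cancel-q = ℕ.*-cancelˡ-≡ _ _ F.q {{q-nonZero}}

  module _ {x x′} (sx : Sing x) (x≉0 : ¬ (x ≈ᴹ 0ᴹ)) (sx′ : Sing x′) (x′≉0 : ¬ (x′ ≈ᴹ 0ᴹ)) where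
    -- The equation for this number mentions `x` nowhere else, so two instances of it can be
    -- cancelled against each other. The same reasoning makes the degrees and both kinds of common
    -- neighbour counts constant.
    ∣X∩⊥∣-const : ∣X∩ x ⊥∣ ≡ ∣X∩ x′ ⊥∣
    ∣X∩⊥∣-const = cancel-q (cancel-q (≡.trans (≡.sym (ℕ.*-assoc F.q F.q _)) (≡.trans
      (ℕ.+-cancelʳ-≡ (s * (F.q * N)) _ _ (≡.trans (∣X∩x⊥∣-eq sx x≉0) (≡.sym (∣X∩x⊥∣-eq sx′ x′≉0))))
          (ℕ.*-assoc F.q F.q _))))

    degree₀-const : degree₀ x ≡ degree₀ x′
    degree₀-const = ℕ.+-cancelʳ-≡ F.q _ _ (≡.trans (∣X∩x⊥∣-degree sx x≉0)
        (≡.trans ∣X∩⊥∣-const (≡.sym (∣X∩x⊥∣-degree sx′ x′≉0))))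

    module _ {y y′} (sy : Sing y) (y≉0 : ¬ (y ≈ᴹ 0ᴹ)) (sy′ : Sing y′) (y′≉0 : ¬ (y′ ≈ᴹ 0ᴹ)) where
      common₀-noncollinear-const : ¬ (B x y ≈ 0#) → ¬ (B x′ y′ ≈ 0#) → common₀ x y ≡ common₀ x′ y′
      common₀-noncollinear-const xy≉0 xy′≉0 = ℕ.+-cancelʳ-≡ 1 _ _ (≡.trans (common₀-noncollinear sx x≉0 sy y≉0 xy≉0)
        (≡.trans (cancel-q (≡.trans (∣X∩x⊥∩y⊥∣-noncollinear sx x≉0 sy y≉0 xy≉0)
            (≡.trans ∣X∩⊥∣-const (≡.sym (∣X∩x⊥∩y⊥∣-noncollinear sx′ x′≉0 sy′ y′≉0 xy′≉0)))))
          (≡.sym (common₀-noncollinear sx′ x′≉0 sy′ y′≉0 xy′≉0))))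

      common₀-collinear-const : B x y ≈ 0# → ¬ (x ∈⟨ y ⟩) → B x′ y′ ≈ 0# → ¬ (x′ ∈⟨ y′ ⟩) → common₀ x y ≡ common₀ x′ y′
      common₀-collinear-const xy≈0 x∉y xy′≈0 x∉y′ = ℕ.+-cancelʳ-≡ (F.q + F.q) _ _
          (≡.trans (common₀-collinear sx x≉0 sy y≉0 xy≈0 x∉y)
        (≡.trans (≡.cong (_+ 1) (ℕ.*-cancelˡ-≡ _ _ (F.q * F.q * F.q)
            {{ℕ.m*n≢0 (F.q * F.q) F.q {{ℕ.m*n≢0 F.q F.q {{q-nonZero}} {{q-nonZero}}}} {{q-nonZero}}}}
            (ℕ.+-cancelʳ-≡ (s * (F.q * N)) _ _ (≡.trans (∣X∩x⊥∩y⊥∣-collinear sx x≉0 sy y≉0 xy≈0 x∉y)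
              (≡.trans (≡.cong (λ t → F.q * F.q * F.q * t + s * N) ∣X∩⊥∣-const)
                  (≡.sym (∣X∩x⊥∩y⊥∣-collinear sx′ x′≉0 sy′ y′≉0 xy′≈0 x∉y′)))))))
          (≡.sym (common₀-collinear sx′ x′≉0 sy′ y′≉0 xy′≈0 x∉y′))))

-- Functionals induced on a maximal singular subspace.

module MaximalSubspace
  (F : FiniteField c ℓ) (V : LeftModule (FiniteField.ring F) m ℓm)
  {N : ℕ} (h : HasCard (LeftModule.≈ᴹ-setoid V) N) (𝐁 : PolarForms.PolarForm F V h) (d : ℕ)
  (u : Vector (LeftModule.Carrierᴹ V) (3 ℕ.+ d)) (U-isMaximal : SingularVectors.IsMaximalIsotropic F V h 𝐁 u)
  where

  open FiniteModule F V h
  open Spans F V h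
  open SingularVectors F V h 𝐁
  open IsMaximalIsotropic U-isMaximal public
  open F using (Carrier; _≈_; 0#; 1#)
  open LinearAlgebra F V using (combination)
  open Dot F
  open +-*-Solver using (solve; con; _:+_; _:*_; _:=_)

  n : ℕ
  n = 3 ℕ.+ d
  hn = Fⁿ-card n
  module W = FiniteModule F (Fⁿ n) hn
  module D₀ = HyperplaneDesign d
  module Dn = SesquilinearForm F (Fⁿ n) hn id id (λ _ → F.refl) _·_ (·-sesquilinear n)
  open VectorDesign F (Fⁿ n) hn using (IsVectorDesign; replication; intersection)

  k l : ℕ
  k = D₀.k
  l = D₀.l

  private
    power : ∀ e → F.θ (suc e) * q∸1 + 1 ≡ suc q∸1 * (F.θ e * q∸1 + 1)
    power e = ≡.trans (≡.sym (q^ (suc e))) (≡.cong₂ _*_ q≡1+q∸1 (q^ e))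

  k≡ : k ≡ suc q∸1 * l + q∸1
  k≡ = ℕ.+-cancelʳ-≡ 1 _ _ (≡.trans (power (suc d))
      (solve 2 (λ p l → (con 1 :+ p) :* (l :+ con 1) := (con 1 :+ p) :* l :+ p :+ con 1) ≡.refl q∸1 l))

  q^n≡ : F.q ^ n ≡ suc q∸1 * k + suc q∸1
  q^n≡ = ≡.trans (q^ n) (≡.trans (power (2 ℕ.+ d))
      (solve 2 (λ p k → (con 1 :+ p) :* (k :+ con 1) := (con 1 :+ p) :* k :+ (con 1 :+ p)) ≡.refl q∸1 k))

  -- Here l = q^(1 + d) - 1, and l = 0 would make q a divisor of 1. Rank at least 3 is what makes
  -- the exponent positive.
  l-nonZero : NonZero l
  l-nonZero = ℕ.≢-nonZero λ l≡0 → ℕ.≢-nonZero⁻¹ q∸1 (ℕ.suc-injective (ℕ.m*n≡1⇒m≡1 (suc q∸1) _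
    (≡.trans (≡.sym (power d)) (≡.cong (_+ 1) l≡0))))

  -- The functional that `z` induces on U, in coordinates for the basis `u`; its value at the vector
  -- with coordinates `a` is `a · f z`.
  f : Carrierᴹ → Vector Carrier n
  f z i = B (u i) z

  f-cong : ∀ {x y} → x ≈ᴹ y → f x W.≈ᴹ f y
  f-cong e i = B-cong ≈ᴹ-refl e

  opaque
    unfolding _·_

    B-combination : ∀ a z → B (combination a u) z ≈ a · f z
    B-combination a z = combinationˡ a u z

  f-U : ∀ {x} → Span u x → f x W.≈ᴹ W.0ᴹ
  f-U x∈ i = U-perp (span-basis u i) x∈

  f≈0⇒U : ∀ {z} → Sing z → f z W.≈ᴹ W.0ᴹ → Span u z
  f≈0⇒U = U-maximal

  f-translate : ∀ {v} → Span u v → ∀ α z → f (z +ᴹ α *ₗ v) W.≈ᴹ f z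
  f-translate v∈ α z i = ⊥-translate (U-perp (span-basis u i) v∈) α z

  f-∈⟨⟩ : ∀ {z y} → z ∈⟨ y ⟩ → f z W.∈⟨ f y ⟩
  f-∈⟨⟩ (α , e) = σ α , λ i → F.trans (B-cong ≈ᴹ-refl e) (scalarʳ α (u i) _)

  combination≉0 : ∀ {a} → ¬ (a W.≈ᴹ W.0ᴹ) → ¬ (combination a u ≈ᴹ 0ᴹ)
  combination≉0 a≉0 e = a≉0 (independent _ e)

  private
    U-nondegenerate : Nondegenerate u
    U-nondegenerate = singular-nondegenerate {t = u} independent (λ a → U-sing (a , ≈ᴹ-refl))

    -- The vectors are sorted by the functional they induce.
    ∑-by-functional : (w : Carrierᴹ → ℕ) {G : Vector Carrier n → ℕ} → (∀ {a b} → a W.≈ᴹ b → G a ≡ G b) →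
                      ∑ h (λ z → w z * G (f z)) ≡ ∑ hn (λ b → G b * ∑ h (λ z → 𝟙 (f z ≟ⁿ b) * w z))
    ∑-by-functional w {G} G-cong = begin
      ∑ h (λ z → w z * G (f z)) ≡⟨ ∑-cong h (λ z → ∑-point hn (f z) (λ b → f z ≟ⁿ b) W.≈ᴹ-sym W.≈ᴹ-sym (λ b → w z * G b)
          (λ e → ≡.cong (w z *_) (G-cong e))) ⟨
      ∑ h (λ z → ∑ hn (λ b → 𝟙 (f z ≟ⁿ b) * (w z * G b)))       ≡⟨ ∑-swap h hn _ ⟩
      ∑ hn (λ b → ∑ h (λ z → 𝟙 (f z ≟ⁿ b) * (w z * G b))) ≡⟨ ∑-cong hn
          (λ b → ≡.trans (∑-cong h (λ z → solve 3 (λ i w g → i :* (w :* g) := g :* (i :* w)) ≡.refl (𝟙 (f z ≟ⁿ b)) (w z)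
          (G b))) (∑-*ˡ h (G b) _)) ⟩
      ∑ hn (λ b → G b * ∑ h (λ z → 𝟙 (f z ≟ⁿ b) * w z))         ∎
      where open ≡-Reasoning

    ≟ⁿ-resp : ∀ {b : Vector Carrier n} {x y} → x ≈ᴹ y → (∀ i → f x i ≈ b i) → ∀ i → f y i ≈ b i
    ≟ⁿ-resp e p i = F.trans (B-cong ≈ᴹ-refl (≈ᴹ-sym e)) (p i)

    -- A direction v in U with b (v) nonzero: translations by v preserve the functional because U is
    -- totally isotropic, and no vector inducing b is orthogonal to v. Hence the fraction s / q of
    -- the N / qⁿ vectors inducing b is singular.
    functional-count : ∀ {b} → ¬ (b W.≈ᴹ W.0ᴹ) → F.q ^ n * F.q * ∑ h (λ z → 𝟙 (f z ≟ⁿ b) * 𝟙 (Sing? z)) ≡ s * N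
    functional-count {b} b≉0 = begin
      F.q ^ n * F.q * ∑ h (λ z → 𝟙 (f z ≟ⁿ b) * 𝟙 (Sing? z))    ≡⟨ ℕ.*-assoc (F.q ^ n) F.q _ ⟩
      F.q ^ n * (F.q * ∑ h (λ z → 𝟙 (f z ≟ⁿ b) * 𝟙 (Sing? z))) ≡⟨ ≡.cong (F.q ^ n *_)
          (singular-fibration {P = λ z → ∀ i → f z i ≈ b i} (≟ⁿ-resp {b}) (λ z → f z ≟ⁿ b) v
          (λ α p i → F.trans (f-translate v∈ α _ i) (p i)) (U-sing v∈)
             (λ p vz≈0 → proj₂ separate (F.trans (D₀-cong (W.≈ᴹ-sym p)) (F.trans (F.sym (B-combination a _)) vz≈0)))) ⟩
      F.q ^ n * (s * ∑ h (λ z → 𝟙 (f z ≟ⁿ b))) ≡⟨ solve 3 (λ Q s t → Q :* (s :* t) := s :* (Q :* t)) ≡.refl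
          (F.q ^ n) s _ ⟩
      s * (F.q ^ n * ∑ h (λ z → 𝟙 (f z ≟ⁿ b)))                  ≡⟨ ≡.cong (s *_) (∑-solutions u U-nondegenerate b) ⟩
      s * N                                                     ∎
      where
      open ≡-Reasoning
      D₀-cong : ∀ {x y z} → y W.≈ᴹ z → x · y ≈ x · z
      D₀-cong e = Dn.B-cong W.≈ᴹ-refl e
      separate : ∃ λ a → ¬ (a · b ≈ 0#)
      separate = decidable-stable (card-∃? hn (λ {x} {y} e p r → p (F.trans (Dn.B-cong e W.≈ᴹ-refl) r))
          (λ a → ¬? (a · b ≟ 0#)))
        (λ none → b≉0 (·-radical b (λ a → F.trans (·-comm b a) (decidable-stable (a · b ≟ 0#) (λ ≉0 → none (a , ≉0))))))
      a = proj₁ separate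
      v = combination a u
      v∈ : Span u v
      v∈ = a , ≈ᴹ-refl

    outside-Sing : ∀ z (g : ℕ) → (f z W.≈ᴹ W.0ᴹ → g ≡ 0) → 𝟙 (¬? (span? u z)) * (𝟙 (proper? z) * g) ≡ 𝟙 (Sing? z) * g
    outside-Sing z g g≡0 = go (span? u z) (Sing? z)
      where
      go : Dec (Span u z) → Dec (Sing z) → 𝟙 (¬? (span? u z)) * (𝟙 (proper? z) * g) ≡ 𝟙 (Sing? z) * g
      go (yes z∈) _ rewrite g≡0 (f-U z∈) | ℕ.*-zeroʳ (𝟙 (proper? z)) | ℕ.*-zeroʳ (𝟙 (¬? (span? u z))) | ℕ.*-zeroʳ
          (𝟙 (Sing? z)) = ≡.refl
      go (no z∉) (no ¬sz) rewrite 𝟙-no (proper? z) (¬sz ∘ proj₁) | 𝟙-no (Sing? z) ¬sz = ℕ.*-zeroʳ (𝟙 (¬? (span? u z)))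
      go (no z∉) (yes sz) rewrite 𝟙-yes (proper? z) (sz , λ z≈0 → z∉ (span-resp u (≈ᴹ-sym z≈0) (span-0 u))) | 𝟙-yes
          (Sing? z) sz | 𝟙-yes (¬? (span? u z)) z∉ | ℕ.+-identityʳ g = ℕ.+-identityʳ g

  -- For degrees `G` is a row of the incidence matrix, for common neighbours a product of two rows.
  -- Each nonzero functional is induced by s N / qⁿ⁺¹ singular vectors.
  ∑-outside : {G : Vector Carrier n → ℕ} → (∀ {a b} → a W.≈ᴹ b → G a ≡ G b) → G W.0ᴹ ≡ 0 →
              F.q ^ n * F.q * ∑ h (λ z → 𝟙 (¬? (span? u z)) * (𝟙 (proper? z) * G (f z))) ≡ s * N * ∑ hn G
  ∑-outside {G} G-cong G0≡0 = begin
    F.q ^ n * F.q * ∑ h (λ z → 𝟙 (¬? (span? u z)) * (𝟙 (proper? z) * G (f z))) ≡⟨ ≡.cong (F.q ^ n * F.q *_)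
        (∑-cong h (λ z → outside-Sing z (G (f z)) (λ e → ≡.trans (G-cong e) G0≡0))) ⟩
    F.q ^ n * F.q * ∑ h (λ z → 𝟙 (Sing? z) * G (f z)) ≡⟨ ≡.cong (F.q ^ n * F.q *_)
        (∑-by-functional (λ z → 𝟙 (Sing? z)) G-cong) ⟩
    F.q ^ n * F.q * ∑ hn (λ b → G b * C b)                                          ≡⟨ ∑-*ˡ hn (F.q ^ n * F.q) _ ⟨
    ∑ hn (λ b → F.q ^ n * F.q * (G b * C b))                                        ≡⟨ ∑-cong hn pointwise ⟩
    ∑ hn (λ b → s * N * G b)                                                        ≡⟨ ∑-*ˡ hn (s * N) G ⟩
    s * N * ∑ hn G                                                                  ∎
    where
    open ≡-Reasoning
    C : Vector Carrier n → ℕ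
    C b = ∑ h (λ z → 𝟙 (f z ≟ⁿ b) * 𝟙 (Sing? z))
    pointwise : ∀ b → F.q ^ n * F.q * (G b * C b) ≡ s * N * G b
    pointwise b = go (b W.≟ᴹ W.0ᴹ)
      where
      go : Dec (b W.≈ᴹ W.0ᴹ) → F.q ^ n * F.q * (G b * C b) ≡ s * N * G b
      go (yes b≈0) rewrite ≡.trans (G-cong b≈0) G0≡0 = ≡.trans (ℕ.*-zeroʳ (F.q ^ n * F.q)) (≡.sym (ℕ.*-zeroʳ (s * N)))
      go (no b≉0) = ≡.trans (solve 3 (λ Q g c → Q :* (g :* c) := Q :* c :* g) ≡.refl (F.q ^ n * F.q) (G b) (C b))
          (≡.cong (_* G b) (functional-count b≉0))

  module _ {y} (sy : Sing y) (y∉U : ¬ Span u y) where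
    fy≉0 : ¬ (f y W.≈ᴹ W.0ᴹ)
    fy≉0 e = y∉U (f≈0⇒U sy e)

    private
      -- Pairing a relation with `u i` leaves only the term of `y`, since U is totally isotropic. As
      -- `y` lies outside the maximal U, some such pairing is nonzero, so the coefficient of `y`
      -- vanishes.
      extended-nondegenerate : Nondegenerate (y ∷ u)
      extended-nondegenerate a a⊥ = λ { zero → a₀≈0 ; (suc i) → U-nondegenerate (a ∘ suc)
          (λ z → F.trans (B-cong rest ≈ᴹ-refl) (a⊥ z)) i }
        where
        a₀≈0 : a zero ≈ 0#
        a₀≈0 = decidable-stable (a zero ≟ 0#) λ a₀≉0 → fy≉0 λ i → reflexive (decidable-stable (B y (u i) ≟ 0#) λ yu≉0 →
          *-≉0 a₀≉0 yu≉0 (F.trans (F.sym (F.+-identityʳ _))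
              (F.trans (F.+-cong (F.sym (scalarˡ (a zero) y (u i)))
              (F.sym (U-perp (a ∘ suc , ≈ᴹ-refl) (span-basis u i))))
            (F.trans (F.sym (additiveˡ _ _ (u i))) (a⊥ (u i))))))
        rest : combination (a ∘ suc) u ≈ᴹ combination a (y ∷ u)
        rest = ≈ᴹ-sym (≈ᴹ-trans (+ᴹ-cong (≈ᴹ-trans (*ₗ-cong a₀≈0 ≈ᴹ-refl) (*ₗ-zeroˡ y)) ≈ᴹ-refl) (+ᴹ-identityˡ _))

      perp-functional-count : ∀ {b} → ¬ (b W.∈⟨ f y ⟩) → F.q ^ suc n * F.q * ∑ h
          (λ z → 𝟙 (f z ≟ⁿ b) * (𝟙 (Sing? z) * 𝟙 (y ⊥? z))) ≡ s * N
      perp-functional-count {b} b∉ = begin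
        F.q ^ suc n * F.q * ∑ h (λ z → 𝟙 (f z ≟ⁿ b) * (𝟙 (Sing? z) * 𝟙 (y ⊥? z))) ≡⟨ ℕ.*-assoc (F.q ^ suc n) F.q _ ⟩
        F.q ^ suc n * (F.q * ∑ h (λ z → 𝟙 (f z ≟ⁿ b) * (𝟙 (Sing? z) * 𝟙 (y ⊥? z)))) ≡⟨ ≡.cong
            (λ t → F.q ^ suc n * (F.q * t))
            (∑-cong h (λ z → ≡.trans (solve 3 (λ i s p → i :* (s :* p) := i :* p :* s) ≡.refl (𝟙 (f z ≟ⁿ b))
            (𝟙 (Sing? z)) (𝟙 (y ⊥? z))) (≡.cong (_* 𝟙 (Sing? z)) (merge z)))) ⟩
        F.q ^ suc n * (F.q * ∑ h (λ z → 𝟙 (P? z) * 𝟙 (Sing? z))) ≡⟨ ≡.cong (F.q ^ suc n *_)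
            (singular-fibration {P = P} (λ e p i → F.trans (B-cong ≈ᴹ-refl (≈ᴹ-sym e)) (p i)) P? v
             (λ α p → λ { zero → F.trans (⊥-translate yv≈0 α _) (p zero) ; (suc i) → F.trans (f-translate v∈ α _ i)
                 (p (suc i)) })
             (U-sing v∈) (λ p vz≈0 → F.0≉1 (F.trans (F.sym vz≈0) (F.trans (B-combination a _)
                 (F.trans (Dn.B-cong W.≈ᴹ-refl (λ i → p (suc i))) (F.trans (·-comm a b) (proj₂ separate zero))))))) ⟩
        F.q ^ suc n * (s * ∑ h (λ z → 𝟙 (P? z))) ≡⟨ solve 3 (λ Q s t → Q :* (s :* t) := s :* (Q :* t)) ≡.refl
            (F.q ^ suc n) s _ ⟩
        s * (F.q ^ suc n * ∑ h (λ z → 𝟙 (P? z))) ≡⟨ ≡.cong (s *_) (∑-solutions (y ∷ u) extended-nondegenerate (0# ∷ b))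
            ⟩
        s * N                                                                         ∎
        where
        open ≡-Reasoning
        module Sn = Spans F (Fⁿ n) hn
        P : Carrierᴹ → Set _
        P z = ∀ i → B ((y ∷ u) i) z ≈ (0# ∷ b) i
        P? : ∀ z → Dec (P z)
        P? z = (λ i → B ((y ∷ u) i) z) ≟ⁿ (0# ∷ b)
        merge : ∀ z → 𝟙 (f z ≟ⁿ b) * 𝟙 (y ⊥? z) ≡ 𝟙 (P? z)
        merge z = ≡.trans (≡.sym (𝟙-× (f z ≟ⁿ b) (y ⊥? z))) (𝟙-⇔ {𝒬 = P z} (λ (p , r) → λ { zero → r ; (suc i) → p i })
            (λ p → (λ i → p (suc i)) , p zero) (f z ≟ⁿ b ×-dec (y ⊥? z)) (P? z))
        -- A direction v in U where b takes the value 1 and the functional of y the value 0; it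
        -- exists because b is not a multiple of the latter. Moving along v stays in y⊥ and keeps
        -- the functional.
        separate = Dn.solvable (b ∷ f y ∷ []) (D₀.·-nondegenerate {t = b ∷ f y ∷ []} (Sn.independent₂ fy≉0 b∉))
            (1# ∷ 0# ∷ [])
        a = proj₁ separate
        v = combination a u
        v∈ : Span u v
        v∈ = a , ≈ᴹ-refl
        yv≈0 : B y v ≈ 0#
        yv≈0 = reflexive (F.trans (B-combination a y) (F.trans (·-comm a (f y)) (proj₂ separate (suc zero))))

    -- The number of neighbours of `y` inducing a nonzero multiple of its functional. It is kept as
    -- an unknown: it involves only `y`, U and the form, and so agrees for all designs.
    near : ℕ
    near = ∑ h (λ z → 𝟙 (f z W.∈⟨ f y ⟩?) * (𝟙 (¬? (f z W.≟ᴹ W.0ᴹ)) * (𝟙 (Sing? z) * adj₀ y z)))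

    -- The functionals proportional to that of y contribute the same value of G;
    -- each other functional is attained equally often on y⊥.
    ∑-outside-adj : {G : Vector Carrier n → ℕ} → (∀ {a b} → a W.≈ᴹ b → G a ≡ G b) → G W.0ᴹ ≡ 0 →
                    (∀ {b} → ¬ (b W.≈ᴹ W.0ᴹ) → b W.∈⟨ f y ⟩ → G b ≡ G (f y)) →
                    F.q ^ suc n * F.q * ∑ h (λ z → 𝟙 (¬? (span? u z)) * (𝟙 (proper? z) * (G (f z) * adj₀ y z))) + s * N
                        * (q∸1 * G (f y)) ≡
                    F.q ^ suc n * F.q * (G (f y) * near) + s * N * ∑ hn G
    ∑-outside-adj {G} G-cong G0≡0 G-class = begin
      Q * ∑ h (λ z → 𝟙 (¬? (span? u z)) * (𝟙 (proper? z) * (G (f z) * adj₀ y z))) + s * N * (q∸1 * g)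
        ≡⟨ ≡.cong (λ t → Q * t + s * N * (q∸1 * g))
            (∑-cong h (λ z → outside-Sing z (G (f z) * adj₀ y z)
            (λ e → ≡.cong (_* adj₀ y z) (≡.trans (G-cong e) G0≡0)))) ⟩
      Q * ∑ h body + s * N * (q∸1 * g) ≡⟨ ≡.cong (λ t → Q * t + s * N * (q∸1 * g))
          (∑-split h (λ z → f z W.∈⟨ f y ⟩?) body) ⟩
      Q * (∑ h (λ z → 𝟙 (f z W.∈⟨ f y ⟩?) * body z) + ∑ h (λ z → 𝟙 (¬? (f z W.∈⟨ f y ⟩?)) * body z)) + s * N * (q∸1 * g)
        ≡⟨ ≡.cong (λ t → Q * (t + far) + s * N * (q∸1 * g)) near-eq ⟩
      Q * (g * near + far) + s * N * (q∸1 * g) ≡⟨ solve 5 (λ Q a b s g → Q :* (a :+ b) :+ s :* g := Q :* a :+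
          (Q :* b :+ s :* g)) ≡.refl Q (g * near) far (s * N) (q∸1 * g) ⟩
      Q * (g * near) + (Q * far + s * N * (q∸1 * g)) ≡⟨ ≡.cong (Q * (g * near) +_) far-eq ⟩
      Q * (g * near) + s * N * ∑ hn G ∎
      where
      open ≡-Reasoning
      Q = F.q ^ suc n * F.q
      g = G (f y)
      body : Carrierᴹ → ℕ
      body z = 𝟙 (Sing? z) * (G (f z) * adj₀ y z)
      far : ℕ
      far = ∑ h (λ z → 𝟙 (¬? (f z W.∈⟨ f y ⟩?)) * body z)

      near-eq : ∑ h (λ z → 𝟙 (f z W.∈⟨ f y ⟩?) * body z) ≡ g * near
      near-eq = ≡.trans (∑-cong h pointwise) (∑-*ˡ h g _)
        where
        pointwise : ∀ z → 𝟙 (f z W.∈⟨ f y ⟩?) * body z ≡ g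
            * (𝟙 (f z W.∈⟨ f y ⟩?) * (𝟙 (¬? (f z W.≟ᴹ W.0ᴹ)) * (𝟙 (Sing? z) * adj₀ y z)))
        pointwise z = ≡.trans (𝟙-guard (f z W.∈⟨ f y ⟩?) inner) (solve 3 (λ i g t → i :* (g :* t) := g :* (i :* t))
            ≡.refl (𝟙 (f z W.∈⟨ f y ⟩?)) g _)
          where
          inner : f z W.∈⟨ f y ⟩ → body z ≡ g * (𝟙 (¬? (f z W.≟ᴹ W.0ᴹ)) * (𝟙 (Sing? z) * adj₀ y z))
          inner fz∈ = go (f z W.≟ᴹ W.0ᴹ)
            where
            go : Dec (f z W.≈ᴹ W.0ᴹ) → body z ≡ g * (𝟙 (¬? (f z W.≟ᴹ W.0ᴹ)) * (𝟙 (Sing? z) * adj₀ y z))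
            go (yes e) rewrite ≡.trans (G-cong e) G0≡0 | 𝟙-no (¬? (f z W.≟ᴹ W.0ᴹ)) (λ ¬e → ¬e e) | ℕ.*-zeroʳ
                (𝟙 (Sing? z)) = ≡.sym (ℕ.*-zeroʳ g)
            go (no ¬e) rewrite 𝟙-yes (¬? (f z W.≟ᴹ W.0ᴹ)) ¬e | G-class ¬e fz∈ = solve 3 (λ s g t → s :* (g :* t) := g :*
                (s :* t :+ con 0)) ≡.refl (𝟙 (Sing? z)) g (adj₀ y z)

      G∉ : Vector Carrier n → ℕ
      G∉ b = 𝟙 (¬? (b W.∈⟨ f y ⟩?)) * G b
      G∉-cong : ∀ {a b} → a W.≈ᴹ b → G∉ a ≡ G∉ b
      G∉-cong {a} {b} e = ≡.cong₂ _*_ (𝟙-⇔ (_∘ W.∈⟨⟩-resp (W.≈ᴹ-sym e) W.≈ᴹ-refl) (_∘ W.∈⟨⟩-resp e W.≈ᴹ-refl)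
          (¬? (a W.∈⟨ f y ⟩?)) (¬? (b W.∈⟨ f y ⟩?))) (G-cong e)

      far-eq : Q * far + s * N * (q∸1 * g) ≡ s * N * ∑ hn G
      far-eq = begin
        Q * far + s * N * (q∸1 * g) ≡⟨ ≡.cong (λ t → Q * t + s * N * (q∸1 * g)) (≡.trans (∑-cong h pointwise)
            (∑-by-functional (λ z → 𝟙 (Sing? z) * 𝟙 (y ⊥? z)) G∉-cong)) ⟩
        Q * ∑ hn (λ b → G∉ b * C b) + s * N * (q∸1 * g) ≡⟨ ≡.cong (_+ s * N * (q∸1 * g)) (∑-*ˡ hn Q _) ⟨
        ∑ hn (λ b → Q * (G∉ b * C b)) + s * N * (q∸1 * g) ≡⟨ ≡.cong (_+ s * N * (q∸1 * g)) (∑-cong hn count) ⟩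
        ∑ hn (λ b → s * N * G∉ b) + s * N * (q∸1 * g) ≡⟨ ≡.cong (_+ s * N * (q∸1 * g)) (∑-*ˡ hn (s * N) G∉) ⟩
        s * N * ∑ hn G∉ + s * N * (q∸1 * g) ≡⟨ ℕ.*-distribˡ-+ (s * N) _ _ ⟨
        s * N * (∑ hn G∉ + q∸1 * g) ≡⟨ ≡.cong (s * N *_) (ℕ.+-comm (∑ hn G∉) _) ⟩
        s * N * (q∸1 * g + ∑ hn G∉) ≡⟨ ≡.cong (λ t → s * N * (t + ∑ hn G∉)) class-eq ⟨
        s * N * (∑ hn (λ b → 𝟙 (b W.∈⟨ f y ⟩?) * G b) + ∑ hn G∉) ≡⟨ ≡.cong (s * N *_) (∑-split hn (W._∈⟨ f y ⟩?) G) ⟨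
        s * N * ∑ hn G ∎
        where
        C : Vector Carrier n → ℕ
        C b = ∑ h (λ z → 𝟙 (f z ≟ⁿ b) * (𝟙 (Sing? z) * 𝟙 (y ⊥? z)))
        pointwise : ∀ z → 𝟙 (¬? (f z W.∈⟨ f y ⟩?)) * body z ≡ 𝟙 (Sing? z) * 𝟙 (y ⊥? z) * G∉ (f z)
        -- If the functional of z is not a multiple of that of y, then z is not a multiple of y, and
        -- `adj₀` reduces to orthogonality.
        pointwise z = ≡.trans (𝟙-guard (¬? (f z W.∈⟨ f y ⟩?))
            (λ fz∉ → ≡.cong (λ t → 𝟙 (Sing? z) * (G (f z) * (t * 𝟙 (y ⊥? z)))) (𝟙-yes (¬? (z ∈⟨ y ⟩?)) (fz∉ ∘ f-∈⟨⟩))))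
          (solve 4 (λ i s g p → i :* (s :* (g :* (con 1 :* p))) := s :* p :* (i :* g)) ≡.refl (𝟙 (¬? (f z W.∈⟨ f y ⟩?)))
              (𝟙 (Sing? z)) (G (f z)) (𝟙 (y ⊥? z)))
        count : ∀ b → Q * (G∉ b * C b) ≡ s * N * G∉ b
        count b = ≡.trans (solve 4 (λ Q i g c → Q :* (i :* g :* c) := i :* (Q :* c :* g)) ≡.refl Q
            (𝟙 (¬? (b W.∈⟨ f y ⟩?))) (G b) (C b))
          (≡.trans (𝟙-guard (¬? (b W.∈⟨ f y ⟩?)) (λ b∉ → ≡.cong (_* G b) (perp-functional-count b∉)))
            (solve 3 (λ i s g → i :* (s :* g) := s :* (i :* g)) ≡.refl (𝟙 (¬? (b W.∈⟨ f y ⟩?))) (s * N) (G b)))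
        class-eq : ∑ hn (λ b → 𝟙 (b W.∈⟨ f y ⟩?) * G b) ≡ q∸1 * g
        class-eq = ≡.trans (∑-cong hn pt) (≡.trans (∑-*ʳ hn _ g) (≡.cong (_* g) (W.∑-⟨⟩≉0 fy≉0)))
          where
          pt : ∀ b → 𝟙 (b W.∈⟨ f y ⟩?) * G b ≡ 𝟙 (¬? (b W.≟ᴹ W.0ᴹ)) * 𝟙 (b W.∈⟨ f y ⟩?) * g
          pt b = go (b W.≟ᴹ W.0ᴹ)
            where
            go : Dec (b W.≈ᴹ W.0ᴹ) → 𝟙 (b W.∈⟨ f y ⟩?) * G b ≡ 𝟙 (¬? (b W.≟ᴹ W.0ᴹ)) * 𝟙 (b W.∈⟨ f y ⟩?) * g
            go (yes e) rewrite ≡.trans (G-cong e) G0≡0 | 𝟙-no (¬? (b W.≟ᴹ W.0ᴹ)) (λ ¬e → ¬e e) = ℕ.*-zeroʳ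
                (𝟙 (b W.∈⟨ f y ⟩?))
            go (no ¬e) rewrite 𝟙-yes (¬? (b W.≟ᴹ W.0ᴹ)) ¬e | ℕ.+-identityʳ (𝟙 (b W.∈⟨ f y ⟩?)) = 𝟙-guard (b W.∈⟨ f y ⟩?)
                (λ b∈ → G-class ¬e b∈)

  -- Each nonzero functional, for instance the one with all coordinates 1, is induced by some
  -- singular vector, since s N is not zero; a vector of U would induce 0.
  ∃-outside : ∃ λ y → Proper y × ¬ Span u y
  ∃-outside = z , (proj₂ (proj₂ witness) , λ z≈0 → z∉U (span-resp u (≈ᴹ-sym z≈0) (span-0 u))) , z∉U
    where
    one : Vector Carrier n
    one _ = 1#
    one≉0 : ¬ (one W.≈ᴹ W.0ᴹ)
    one≉0 e = F.0≉1 (F.sym (e zero))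
    inhabited : ∀ {N} → Fin N → NonZero N
    inhabited zero    = _
    inhabited (suc _) = _
    sN≢0 : s * N ≢ 0
    sN≢0 = ℕ.≢-nonZero⁻¹ (s * N) {{ℕ.m*n≢0 s N {{s-nonZero}} {{inhabited (Inverse.to h 0ᴹ)}}}}
    P : Carrierᴹ → Set _
    P z = (∀ i → f z i ≈ one i) × Sing z
    P? : ∀ z → Dec (P z)
    P? z = (f z ≟ⁿ one) ×-dec Sing? z
    witness : ∃ P
    witness = decidable-stable (card-∃? h (λ e (p , r) → ≟ⁿ-resp {one} e p , Sing-resp e r) P?)
      (λ none → sN≢0 (≡.trans (≡.sym (functional-count one≉0)) (≡.trans (≡.cong (F.q ^ n * F.q *_) (∑-zero h (λ z →
            ≡.trans (≡.sym (𝟙-× (f z ≟ⁿ one) (Sing? z))) (𝟙-no (P? z) (λ p → none (z , p))))))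
                (ℕ.*-zeroʳ (F.q ^ n * F.q)))))
    z = proj₁ witness
    z∉U : ¬ Span u z
    z∉U z∈ = F.0≉1 (F.trans (F.sym (f-U z∈ zero)) (proj₁ (proj₂ witness) zero))

  -- ρ a b stands for: the point of U with coordinates a lies in the block of
  -- the functional b.  The choice ρ₀ of a · b ≈ 0# gives Γ₀.
  record IsAdjacency (ρ : Vector Carrier n → Vector Carrier n → ℕ) (α : Carrierᴹ → Carrierᴹ → ℕ) : Set (c ⊔ ℓ ⊔ m ⊔ ℓm) where
    field
      α-cong  : ∀ x {z z′} → z ≈ᴹ z′ → α x z ≡ α x z′
      in-in   : ∀ {x z} → Proper x → Proper z → Span u x → Span u z → α x z ≡ 𝟙 (¬? (z ∈⟨ x ⟩?))
      out-out : ∀ {x z} → Proper x → Proper z → ¬ Span u x → ¬ Span u z → α x z ≡ adj₀ x z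
      in-out  : ∀ {x z a} → Proper x → Proper z → combination a u ≈ᴹ x → ¬ Span u z → α x z ≡ ρ a (f z)
      out-in  : ∀ {x z a} → Proper x → Proper z → ¬ Span u x → combination a u ≈ᴹ z → α x z ≡ ρ a (f x)

  combination-coordinate≉0 : ∀ {x a} → Proper x → combination a u ≈ᴹ x → ¬ (a W.≈ᴹ W.0ᴹ)
  combination-coordinate≉0 (_ , x≉0) e a≈0 = x≉0
      (≈ᴹ-trans (≈ᴹ-sym e) (≈ᴹ-trans (combination-cong u a≈0) (combination-0 u)))

  -- A vector of U is never a multiple of a vector outside or conversely, so for mixed pairs
  -- adjacency is just orthogonality, which is incidence of coordinates with the functional.
  adj₀-isAdjacency : IsAdjacency D₀.ρ₀ adj₀
  adj₀-isAdjacency = record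
    { α-cong = λ x {z} {z′} e → ≡.cong₂ _*_ (𝟙-⇔ (_∘ ∈⟨⟩-resp (≈ᴹ-sym e) ≈ᴹ-refl) (_∘ ∈⟨⟩-resp e ≈ᴹ-refl)
        (¬? (z ∈⟨ x ⟩?)) (¬? (z′ ∈⟨ x ⟩?))) (⊥-cong x e)
    ; in-in = λ {x} {z} _ _ x∈ z∈ → ≡.trans (≡.cong (𝟙 (¬? (z ∈⟨ x ⟩?)) *_) (𝟙-yes (x ⊥? z) (U-perp x∈ z∈))) (ℕ.*-identityʳ _)
    ; out-out = λ _ _ _ _ → ≡.refl
    ; in-out = λ {x} {z} {a} px pz e z∉ → ≡.trans (≡.cong (_* 𝟙 (x ⊥? z)) (𝟙-yes (¬? (z ∈⟨ x ⟩?)) (λ (α , z≈) → z∉ (span-resp u (≈ᴹ-sym z≈) (span-* u α (a , e))))))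
        (≡.trans (ℕ.*-identityˡ _) (incidence px pz e z∉))
    ; out-in = λ {x} {z} {a} px pz x∉ e → ≡.trans (≡.cong (_* 𝟙 (x ⊥? z)) (𝟙-yes (¬? (z ∈⟨ x ⟩?)) (λ z∈ → let (α , x≈) = ∈⟨⟩-sym (proj₂ pz) z∈ in x∉ (span-resp u (≈ᴹ-sym x≈) (span-* u α (a , e))))))
        (≡.trans (ℕ.*-identityˡ _) (≡.trans (𝟙-⇔ reflexive reflexive (x ⊥? z) (z ⊥? x)) (incidence pz px e x∉)))
    }
    where
    incidence : ∀ {x z a} → Proper x → Proper z → combination a u ≈ᴹ x → ¬ Span u z → 𝟙 (x ⊥? z) ≡ D₀.ρ₀ a (f z)
    incidence {x} {z} {a} px pz e z∉ = 𝟙-⇔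
      (λ xz≈0 → combination-coordinate≉0 px e , fy≉0 (proj₁ pz) z∉ , F.trans (F.sym (B-combination a z))
          (F.trans (B-cong e ≈ᴹ-refl) xz≈0))
      (λ (_ , _ , p) → F.trans (B-cong (≈ᴹ-sym e) ≈ᴹ-refl) (F.trans (B-combination a z) p))
      (x ⊥? z) (D₀.nonzero-perp? a (f z))

  private
    P : ℕ
    P = q∸1

    X* : Carrierᴹ → ℕ
    X* z = 𝟙 (proper? z)

    X*U : Vector Carrier n → ℕ
    X*U a = 𝟙 (proper? (combination a u))

    out : (Carrierᴹ → ℕ) → ℕ
    out g = ∑ h (λ z → 𝟙 (¬? (span? u z)) * (X* z * g z))

    inn : (Vector Carrier n → ℕ) → ℕ
    inn g = ∑ hn (λ a → X*U a * g a)

    split-U : {g : Carrierᴹ → ℕ} → (∀ {x y} → x ≈ᴹ y → g x ≡ g y) →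
              ∑ h (λ z → X* z * g z) ≡ inn (λ a → g (combination a u)) + out g
    split-U {g} g-cong = ≡.trans (∑-split h (span? u) _)
        (≡.cong (_+ out g) (∑-span u independent (λ e → ≡.cong₂ _*_ (proper-cong e) (g-cong e))))

    out-cong : {g g′ : Carrierᴹ → ℕ} → (∀ {z} → Proper z → ¬ Span u z → g z ≡ g′ z) → out g ≡ out g′
    out-cong {g} {g′} e = ∑-cong h (λ z → 𝟙-guard (¬? (span? u z)) (λ z∉ → 𝟙-guard (proper? z) (λ pz → e pz z∉)))

    inn-cong : {g g′ : Vector Carrier n → ℕ} → (∀ {a} → Proper (combination a u) → g a ≡ g′ a) → inn g ≡ inn g′
    inn-cong {g} {g′} e = ∑-cong hn (λ a → 𝟙-guard (proper? (combination a u)) e)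

    X*U-value : ∀ a → ¬ (a W.≈ᴹ W.0ᴹ) → X*U a ≡ 1
    X*U-value a a≉0 = 𝟙-yes (proper? (combination a u)) (U-sing (a , ≈ᴹ-refl) , combination≉0 a≉0)

    inn-all : {g : Vector Carrier n → ℕ} → (∀ {a} → a W.≈ᴹ W.0ᴹ → g a ≡ 0) → inn g ≡ ∑ hn g
    inn-all {g} g0 = ∑-cong hn (λ a → go a (a W.≟ᴹ W.0ᴹ))
      where
      go : ∀ a → Dec (a W.≈ᴹ W.0ᴹ) → X*U a * g a ≡ g a
      go a (yes e) rewrite g0 e = ℕ.*-zeroʳ (X*U a)
      go a (no ¬e) rewrite X*U-value a ¬e = ℕ.*-identityˡ (g a)

  -- Degrees and common neighbours in terms of the incidence matrix.

  module Adjacency {ρ α} (D : IsVectorDesign k l ρ) (A : IsAdjacency ρ α) where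
    open IsVectorDesign D
    open IsAdjacency A

    ρ-vanishes : ∀ {a} b → a W.≈ᴹ W.0ᴹ → ρ a b ≡ 0
    ρ-vanishes b a≈0 = ≡.trans (ρ-cong a≈0 W.≈ᴹ-refl) (ρ-zeroˡ b)

    -- The summand inside U does not involve `ρ`, and the one outside is determined by the number of
    -- blocks on a point. `O` stays implicit in its equation; two such equations are later
    -- cancelled.
    degree-in : ∀ {x} → Proper x → Span u x →
                ∃ λ O → degree α x ≡ inn (λ b → 𝟙 (¬? (combination b u ∈⟨ x ⟩?))) + O × F.q ^ n * F.q * O ≡ s * N * k
    degree-in {x} px (a , e) = out (λ z → ρ a (f z))
      , ≡.trans (split-U (α-cong x)) (≡.cong₂ _+_
          (inn-cong (λ {b} pb → in-in px pb (a , e) (b , ≈ᴹ-refl)))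
          (out-cong (λ pz z∉ → in-out px pz e z∉)))
      , ≡.trans (∑-outside (ρ-cong W.≈ᴹ-refl) (ρ-zeroʳ a))
          (≡.cong (s * N *_) (replication D {{l-nonZero}} k≡ q^n≡ (combination-coordinate≉0 px e)))

    degree-out : ∀ {x} → Proper x → ¬ Span u x → degree α x ≡ k + out (adj₀ x)
    degree-out {x} px x∉ = ≡.trans (split-U (α-cong x)) (≡.cong₂ _+_
      (≡.trans (inn-cong (λ {b} pb → out-in px pb x∉ ≈ᴹ-refl)) (≡.trans (inn-all (ρ-vanishes (f x))) (blockSize (fy≉0 (proj₁ px) x∉))))
      (out-cong (λ pz z∉ → out-out px pz x∉ z∉)))

    common-cong : ∀ x y {z z′} → z ≈ᴹ z′ → α x z * α y z ≡ α x z′ * α y z′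
    common-cong x y e = ≡.cong₂ _*_ (α-cong x e) (α-cong y e)

    common-in-in : ∀ {x y} → Proper x → Proper y → Span u x → Span u y → ¬ (y ∈⟨ x ⟩) →
                   ∃ λ O → common α x y ≡ inn (λ b → 𝟙 (¬? (combination b u ∈⟨ x ⟩?)) * 𝟙
                       (¬? (combination b u ∈⟨ y ⟩?))) + O × F.q ^ n * F.q * O ≡ s * N * l
    common-in-in {x} {y} px py (a , e) (b , e′) y∉x = out (λ z → ρ a (f z) * ρ b (f z))
      , ≡.trans (split-U (common-cong x y)) (≡.cong₂ _+_
          (inn-cong (λ {b′} pb → ≡.cong₂ _*_ (in-in px pb (a , e) (b′ , ≈ᴹ-refl)) (in-in py pb (b , e′) (b′ , ≈ᴹ-refl))))
          (out-cong (λ pz z∉ → ≡.cong₂ _*_ (in-out px pz e z∉) (in-out py pz e′ z∉))))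
      , ≡.trans (∑-outside (λ e → ≡.cong₂ _*_ (ρ-cong W.≈ᴹ-refl e) (ρ-cong W.≈ᴹ-refl e))
          (≡.cong (_* ρ b W.0ᴹ) (ρ-zeroʳ a)))
          (≡.cong (s * N *_) (pairCount (combination-coordinate≉0 px e) b∉a))
      where
      b∉a : ¬ (b W.∈⟨ a ⟩)
      b∉a (α , b≈) = y∉x (α , ≈ᴹ-trans (≈ᴹ-sym e′) (≈ᴹ-trans (combination-cong u b≈) (≈ᴹ-trans (combination-* α a u)
          (*ₗ-cong F.refl e))))

    -- The common neighbours inside U are the vectors on two blocks. Proportional functionals have
    -- the same block, others meet in `l` vectors; outside U the design has no influence.
    common-out-out : ∀ {x y} → Proper x → Proper y → ¬ Span u x → ¬ Span u y →
                     ∃ λ I → common α x y ≡ I + out (λ z → adj₀ x z * adj₀ y z) × (f y W.∈⟨ f x ⟩ → I ≡ k) ×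
                         (¬ (f y W.∈⟨ f x ⟩) → I ≡ l)
    common-out-out {x} {y} px py x∉ y∉ = ∑ hn (λ a → ρ a (f x) * ρ a (f y))
      , ≡.trans (split-U (common-cong x y)) (≡.cong₂ _+_
          (≡.trans (inn-cong (λ {b} pb → ≡.cong₂ _*_ (out-in px pb x∉ ≈ᴹ-refl) (out-in py pb y∉ ≈ᴹ-refl))) (inn-all (λ a≈0 → ≡.cong (_* ρ _ (f y)) (ρ-vanishes (f x) a≈0))))
          (out-cong (λ pz z∉ → ≡.cong₂ _*_ (out-out px pz x∉ z∉) (out-out py pz y∉ z∉))))
      , (λ fy∈ → ≡.trans (∑-cong hn (λ a → ≡.trans (≡.cong (ρ a (f x) *_) (ρ-classʳ a (fy≉0 (proj₁ py) y∉ , fy∈)))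
          (idem a (f x)))) (blockSize (fy≉0 (proj₁ px) x∉)))
      , intersection D {{l-nonZero}} k≡ q^n≡ (fy≉0 (proj₁ px) x∉)

    -- Inside U the block of `y` is counted, less the q - 1 multiples of `x` if these lie on it.
    -- Both equations retain of the design only the bit `ρ a (f y)`.
    common-in-out : ∀ {x y a} (px : Proper x) (py : Proper y) → combination a u ≈ᴹ x → (y∉ : ¬ Span u y) →
                    ∃ λ I → ∃ λ O → common α x y ≡ I + O × I + P * ρ a (f y) ≡ k ×
                      F.q ^ suc n * F.q * O + s * N * (P * ρ a (f y)) ≡ F.q ^ suc n * F.q * (ρ a (f y) * near
                          (proj₁ py) y∉) + s * N * k
    common-in-out {x} {y} {a} px py e y∉ = inn (λ b → 𝟙 (¬? (combination b u ∈⟨ x ⟩?)) * ρ b (f y)) , out (λ z → ρ a (f z) * adj₀ y z)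
      , ≡.trans (split-U (common-cong x y)) (≡.cong₂ _+_
          (inn-cong (λ {b} pb → ≡.cong₂ _*_ (in-in px pb (a , e) (b , ≈ᴹ-refl)) (out-in py pb y∉ ≈ᴹ-refl)))
          (out-cong (λ pz z∉ → ≡.cong₂ _*_ (in-out px pz e z∉) (out-out py pz y∉ z∉))))
      , I-eq
      , ≡.trans (∑-outside-adj (proj₁ py) y∉ (ρ-cong W.≈ᴹ-refl) (ρ-zeroʳ a) (λ b≉0 b∈ → ρ-classʳ a (b≉0 , b∈)))
          (≡.cong (λ t → F.q ^ suc n * F.q * (ρ a (f y) * near (proj₁ py) y∉) + s * N * t)
              (replication D {{l-nonZero}} k≡ q^n≡ a≉0))
      where
      a≉0 = combination-coordinate≉0 px e
      to-coordinates : ∀ {b} → combination b u ∈⟨ x ⟩ → b W.∈⟨ a ⟩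
      to-coordinates {b} (β , eq) = β , combination-injective u independent
          (≈ᴹ-trans eq (≈ᴹ-sym (≈ᴹ-trans (combination-* β a u) (*ₗ-cong F.refl e))))
      from-coordinates : ∀ {b} → b W.∈⟨ a ⟩ → combination b u ∈⟨ x ⟩
      from-coordinates {b} (β , eq) = β , ≈ᴹ-trans (combination-cong u eq) (≈ᴹ-trans (combination-* β a u)
          (*ₗ-cong F.refl e))
      pointwise : ∀ b → X*U b * (𝟙 (¬? (combination b u ∈⟨ x ⟩?)) * ρ b (f y)) + 𝟙 (¬? (b W.≟ᴹ W.0ᴹ)) * 𝟙 (b W.∈⟨ a ⟩?)
          * ρ a (f y) ≡ ρ b (f y)
      pointwise b = go (b W.≟ᴹ W.0ᴹ) (b W.∈⟨ a ⟩?)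
        where
        go : Dec (b W.≈ᴹ W.0ᴹ) → Dec (b W.∈⟨ a ⟩) → X*U b * (𝟙 (¬? (combination b u ∈⟨ x ⟩?)) * ρ b (f y)) + 𝟙
            (¬? (b W.≟ᴹ W.0ᴹ)) * 𝟙 (b W.∈⟨ a ⟩?) * ρ a (f y) ≡ ρ b (f y)
        go (yes b≈0) _ rewrite ρ-vanishes (f y) b≈0 | 𝟙-no (¬? (b W.≟ᴹ W.0ᴹ)) (λ ¬e → ¬e b≈0) | ℕ.*-zeroʳ
            (𝟙 (¬? (combination b u ∈⟨ x ⟩?))) | ℕ.*-zeroʳ (X*U b) = ≡.refl
        go (no b≉0) (yes b∈) rewrite 𝟙-no (¬? (combination b u ∈⟨ x ⟩?)) (λ b∉ → b∉ (from-coordinates b∈)) | ℕ.*-zeroʳ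
            (X*U b)
             | 𝟙-yes (¬? (b W.≟ᴹ W.0ᴹ)) b≉0 | 𝟙-yes (b W.∈⟨ a ⟩?) b∈ = ≡.trans (ℕ.+-identityʳ _)
                 (≡.sym (ρ-classˡ (f y) (b≉0 , b∈)))
        go (no b≉0) (no b∉) rewrite 𝟙-yes (¬? (combination b u ∈⟨ x ⟩?)) (b∉ ∘ to-coordinates) | X*U-value b b≉0
             | 𝟙-no (b W.∈⟨ a ⟩?) b∉ | ℕ.*-zeroʳ (𝟙 (¬? (b W.≟ᴹ W.0ᴹ))) = ≡.trans (ℕ.+-identityʳ _)
                 (≡.trans (ℕ.+-identityʳ _) (ℕ.+-identityʳ _))
      I-eq : inn (λ b → 𝟙 (¬? (combination b u ∈⟨ x ⟩?)) * ρ b (f y)) + P * ρ a (f y) ≡ k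
      I-eq = ≡.trans (≡.cong (inn (λ b → 𝟙 (¬? (combination b u ∈⟨ x ⟩?)) * ρ b (f y)) +_)
          (≡.sym (≡.trans (∑-*ʳ hn _ (ρ a (f y))) (≡.cong (_* ρ a (f y)) (W.∑-⟨⟩≉0 a≉0)))))
        (≡.trans (≡.sym (∑-+ hn _ _)) (≡.trans (∑-cong hn pointwise) (blockSize (fy≉0 (proj₁ py) y∉))))

  module Compare {ρ α ρ′ α′} (D : IsVectorDesign k l ρ) (A : IsAdjacency ρ α) (D′ : IsVectorDesign k l ρ′) (A′ : IsAdjacency ρ′ α′) where
    private
      module L = Adjacency D A
      module R = Adjacency D′ A′

      Q-nonZero : ∀ e → NonZero (F.q ^ e * F.q)
      Q-nonZero e = ℕ.m*n≢0 (F.q ^ e) F.q {{ℕ.m^n≢0 F.q e {{q-nonZero}}}} {{q-nonZero}}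

      compare : ∀ e {I I′ O O′ t m m′} → m ≡ I + O → F.q ^ e * F.q * O ≡ t → m′ ≡ I′ + O′ → F.q ^ e * F.q * O′ ≡ t
          → I ≡ I′ → m ≡ m′
      compare e m≡ O≡ m′≡ O′≡ I≡ = ≡.trans m≡
          (≡.trans (≡.cong₂ _+_ I≡ (ℕ.*-cancelˡ-≡ _ _ (F.q ^ e * F.q) {{Q-nonZero e}} (≡.trans O≡ (≡.sym O′≡))))
          (≡.sym m′≡))

    degree-≡ : ∀ {x} → Proper x → degree α x ≡ degree α′ x
    degree-≡ {x} px with span? u x
    ... | yes x∈ = let (_ , e , o) = L.degree-in px x∈ ; (_ , e′ , o′) = R.degree-in px x∈ in compare n e o e′ o′ ≡.refl
    ... | no x∉ = ≡.trans (L.degree-out px x∉) (≡.sym (R.degree-out px x∉))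

    common-in-in-≡ : ∀ {x y} → Proper x → Proper y → Span u x → Span u y → ¬ (y ∈⟨ x ⟩) → common α x y ≡ common α′ x y
    common-in-in-≡ px py x∈ y∈ y∉x = let (_ , e , o) = L.common-in-in px py x∈ y∈ y∉x ; (_ , e′ , o′) = R.common-in-in px py x∈ y∈ y∉x in compare n e o e′ o′ ≡.refl

    common-out-out-≡ : ∀ {x y} → Proper x → Proper y → ¬ Span u x → ¬ Span u y → common α x y ≡ common α′ x y
    common-out-out-≡ {x} {y} px py x∉ y∉ = ≡.trans (proj₁ (proj₂ LL))
        (≡.trans (≡.cong (_+ out (λ z → adj₀ x z * adj₀ y z)) (go (f y W.∈⟨ f x ⟩?))) (≡.sym (proj₁ (proj₂ RR))))
      where
      LL = L.common-out-out px py x∉ y∉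
      RR = R.common-out-out px py x∉ y∉
      go : Dec (f y W.∈⟨ f x ⟩) → proj₁ LL ≡ proj₁ RR
      go (yes fy∈) = ≡.trans (proj₁ (proj₂ (proj₂ LL)) fy∈) (≡.sym (proj₁ (proj₂ (proj₂ RR)) fy∈))
      go (no fy∉)  = ≡.trans (proj₂ (proj₂ (proj₂ LL)) fy∉) (≡.sym (proj₂ (proj₂ (proj₂ RR)) fy∉))

    -- The points `x` and `x′` are allowed to differ, since the same pair may be adjacent in one
    -- graph and not in the other; what has to match is the bit.
    common-in-out-≡ : ∀ {x x′ y a a′} → Proper x → Proper x′ → Proper y → combination a u ≈ᴹ x → combination a′ u ≈ᴹ x′ → ¬ Span u y →
                      ρ a (f y) ≡ ρ′ a′ (f y) → common α x y ≡ common α′ x′ y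
    common-in-out-≡ {y = y} {a} {a′} px px′ py e e′ y∉ bit =
      let (I , O , c≡ , I≡ , O≡) = L.common-in-out px py e y∉
          (I′ , O′ , c′≡ , I′≡ , O′≡) = R.common-in-out px′ py e′ y∉
          O≡O′ : F.q ^ suc n * F.q * O ≡ F.q ^ suc n * F.q * O′
          O≡O′ = ℕ.+-cancelʳ-≡ (s * N * (P * ρ a (f y))) _ _
              (≡.trans O≡ (≡.trans (≡.cong (λ t → F.q ^ suc n * F.q * (t * near (proj₁ py) y∉) + s * N * k) bit)
            (≡.trans (≡.sym O′≡) (≡.cong (λ t → F.q ^ suc n * F.q * O′ + s * N * (P * t)) (≡.sym bit)))))
          I≡I′ : I ≡ I′
          I≡I′ = ℕ.+-cancelʳ-≡ (P * ρ a (f y)) _ _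
              (≡.trans I≡ (≡.trans (≡.sym I′≡) (≡.cong (λ t → I′ + P * t) (≡.sym bit))))
      in compare (suc n) c≡ O≡O′ c′≡ ≡.refl I≡I′

  module _ {ρ} (D : IsVectorDesign k l ρ) {b : Vector Carrier n} (b≉0 : ¬ (b W.≈ᴹ W.0ᴹ)) where
    open IsVectorDesign D

    ∃-incident : ∃ λ a → ρ a b ≢ 0
    ∃-incident = decidable-stable (card-∃? hn (λ e p r → p (≡.trans (ρ-cong e W.≈ᴹ-refl) r)) (λ a → ¬? (ρ a b ℕ.≟ 0)))
      (λ none → k≢0 (≡.trans (≡.sym (blockSize b≉0))
          (∑-zero hn (λ a → decidable-stable (ρ a b ℕ.≟ 0) (λ ≢0 → none (a , ≢0))))))
      where
      k≢0 : k ≢ 0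
      k≢0 k≡0 = ℕ.≢-nonZero⁻¹ q∸1 (ℕ.m+n≡0⇒n≡0 (suc q∸1 * l) (≡.trans (≡.sym k≡) k≡0))

    -- If every nonzero vector lay on the block, then qⁿ = k + 1, whereas qⁿ = q (k + 1) and q > 1.
    ∃-nonincident : ∃ λ a → ¬ (a W.≈ᴹ W.0ᴹ) × ρ a b ≡ 0
    ∃-nonincident = decidable-stable
        (card-∃? hn (λ e (p , r) → (λ z → p (W.≈ᴹ-trans e z)) , ≡.trans (ρ-cong (W.≈ᴹ-sym e) W.≈ᴹ-refl) r)
        (λ a → ¬? (a W.≟ᴹ W.0ᴹ) ×-dec (ρ a b ℕ.≟ 0)))
      (λ none → ℕ.≢-nonZero⁻¹ q∸1 (ℕ.m+n≡0⇒n≡0 (q∸1 * k) (ℕ.+-cancelʳ-≡ 1 _ _ (ℕ.+-cancelˡ-≡ k _ _ (begin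
        k + (q∸1 * k + q∸1 + 1) ≡⟨ solve 2 (λ p k → k :+ (p :* k :+ p :+ con 1) := (con 1 :+ p) :* k :+ (con 1 :+ p))
            ≡.refl q∸1 k ⟩
        suc q∸1 * k + suc q∸1                        ≡⟨ q^n≡ ⟨
        F.q ^ n                                      ≡⟨ ≡.trans (∑-const hn 1) (ℕ.*-identityʳ _) ⟨
        ∑ hn (λ _ → 1)                               ≡⟨ W.∑-0 (λ _ → ≡.refl) ⟩
        1 + ∑ hn (λ a → 𝟙 (¬? (a W.≟ᴹ W.0ᴹ)) * 1)    ≡⟨ ≡.cong suc (∑-cong hn (λ a → incident a (λ p → none (a , p)))) ⟩
        1 + ∑ hn (λ a → ρ a b)                       ≡⟨ ≡.cong suc (blockSize b≉0) ⟩
        1 + k                                        ≡⟨ ℕ.+-comm 1 k ⟩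
        k + 1                                        ∎)))))
      where
      open ≡-Reasoning
      idempotent : ∀ n → n * n ≡ n → n ≢ 0 → n ≡ 1
      idempotent zero    _ ≢0 = contradiction ≡.refl ≢0
      idempotent (suc n) e _  = ℕ.*-cancelˡ-≡ (suc n) 1 (suc n) (≡.trans e (≡.sym (ℕ.*-identityʳ (suc n))))
      incident : ∀ a → ¬ (¬ (a W.≈ᴹ W.0ᴹ) × ρ a b ≡ 0) → 𝟙 (¬? (a W.≟ᴹ W.0ᴹ)) * 1 ≡ ρ a b
      incident a none = go (a W.≟ᴹ W.0ᴹ)
        where
        go : Dec (a W.≈ᴹ W.0ᴹ) → 𝟙 (¬? (a W.≟ᴹ W.0ᴹ)) * 1 ≡ ρ a b
        go (yes e) rewrite 𝟙-no (¬? (a W.≟ᴹ W.0ᴹ)) (λ ¬e → ¬e e) = ≡.sym (≡.trans (ρ-cong e W.≈ᴹ-refl) (ρ-zeroˡ b))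
        go (no ¬e) rewrite 𝟙-yes (¬? (a W.≟ᴹ W.0ᴹ)) ¬e = ≡.sym (idempotent (ρ a b) (idem a b) (λ ρ≡0 → none (¬e , ρ≡0)))

-- Points as classes of vectors, and cardinalities of sets of points.

module VectorSpaceCard (F : FiniteField c ℓ) (V : LeftModule (FiniteField.ring F) m ℓm) where
  open FieldProperties F
  open LeftModule V
  open Combinations F V
  open LinearAlgebra F V

  card : (fd : FiniteDimensional) → HasCard ≈ᴹ-setoid (F.q ^ proj₁ fd)
  card (n , (t , t-ind) , all) = record
    { to = λ x → to (proj₁ (all x))
    ; from = λ i → combination (from i) t
    ; to-cong = λ {x} {y} x≈y → to-cong (combination-injective t t-ind
        (≈ᴹ-trans (proj₂ (all x)) (≈ᴹ-trans x≈y (≈ᴹ-sym (proj₂ (all y))))))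
    ; from-cong = λ { ≡.refl → ≈ᴹ-refl }
    ; inverse = (λ {i} {x} x≈ → ≡.trans (to-cong (combination-injective t t-ind (≈ᴹ-trans (proj₂ (all x)) x≈)))
        (strictlyInverseˡ i))
              , (λ { {x} ≡.refl → ≈ᴹ-trans (combination-cong t (strictlyInverseʳ (proj₁ (all x)))) (proj₂ (all x)) })
    }
    where open Inverse (Fⁿ-card n)

module Points (𝐏 : PolarSpace c ℓ m ℓm) where
  open PolarSpace 𝐏
  open Geometry 𝐏

  h : HasCard (LeftModule.≈ᴹ-setoid space) _
  h = VectorSpaceCard.card field′ space finiteDimensional

  module PF = PolarForms field′ space h
  open FiniteModule field′ space h hiding (q∸1)
  open FieldProperties field′ using (q∸1)
  open Spans field′ space h
  open SingularVectors field′ space h (PF.polarForm form)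
  open Setoid points using (_≈_; _≉_) renaming (Carrier to Point)

  rep : Point → Carrierᴹ
  rep ((t , _) , _) = t zero

  rep-proper : ∀ x → Proper (rep x)
  rep-proper ((t , ind) , ti) = proj₁ (PF.totallyIsotropic⇒ form (t , ind) ti) (span-basis t zero) , basis≉0 t ind zero

  point : ∀ {z} → Proper z → Point
  point {z} (sz , z≉0) = W , PF.⇒totallyIsotropic form W
      (λ x∈ → ∈⟨⟩-sing sz (span₁⇒∈⟨⟩ (z ∷ []) x∈))
      (λ x∈ y∈ → reflexive (∈⟨⟩-perp (reflexive (∈⟨⟩-perp (isotropic sz) (span₁⇒∈⟨⟩ (z ∷ []) y∈)))
          (span₁⇒∈⟨⟩ (z ∷ []) x∈)))
    where
    W : Subspace 1
    W = z ∷ [] , independent₁ z≉0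

  ≈⇒∈⟨⟩ : ∀ x y → x ≈ y → rep x ∈⟨ rep y ⟩
  ≈⇒∈⟨⟩ ((t , _) , _) ((s , _) , _) (x⊆y , _) = span₁⇒∈⟨⟩ s (x⊆y (span-basis t zero))

  ∈⟨⟩⇒≈ : ∀ x y → rep x ∈⟨ rep y ⟩ → x ≈ y
  ∈⟨⟩⇒≈ x@((t , _) , _) y@((s , _) , _) x∈y =
    (λ z∈ → ∈⟨⟩⇒span₁ s (∈⟨⟩-trans (span₁⇒∈⟨⟩ t z∈) x∈y)) ,
    (λ z∈ → ∈⟨⟩⇒span₁ t (∈⟨⟩-trans (span₁⇒∈⟨⟩ s z∈) (∈⟨⟩-sym (proj₂ (rep-proper x)) x∈y)))

  on⇒span : ∀ {k} (W : Subspace k) x → x on W → Span (proj₁ W) (rep x)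
  on⇒span W ((t , _) , _) x⊆W = x⊆W (span-basis t zero)

  span⇒on : ∀ {k} (W : Subspace k) x → Span (proj₁ W) (rep x) → x on W
  span⇒on (s , _) ((t , _) , _) x∈W z∈ with a , z≈ ← span₁⇒∈⟨⟩ t z∈ = span-resp s (≈ᴹ-sym z≈) (span-* s a x∈W)

  infix 4 _≟ₚ_ _on?_
  _≟ₚ_ : B.Decidable _≈_
  x ≟ₚ y = map′ (∈⟨⟩⇒≈ x y) (≈⇒∈⟨⟩ x y) (rep x ∈⟨ rep y ⟩?)

  _on?_ : ∀ {k} x (W : Subspace k) → Dec (x on W)
  x on? W = map′ (span⇒on W x) (on⇒span W x) (span? (proj₁ W) (rep x))

  collinear⇒⊥ : ∀ x y → Collinear x y → F._≈_ (B (rep x) (rep y)) F.0#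
  collinear⇒⊥ x y (ℒ , ti , x∈ , y∈) = proj₂ (PF.totallyIsotropic⇒ form ℒ ti) (on⇒span ℒ x x∈) (on⇒span ℒ y y∈)

  ⊥⇒collinear : ∀ x y → x ≉ y → F._≈_ (B (rep x) (rep y)) F.0# → Collinear x y
  ⊥⇒collinear x y x≉y xy≈0 = ℒ
      , PF.⇒totallyIsotropic form ℒ (span-sing t (Sing-0 sx)
          (∷-sing sx (∷-sing {t = []} sy λ ())) t⊥t) (spans-perp t t⊥t)
      , span⇒on ℒ x (span-basis t zero) , span⇒on ℒ y (span-basis t (suc zero))
    where
    sx = proj₁ (rep-proper x)
    sy = proj₁ (rep-proper y)
    t : Vector Carrierᴹ 2
    t = rep x ∷ rep y ∷ []
    t⊥t : ∀ i j → F._≈_ (B (t i) (t j)) F.0#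
    t⊥t = ∷-perp sx (λ { zero → reflexive xy≈0 }) (∷-perp {t = []} sy (λ ()) λ ())
    ℒ : Subspace 2
    ℒ = t , independent₂ (proj₂ (rep-proper y)) (λ x∈y → x≉y (∈⟨⟩⇒≈ x y x∈y))

  ⊥⇒perp : ∀ x y → (x ⊥) y → F._≈_ (B (rep x) (rep y)) F.0#
  ⊥⇒perp x y (inj₁ y≈x) = ∈⟨⟩-perp (isotropic (proj₁ (rep-proper x))) (≈⇒∈⟨⟩ y x y≈x)
  ⊥⇒perp x y (inj₂ c)   = reflexive (collinear⇒⊥ y x c)

  perp⇒⊥ : ∀ x y → F._≈_ (B (rep x) (rep y)) F.0# → (x ⊥) y
  perp⇒⊥ x y xy≈0 = go (y ≟ₚ x)
    where
    go : Dec (y ≈ x) → (x ⊥) y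
    go (yes y≈x) = inj₁ y≈x
    go (no y≉x)  = inj₂ (⊥⇒collinear y x y≉x (reflexive xy≈0))

  module PointSet {P : Pred Point ℓ₁} (P-resp : P Respects _≈_) (P? : ∀ x → Dec (P x)) where
    private
      pick : ∀ {z} → Dec (Proper z) → ℕ
      pick (yes pz) = 𝟙 (P? (point pz))
      pick (no _)   = 0

    opaque
      -- The point set lifted to vectors: all representatives of its points count, and vectors that
      -- represent no point do not.
      χ : Carrierᴹ → ℕ
      χ z = pick (proper? z)

      χ-point : ∀ x {z} → z ≈ᴹ rep x → χ z ≡ 𝟙 (P? x)
      χ-point x {z} z≈ = go (proper? z)
        where
        go : (d : Dec (Proper z)) → pick d ≡ 𝟙 (P? x)
        go (yes pz) = 𝟙-⇔ (P-resp z≈x) (P-resp {x} (Setoid.sym points {point pz} {x} z≈x)) _ _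
          where
          z≈x : point pz ≈ x
          z≈x = ∈⟨⟩⇒≈ (point pz) x (∈⟨⟩-resp (≈ᴹ-sym z≈) ≈ᴹ-refl (v∈⟨v⟩ (rep x)))
        go (no ¬pz) = contradiction (proper-resp (≈ᴹ-sym z≈) (rep-proper x)) ¬pz

      χ-improper : ∀ {z} → ¬ Proper z → χ z ≡ 0
      χ-improper {z} ¬pz = go (proper? z)
        where
        go : (d : Dec (Proper z)) → pick d ≡ 0
        go (yes pz) = contradiction pz ¬pz
        go (no _)   = ≡.refl

    Subset = Subsetoid points P
    open Setoid Subset using () renaming (Carrier to Element; _≈_ to _≈ₛ_)

    private
      candidates : ∀ {z} → Dec (Proper z) → List Element
      candidates (no _) = List.[]
      candidates (yes pz) with P? (point pz)
      ... | yes Pz = List.[ point pz , Pz ]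
      ... | no _   = List.[]

      -- All vectors are run through, so each point of the set occurs once for every one of its q -
      -- 1 representatives; `finite` removes the repetitions.
      elements : List Element
      elements = List.concatMap (λ i → candidates (proper? (Inverse.from h i))) (List.allFin _)

      found : ∀ x {z} (d : Dec (Proper z)) → z ≈ᴹ rep (proj₁ x) → Any.Any (x ≈ₛ_) (candidates d)
      found (x , Px) (no ¬pz) z≈ = contradiction (proper-resp (≈ᴹ-sym z≈) (rep-proper x)) ¬pz
      found (x , Px) {z} (yes pz) z≈ with P? (point pz)
      ... | yes Pz = Any.here x≈z
        where
        x≈z : x ≈ point pz
        x≈z = ∈⟨⟩⇒≈ x (point pz) (∈⟨⟩-resp z≈ ≈ᴹ-refl (v∈⟨v⟩ z))
      ... | no ¬Pz = contradiction (P-resp {x} x≈z Px) ¬Pz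
        where
        x≈z : x ≈ point pz
        x≈z = ∈⟨⟩⇒≈ x (point pz) (∈⟨⟩-resp z≈ ≈ᴹ-refl (v∈⟨v⟩ z))

      card : ∃ λ m → HasCard Subset m
      card = finite Subset (λ x y → proj₁ x ≟ₚ proj₁ y) elements λ x →
        Any.concatMap⁺ _ (Any.tabulate⁺ (Inverse.to h (rep (proj₁ x)))
          (found x (proper? _) (Inverse.strictlyInverseʳ h (rep (proj₁ x)))))

      count-eq : ∀ {m} → HasCard Subset m → ∑ h χ ≡ m * q∸1
      count-eq k = ∑-classes h k {R = λ z x → Proper z × z ∈⟨ rep (proj₁ x) ⟩} R? χ q∸1 row column
        where
        R? : ∀ z (x : Element) → Dec (Proper z × z ∈⟨ rep (proj₁ x) ⟩)
        R? z x = proper? z ×-dec (z ∈⟨ rep (proj₁ x) ⟩?)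
        row : ∀ z → χ z ≡ ∑ k (λ x → 𝟙 (R? z x))
        row z = go (proper? z)
          where
          go : Dec (Proper z) → χ z ≡ ∑ k (λ x → 𝟙 (R? z x))
          go (no ¬pz) = ≡.trans (χ-improper ¬pz) (≡.sym (∑-zero k (λ x → 𝟙-no (R? z x) (¬pz ∘ proj₁))))
          go (yes pz) = ≡.trans (χ-point (point pz) ≈ᴹ-refl) (go′ (P? (point pz)))
            where
            go′ : Dec (P (point pz)) → 𝟙 (P? (point pz)) ≡ ∑ k (λ x → 𝟙 (R? z x))
            go′ (yes Pz) = ≡.trans (𝟙-yes _ Pz) (≡.sym (∑-unique k (point pz , Pz) (R? z)
              (λ {x} r → Setoid.sym points {point pz} {proj₁ x} (∈⟨⟩⇒≈ (point pz) (proj₁ x) (proj₂ r)))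
              (λ {x} x≈ → pz , ≈⇒∈⟨⟩ (point pz) (proj₁ x) (Setoid.sym points {proj₁ x} {point pz} x≈))))
            go′ (no ¬Pz) = ≡.trans (𝟙-no _ ¬Pz) (≡.sym (∑-zero k (λ x → 𝟙-no (R? z x) (λ r →
              ¬Pz (P-resp {proj₁ x} (Setoid.sym points {point pz} {proj₁ x} (∈⟨⟩⇒≈ (point pz) (proj₁ x) (proj₂ r)))
                  (proj₂ x))))))
        column : ∀ x → ∑ h (λ z → 𝟙 (R? z x)) ≡ q∸1
        column x = ≡.trans (∑-cong h (λ z → ≡.trans
            (𝟙-⇔ (λ (p , r) → proj₂ p , r) (λ (p , r) → (∈⟨⟩-sing (proj₁ (rep-proper (proj₁ x))) r , p) , r) (R? z x)
                (¬? (z ≟ᴹ 0ᴹ) ×-dec (z ∈⟨ rep (proj₁ x) ⟩?)))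
            (𝟙-× (¬? (z ≟ᴹ 0ᴹ)) (z ∈⟨ rep (proj₁ x) ⟩?))))
          (∑-⟨⟩≉0 (proj₂ (rep-proper (proj₁ x))))

    subset-count : ∃ λ m → ∑ h χ ≡ m * q∸1
    subset-count = proj₁ card , count-eq (proj₂ card)

    -- The set has some cardinality by enumeration, and q - 1 times it is the vector count;
    -- cancelling q - 1 identifies it.
    subset-card : ∀ {m} → ∑ h χ ≡ m * q∸1 → HasCard Subset m
    subset-card e = ≡.subst (HasCard Subset) (ℕ.*-cancelʳ-≡ _ _ q∸1 {{q∸1-nonZero}}
        (≡.trans (≡.sym (count-eq (proj₂ card))) e)) (proj₂ card)

  module Neighbours {_~_ : Rel Point ℓ₁} (~-resp : _~_ Respects₂ _≈_) (_~?_ : ∀ x y → Dec (x ~ y)) where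
    private
      respʳ : ∀ x → (x ~_) Respects _≈_
      respʳ x {y} {z} = proj₁ ~-resp {x} {y} {z}
      respˡ : ∀ y → (_~ y) Respects _≈_
      respˡ y {x} {z} = proj₂ ~-resp {y} {x} {z}
      common-resp : ∀ x y → ((x ~_) ∩ (y ~_)) Respects _≈_
      common-resp x y {z} {w} e (p , r) = respʳ x {z} {w} e p , respʳ y {z} {w} e r
      common? : ∀ x y z → Dec (((x ~_) ∩ (y ~_)) z)
      common? x y z = (x ~? z) ×-dec (y ~? z)
      row : ∀ {x} → Dec (Proper x) → Carrierᴹ → ℕ
      row (yes px) z = PointSet.χ (λ {y} {z} → respʳ (point px) {y} {z}) (point px ~?_) z
      row (no _)   z = 0

    opaque
      -- Adjacency of points transported to vectors: it depends only on the points they span, and is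
      -- 0 if one of them spans none.
      α : Carrierᴹ → Carrierᴹ → ℕ
      α x z = row (proper? x) z

      α-value : ∀ x y {v w} → v ≈ᴹ rep x → w ≈ᴹ rep y → α v w ≡ 𝟙 (x ~? y)
      α-value x y {v} {w} v≈ w≈ = go (proper? v)
        where
        go : (d : Dec (Proper v)) → row d w ≡ 𝟙 (x ~? y)
        go (no ¬pv) = contradiction (proper-resp (≈ᴹ-sym v≈) (rep-proper x)) ¬pv
        go (yes pv) = ≡.trans (PointSet.χ-point (λ {y} {z} → respʳ (point pv) {y} {z}) (point pv ~?_) y w≈)
          (𝟙-⇔ (respˡ y {point pv} {x} v≈x) (respˡ y {x} {point pv} (Setoid.sym points {point pv} {x} v≈x))
              (point pv ~? y) (x ~? y))
          where
          v≈x : point pv ≈ x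
          v≈x = ∈⟨⟩⇒≈ (point pv) x (∈⟨⟩-resp (≈ᴹ-sym v≈) ≈ᴹ-refl (v∈⟨v⟩ (rep x)))

      α-cong : ∀ x {z z′} → z ≈ᴹ z′ → α x z ≡ α x z′
      α-cong x {z} {z′} e = go (proper? x) (proper? z)
        where
        go : (d : Dec (Proper x)) → Dec (Proper z) → row d z ≡ row d z′
        go (no _) _ = ≡.refl
        go (yes px) (yes pz) = ≡.trans (PointSet.χ-point (λ {y} {z} → respʳ (point px) {y} {z}) (point px ~?_)
            (point pz) ≈ᴹ-refl)
          (≡.sym (PointSet.χ-point (λ {y} {z} → respʳ (point px) {y} {z}) (point px ~?_) (point pz) (≈ᴹ-sym e)))
        go (yes px) (no ¬pz) = ≡.trans (PointSet.χ-improper (λ {y} {z} → respʳ (point px) {y} {z}) (point px ~?_) ¬pz)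
          (≡.sym (PointSet.χ-improper (λ {y} {z} → respʳ (point px) {y} {z}) (point px ~?_)
              (λ pz′ → ¬pz (proper-resp (≈ᴹ-sym e) pz′))))

    private
      module Nbr x = PointSet (λ {y} {z} → respʳ x {y} {z}) (x ~?_)
      module Common x y = PointSet (λ {z} {w} → common-resp x y {z} {w}) (common? x y)

      degree-eq : ∀ x → ∑ h (Nbr.χ x) ≡ degree α (rep x)
      degree-eq x = ∑-cong h (λ z → go z (proper? z))
        where
        go : ∀ z → Dec (Proper z) → Nbr.χ x z ≡ 𝟙 (proper? z) * α (rep x) z
        go z (no ¬pz) = ≡.trans (Nbr.χ-improper x ¬pz) (≡.sym (≡.cong (_* α (rep x) z) (𝟙-no (proper? z) ¬pz)))
        go z (yes pz) = ≡.trans (Nbr.χ-point x (point pz) ≈ᴹ-refl)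
            (≡.sym (≡.trans (≡.cong₂ _*_ (𝟙-yes (proper? z) pz) (α-value x (point pz) ≈ᴹ-refl ≈ᴹ-refl))
            (ℕ.*-identityˡ _)))

      common-eq : ∀ x y → ∑ h (Common.χ x y) ≡ common α (rep x) (rep y)
      common-eq x y = ∑-cong h (λ z → go z (proper? z))
        where
        go : ∀ z → Dec (Proper z) → Common.χ x y z ≡ 𝟙 (proper? z) * (α (rep x) z * α (rep y) z)
        go z (no ¬pz) = ≡.trans (Common.χ-improper x y ¬pz)
            (≡.sym (≡.cong (_* (α (rep x) z * α (rep y) z)) (𝟙-no (proper? z) ¬pz)))
        go z (yes pz) = ≡.trans (Common.χ-point x y (point pz) ≈ᴹ-refl) (≡.trans (𝟙-× (x ~? point pz) (y ~? point pz))
          (≡.sym (≡.trans (≡.cong₂ _*_ (𝟙-yes (proper? z) pz) (≡.cong₂ _*_ (α-value x (point pz) ≈ᴹ-refl ≈ᴹ-refl)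
              (α-value y (point pz) ≈ᴹ-refl ≈ᴹ-refl))) (ℕ.*-identityˡ _))))

    degree-count : ∀ x → ∃ λ m → degree α (rep x) ≡ m * q∸1
    degree-count x = proj₁ (Nbr.subset-count x) , ≡.trans (≡.sym (degree-eq x)) (proj₂ (Nbr.subset-count x))

    degree-card : ∀ x {m} → degree α (rep x) ≡ m * q∸1 → HasCard (Subsetoid points (x ~_)) m
    degree-card x e = Nbr.subset-card x (≡.trans (degree-eq x) e)

    common-count : ∀ x y → ∃ λ m → common α (rep x) (rep y) ≡ m * q∸1
    common-count x y = proj₁ (Common.subset-count x y) , ≡.trans (≡.sym (common-eq x y))
        (proj₂ (Common.subset-count x y))

    common-card : ∀ x y {m} → common α (rep x) (rep y) ≡ m * q∸1 → HasCard (Subsetoid points ((x ~_) ∩ (y ~_))) m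
    common-card x y e = Common.subset-card x y (≡.trans (common-eq x y) e)

-- Totally singular subspaces as singular sets of points.

module SingularSubspaces (𝐏 : PolarSpace c ℓ m ℓm) where
  open PolarSpace 𝐏
  open Geometry 𝐏
  open Points 𝐏
  open FiniteModule field′ space h hiding (q∸1)
  open Spans field′ space h
  open SingularVectors field′ space h (PF.polarForm form)

  isSingular : ∀ {k} (W : Subspace k) → TotallyIsotropic W → IsSingular (_on W)
  isSingular W ti = record
    { decidable = λ x → x on? W
    ; respects = λ {x} {y} → on-resp W {x} {y}
    ; pairwise = λ {x} {y} x∈ y∈ → perp⇒⊥ y x (proj₂ (PF.totallyIsotropic⇒ form W ti) (on⇒span W y y∈) (on⇒span W x x∈))
    ; lineClosed = λ {x} {y} x∈ y∈ x≉y ℒ _ x∈ℒ y∈ℒ {z} z∈ℒ → let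
        t : Vector Carrierᴹ 2
        t = rep x ∷ rep y ∷ []
        t-ind : LinearlyIndependent t
        t-ind = independent₂ (proj₂ (rep-proper y)) (λ x∈y → x≉y (∈⟨⟩⇒≈ x y x∈y))
        in span⇒on W z (span-⊆ t (proj₁ W) (λ { zero → on⇒span W x x∈ ; (suc zero) → on⇒span W y y∈ })
          -- The span of two distinct points lies in `ℒ` and has the same dimension 2, so it is all
          -- of `ℒ`.
          (span-dimension t (proj₁ ℒ) t-ind (proj₂ ℒ)
            (span-⊆ t (proj₁ ℒ) (λ { zero → on⇒span ℒ x x∈ℒ ; (suc zero) → on⇒span ℒ y y∈ℒ })) (on⇒span ℒ z z∈ℒ)))
    }

  -- A singular vector orthogonal to U but outside it would span with U a larger totally singular
  -- subspace, whose points would form a larger singular set.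
  isMaximalIsotropic : ∀ {k} (U : Subspace k) → TotallyIsotropic U → IsMaximalSingular (_on U) → IsMaximalIsotropic
      (proj₁ U)
  isMaximalIsotropic U@(u , u-ind) ti (_ , max) = record
    { independent = u-ind
    ; U-sing = proj₁ (PF.totallyIsotropic⇒ form U ti)
    ; U-perp = proj₂ (PF.totallyIsotropic⇒ form U ti)
    ; U-maximal = maximal
    }
    where
    maximal : ∀ {z} → Sing z → (∀ i → F._≈_ (B (u i) z) F.0#) → Span u z
    maximal {z} sz u⊥z = decidable-stable (span? u z) λ z∉ → let
        pz : Proper z
        pz = sz , λ z≈0 → z∉ (span-resp u (≈ᴹ-sym z≈0) (span-0 u))
        (u-sing , u-perp) = PF.totallyIsotropic⇒ form U ti
        t⊥t = ∷-perp {t = u} sz u⊥z (λ i j → u-perp (span-basis u i) (span-basis u j))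
        T : Subspace _
        T = z ∷ u , independent-∷ u u-ind z∉
        tiT : TotallyIsotropic T
        tiT = PF.⇒totallyIsotropic form T (span-sing (z ∷ u) (Sing-0 sz)
            (∷-sing {t = u} sz (λ i → u-sing (span-basis u i))) t⊥t) (spans-perp (z ∷ u) t⊥t)
      in z∉ (on⇒span U (point pz) (max (_on T) (isSingular T tiT)
           (λ {x} x∈ → span⇒on T x (span-⊆ u (z ∷ u) (λ i → span-basis (z ∷ u) (suc i)) (on⇒span U x x∈)))
           {point pz} (span⇒on T (point pz) (span-basis (z ∷ u) zero))))

-- The given design and bijection as a vector design.

module DeformedGraph
  {c ℓ m ℓm b ℓb i : Level} (𝐏 : PolarSpace c ℓ m ℓm) (d : ℕ)
  (U : Geometry.Subspace 𝐏 (3 ℕ.+ d)) (ti : Geometry.TotallyIsotropic 𝐏 U)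
  (max : Geometry.IsMaximalSingular 𝐏 (λ x → Geometry._on_ 𝐏 x U))
  (𝐃 : SymmetricDesign (Geometry.pointsOn 𝐏 U) (Geometry.θ 𝐏 (3 ℕ.+ d)) (Geometry.θ 𝐏 (2 ℕ.+ d))
      (Geometry.θ 𝐏 (1 ℕ.+ d)) b ℓb i)
  (φ : Bijection (Geometry.hyperplanes 𝐏 U) (SymmetricDesign.Blocks 𝐃))
  where

  open PolarSpace 𝐏
  open Geometry 𝐏
  open Points 𝐏
  open SingularSubspaces 𝐏
  open FiniteModule field′ space h hiding (q∸1)
  open FieldProperties field′ using (q∸1)
  open Spans field′ space h
  open SingularVectors field′ space h (PF.polarForm form)
  open Setoid points using (_≈_; _≉_) renaming (Carrier to Point)

  u : Vector Carrierᴹ (3 ℕ.+ d)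
  u = proj₁ U

  open MaximalSubspace field′ space h (PF.polarForm form) d u (isMaximalIsotropic U ti max)
  open Dot field′ using (_·_; module Kernel)
  open VectorDesign field′ (Fⁿ n) hn using (IsVectorDesign; intersection; _∼_)
  open SymmetricDesign 𝐃
  open Setoid Blocks using () renaming (Carrier to Block; _≈_ to _≈ᴮ_; sym to symᴮ; trans to transᴮ)
  module Hyp = Setoid (hyperplanes U)
  open Bijection φ using () renaming (to to φ→; cong to φ-cong; injective to φ-injective)

  Coordinates : Set c
  Coordinates = Vector F.Carrier n

  NonZeroⁿ : Coordinates → Set ℓ
  NonZeroⁿ a = ¬ (a W.≈ᴹ W.0ᴹ)

  ·-class : ∀ {α b b′} → b′ W.∈⟨ b ⟩ → F._≈_ (α · b) F.0# → F._≈_ (α · b′) F.0#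
  ·-class {α} {b} (μ , e) αb≈0 = F.trans (Dn.B-cong W.≈ᴹ-refl e)
      (F.trans (Dn.scalarʳ μ α b) (F.trans (F.*-congˡ αb≈0) (F.zeroʳ μ)))

  private
    support : ∀ {b} → NonZeroⁿ b → ∃ λ j → ¬ (F._≈_ (b j) F.0#)
    support {b} nb = Fin.¬∀⟶∃¬ n (λ j → F._≈_ (b j) F.0#) (λ j → b j ≟ F.0#) nb

  opaque
    -- A nonzero coordinate of `b` serves as pivot and the other coordinates are free, which gives a
    -- basis of length 2 + d.
    kernel : ∀ {b} → NonZeroⁿ b → Subspace (2 ℕ.+ d)
    kernel {b} nb = K.basis , K.basis-independent
      where module K = Kernel space u (proj₂ U) b (proj₁ (support nb)) (proj₂ (support nb))

    kernel⇒ : ∀ {b} (nb : NonZeroⁿ b) {x} → Span (proj₁ (kernel nb)) x → ∃ λ α → combination α u ≈ᴹ x × F._≈_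
        (α · b) F.0#
    kernel⇒ {b} nb = K.kernel⇒
      where module K = Kernel space u (proj₂ U) b (proj₁ (support nb)) (proj₂ (support nb))

    ⇒kernel : ∀ {b} (nb : NonZeroⁿ b) {α x} → combination α u ≈ᴹ x → F._≈_ (α · b) F.0# → Span (proj₁ (kernel nb)) x
    ⇒kernel {b} nb = K.⇒kernel
      where module K = Kernel space u (proj₂ U) b (proj₁ (support nb)) (proj₂ (support nb))

  hyper : ∀ {b} → NonZeroⁿ b → Hyp.Carrier
  hyper nb = kernel nb , λ x∈ → let (α , e , _) = kernel⇒ nb x∈ in α , e

  kernel-∋ : ∀ {b} (nb : NonZeroⁿ b) α → Span (proj₁ (kernel nb)) (combination α u) → F._≈_ (α · b) F.0#
  kernel-∋ nb α α∈ with β , e , βb≈0 ← kernel⇒ nb α∈ =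
    F.trans (Dn.B-cong (λ i → F.sym (combination-injective u (proj₂ U) {β} {α} e i)) W.≈ᴹ-refl) βb≈0

  hyper-cong : ∀ {b b′} (nb : NonZeroⁿ b) (nb′ : NonZeroⁿ b′) → b W.∈⟨ b′ ⟩ → hyper nb Hyp.≈ hyper nb′
  hyper-cong nb nb′ b∈b′ = ⊆ nb nb′ (W.∈⟨⟩-sym nb b∈b′) , ⊆ nb′ nb b∈b′
    where
    ⊆ : ∀ {b b′} (nb : NonZeroⁿ b) (nb′ : NonZeroⁿ b′) → b′ W.∈⟨ b ⟩ → ∀ {x} → Span (proj₁ (kernel nb)) x → Span
        (proj₁ (kernel nb′)) x
    ⊆ nb nb′ b′∈b x∈ with α , e , αb≈0 ← kernel⇒ nb x∈ = ⇒kernel nb′ e (·-class b′∈b αb≈0)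

  -- Proportional functionals are told apart from the others by the size of
  -- the intersection of their kernels.
  hyper-injective : ∀ {b b′} (nb : NonZeroⁿ b) (nb′ : NonZeroⁿ b′) → hyper nb Hyp.≈ hyper nb′ → b′ W.∈⟨ b ⟩
  hyper-injective {b} {b′} nb nb′ (⊆ , ⊇) = decidable-stable (b′ W.∈⟨ b ⟩?) λ b′∉b →
      ℕ.≢-nonZero⁻¹ q∸1 (ℕ.m+n≡0⇒n≡0 (q∸1 * l)
          (ℕ.+-cancelˡ-≡ l _ _ (≡.trans (≡.sym (≡.trans k≡ (ℕ.+-assoc l (q∸1 * l) q∸1)))
        (≡.trans (k≡l b′∉b) (≡.sym (ℕ.+-identityʳ l))))))
    where
    open IsVectorDesign D₀.ρ₀-isVectorDesign using (idem) renaming (blockSize to kernelSize)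
    same : ∀ x → D₀.ρ₀ x b ≡ D₀.ρ₀ x b′
    same x = 𝟙-⇔ (λ (nx , _ , p) → nx , nb′ , kernel-∋ nb′ x (⊆ (⇒kernel nb ≈ᴹ-refl p)))
                 (λ (nx , _ , p) → nx , nb , kernel-∋ nb x (⊇ (⇒kernel nb′ ≈ᴹ-refl p)))
                 (D₀.nonzero-perp? x b) (D₀.nonzero-perp? x b′)
    k≡l : ¬ (b′ W.∈⟨ b ⟩) → k ≡ l
    k≡l b′∉b = ≡.trans (≡.sym (kernelSize nb)) (≡.trans
      (∑-cong hn (λ x → ≡.trans (≡.sym (idem x b)) (≡.cong (D₀.ρ₀ x b *_) (same x))))
      (intersection D₀.ρ₀-isVectorDesign {{l-nonZero}} k≡ q^n≡ nb b′∉b))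

  ptU : ∀ {a} → NonZeroⁿ a → Setoid.Carrier (pointsOn U)
  ptU {a} na = point pa , span⇒on U (point pa) (a , ≈ᴹ-refl)
    where
    pa : Proper (combination a u)
    pa = U-sing (a , ≈ᴹ-refl) , combination≉0 na

  combination-∈⟨⟩ : ∀ {a a′} → a W.∈⟨ a′ ⟩ → combination a u ∈⟨ combination a′ u ⟩
  combination-∈⟨⟩ {a} {a′} (μ , e) = μ , ≈ᴹ-trans (combination-cong u e) (combination-* μ a′ u)

  ∈⟨⟩-coordinates : ∀ {a a′} → combination a u ∈⟨ combination a′ u ⟩ → a W.∈⟨ a′ ⟩
  ∈⟨⟩-coordinates {a} {a′} (μ , e) = μ , combination-injective u (proj₂ U) (≈ᴹ-trans e (≈ᴹ-sym (combination-* μ a′ u)))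

  block : ∀ {b} → NonZeroⁿ b → Block
  block nb = φ→ (hyper nb)

  infix 4 _∈ᴮ?_
  -- A search through the enumeration of the points on `C` that comes with the block size.
  _∈ᴮ?_ : ∀ x C → Dec (x ∈ᴮ C)
  x ∈ᴮ? C = map′ (λ ((y , y∈) , y≈x) → ∈ᴮ-respˡ {C} {y} {x} y≈x y∈) (λ x∈ → (x , x∈) , Setoid.refl points {proj₁ x})
    (card-∃? (blockSize C) {P = λ y → proj₁ (proj₁ y) ≈ proj₁ x}
      (λ {y} {z} y≈z y≈x → Setoid.trans points {proj₁ (proj₁ z)} {proj₁ (proj₁ y)} {proj₁ x}
          (Setoid.sym points {proj₁ (proj₁ y)} {proj₁ (proj₁ z)} y≈z) y≈x)
      (λ y → proj₁ (proj₁ y) ≟ₚ proj₁ x))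

  -- With `f y` for `b` this expresses x ∈ (y⊥ ∩ U)^φ: the hyperplane is the kernel of the
  -- functional of y, and x has the coordinates `a`.
  Incident : Coordinates → Coordinates → Set _
  Incident a b = Σ (NonZeroⁿ a) λ na → Σ (NonZeroⁿ b) λ nb → ptU na ∈ᴮ block nb

  incident-resp : ∀ {a a′ b b′} → NonZeroⁿ a′ → NonZeroⁿ b′ → a W.∈⟨ a′ ⟩ → b W.∈⟨ b′ ⟩ → Incident a b → Incident a′ b′
  incident-resp na′ nb′ a∈ b∈ (na , nb , inc) = na′ , nb′ ,
    ∈ᴮ-respʳ (φ-cong (hyper-cong nb nb′ b∈)) (∈ᴮ-respˡ {block nb} {ptU na} {ptU na′}
        (∈⟨⟩⇒≈ (proj₁ (ptU na)) (proj₁ (ptU na′)) (combination-∈⟨⟩ a∈)) inc)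

  opaque
    incident? : ∀ a b → Dec (Incident a b)
    incident? a b = go (a W.≟ᴹ W.0ᴹ) (b W.≟ᴹ W.0ᴹ)
      where
      go : Dec (a W.≈ᴹ W.0ᴹ) → Dec (b W.≈ᴹ W.0ᴹ) → Dec (Incident a b)
      go (yes a≈0) _ = no (λ (na , _) → na a≈0)
      go (no _) (yes b≈0) = no (λ (_ , nb , _) → nb b≈0)
      go (no na) (no nb) = map′ (λ inc → na , nb , inc)
        (λ inc → proj₂ (proj₂ (incident-resp na nb (W.v∈⟨v⟩ a) (W.v∈⟨v⟩ b) inc))) (ptU na ∈ᴮ? block nb)

  ρ₁ : Coordinates → Coordinates → ℕ
  ρ₁ a b = 𝟙 (incident? a b)

  private
    -- The functional `b` belongs to `C` if `φ` sends its kernel to `C`. Counting these functionals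
    -- shows that blocks and points are blown up by the same factor q - 1.
    Maps : Coordinates → Block → Set _
    Maps b C = Σ (NonZeroⁿ b) λ nb → block nb ≈ᴮ C

    block-cong : ∀ {b b′} (nb : NonZeroⁿ b) (nb′ : NonZeroⁿ b′) → b W.∈⟨ b′ ⟩ → block nb ≈ᴮ block nb′
    block-cong nb nb′ b∈ = φ-cong (hyper-cong nb nb′ b∈)

    opaque
      maps? : ∀ b C → Dec (Maps b C)
      maps? b C = go (b W.≟ᴹ W.0ᴹ)
        where
        go : Dec (b W.≈ᴹ W.0ᴹ) → Dec (Maps b C)
        go (yes b≈0) = no (λ (nb , _) → nb b≈0)
        go (no nb) = map′ (nb ,_) (λ (nb′ , e) → transᴮ (block-cong nb nb′ (W.v∈⟨v⟩ b)) e)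
            (card-≟ blockCount (block nb) C)

    fibre : Block → ℕ
    fibre C = ∑ hn (λ b → 𝟙 (maps? b C))

    class-size : ∀ {b} → NonZeroⁿ b → ∑ hn (λ b′ → 𝟙 (¬? (b′ W.≟ᴹ W.0ᴹ) ×-dec (b′ W.∈⟨ b ⟩?))) ≡ q∸1
    class-size {b} nb = ≡.trans (∑-cong hn (λ b′ → 𝟙-× (¬? (b′ W.≟ᴹ W.0ᴹ)) (b′ W.∈⟨ b ⟩?))) (W.∑-⟨⟩≉0 nb)

    -- There are θ (3 + d) blocks and (q - 1) θ (3 + d) nonzero functionals, and each
    -- block comes from at most q - 1 functionals; so equality holds throughout.
    fibre-≤ : ∀ C → fibre C ℕ.≤ q∸1
    fibre-≤ C = go (card-∃? hn {P = λ b → Maps b C} resp (λ b → maps? b C))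
      where
      resp : (λ b → Maps b C) Respects W._≈ᴹ_
      resp {b} {b′} b≈b′ (nb , e) = nb′ , transᴮ (block-cong nb′ nb (W.∈⟨⟩-resp b≈b′ W.≈ᴹ-refl (W.v∈⟨v⟩ b))) e
        where
        nb′ : NonZeroⁿ b′
        nb′ b′≈0 = nb (W.≈ᴹ-trans b≈b′ b′≈0)
      go : Dec (∃ λ b → Maps b C) → fibre C ℕ.≤ q∸1
      go (no none) = ℕ.≤-trans (ℕ.≤-reflexive (∑-zero hn (λ b → 𝟙-no (maps? b C) (λ r → none (b , r))))) z≤n
      go (yes (b , nb , e)) = ℕ.≤-reflexive (≡.trans (∑-cong hn (λ b′ → 𝟙-⇔
          (λ (nb′ , e′) → nb′ , hyper-injective nb nb′ (φ-injective (transᴮ e (symᴮ e′))))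
          (λ (nb′ , b′∈) → nb′ , transᴮ (block-cong nb′ nb b′∈) e)
          (maps? b′ C) (¬? (b′ W.≟ᴹ W.0ᴹ) ×-dec (b′ W.∈⟨ b ⟩?)))) (class-size nb))

    ∑-fibre : ∑ blockCount fibre ≡ ∑ blockCount (λ _ → q∸1)
    ∑-fibre = begin
      ∑ blockCount (λ C → ∑ hn (λ b → 𝟙 (maps? b C)))    ≡⟨ ∑-swap hn blockCount _ ⟨
      ∑ hn (λ b → ∑ blockCount (λ C → 𝟙 (maps? b C)))    ≡⟨ ∑-cong hn (λ b → row b (b W.≟ᴹ W.0ᴹ)) ⟩
      ∑ hn (λ b → 𝟙 (¬? (b W.≟ᴹ W.0ᴹ)) * 1) ≡⟨ ℕ.suc-injective (≡.trans (≡.sym (W.∑-0 (λ _ → ≡.refl)))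
          (≡.trans (∑-const hn 1) (≡.trans (ℕ.*-identityʳ _) (≡.trans (q^ n) (ℕ.+-comm _ 1))))) ⟩
      F.θ n * q∸1                                        ≡⟨ ∑-const blockCount q∸1 ⟨
      ∑ blockCount (λ _ → q∸1)                           ∎
      where
      open ≡-Reasoning
      row : ∀ b → Dec (b W.≈ᴹ W.0ᴹ) → ∑ blockCount (λ C → 𝟙 (maps? b C)) ≡ 𝟙 (¬? (b W.≟ᴹ W.0ᴹ)) * 1
      row b (yes b≈0) = ≡.trans (∑-zero blockCount (λ C → 𝟙-no (maps? b C) (λ (nb , _) → nb b≈0)))
          (≡.sym (≡.cong (_* 1) (𝟙-no (¬? (b W.≟ᴹ W.0ᴹ)) (λ nb → nb b≈0))))
      row b (no nb) = ≡.trans (∑-unique blockCount (block nb) (maps? b) (λ (nb′ , e) → transᴮ (symᴮ e)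
          (block-cong nb′ nb (W.v∈⟨v⟩ b))) (λ e → nb , symᴮ e))
        (≡.sym (≡.cong (_* 1) (𝟙-yes (¬? (b W.≟ᴹ W.0ᴹ)) nb)))

    fibre-size : ∀ C → fibre C ≡ q∸1
    fibre-size = ∑-≤-≡ blockCount (λ {C} {C′} e → ∑-cong hn (λ b → 𝟙-⇔ (λ (nb , r) → nb , transᴮ r e)
        (λ (nb , r) → nb , transᴮ r (symᴮ e)) (maps? b C) (maps? b C′)))
      (λ _ → ≡.refl) fibre-≤ ∑-fibre

    -- Each point on the block has q - 1 coordinate vectors.
    ρ₁-size : ∀ {b} → NonZeroⁿ b → ∑ hn (λ a → ρ₁ a b) ≡ k
    ρ₁-size {b} nb = ∑-classes hn (blockSize (block nb)) {R = λ a x → Rel′ a x} R? (λ a → ρ₁ a b) q∸1 row column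
      where
      Element = Setoid.Carrier (Subsetoid (pointsOn U) (_∈ᴮ block nb))
      Rel′ : Coordinates → Element → Set _
      Rel′ a x = NonZeroⁿ a × combination a u ∈⟨ rep (proj₁ (proj₁ x)) ⟩
      R? : ∀ a x → Dec (Rel′ a x)
      R? a x = ¬? (a W.≟ᴹ W.0ᴹ) ×-dec (combination a u ∈⟨ rep (proj₁ (proj₁ x)) ⟩?)
      row : ∀ a → ρ₁ a b ≡ ∑ (blockSize (block nb)) (λ x → 𝟙 (R? a x))
      row a = go (incident? a b)
        where
        go : Dec (Incident a b) → ρ₁ a b ≡ ∑ (blockSize (block nb)) (λ x → 𝟙 (R? a x))
        go (yes inc@(na , nb′ , a∈)) = ≡.trans (𝟙-yes (incident? a b) inc) (≡.sym (∑-unique (blockSize (block nb))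
          (ptU na , ∈ᴮ-respʳ (block-cong nb′ nb (W.v∈⟨v⟩ b)) a∈) (R? a)
          (λ {x} (_ , r) → Setoid.sym points {proj₁ (ptU na)} {proj₁ (proj₁ x)}
              (∈⟨⟩⇒≈ (proj₁ (ptU na)) (proj₁ (proj₁ x)) r))
          (λ {x} x≈ → na , ≈⇒∈⟨⟩ (proj₁ (ptU na)) (proj₁ (proj₁ x))
              (Setoid.sym points {proj₁ (proj₁ x)} {proj₁ (ptU na)} x≈))))
        go (no ¬inc) = ≡.trans (𝟙-no (incident? a b) ¬inc) (≡.sym (∑-zero (blockSize (block nb)) (λ x → 𝟙-no (R? a x)
          (λ (na , r) → ¬inc (na , nb , ∈ᴮ-respˡ {block nb} {proj₁ x} {ptU na}
              (Setoid.sym points {proj₁ (ptU na)} {proj₁ (proj₁ x)} (∈⟨⟩⇒≈ (proj₁ (ptU na)) (proj₁ (proj₁ x)) r))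
              (proj₂ x))))))
      column : ∀ x → ∑ hn (λ a → 𝟙 (R? a x)) ≡ q∸1
      column x = ≡.trans (∑-cong hn (λ a → 𝟙-⇔
          (λ (na , r) → na , ∈⟨⟩-coordinates (∈⟨⟩-resp ≈ᴹ-refl (≈ᴹ-sym a₀≈) r))
          (λ (na , r) → na , ∈⟨⟩-resp ≈ᴹ-refl a₀≈ (combination-∈⟨⟩ r))
          (R? a x) (¬? (a W.≟ᴹ W.0ᴹ) ×-dec (a W.∈⟨ a₀ ⟩?))))
              (class-size (combination-coordinate≉0 (rep-proper (proj₁ (proj₁ x))) a₀≈))
        where
        a₀ = proj₁ (on⇒span U (proj₁ (proj₁ x)) (proj₂ (proj₁ x)))
        a₀≈ = proj₂ (on⇒span U (proj₁ (proj₁ x)) (proj₂ (proj₁ x)))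

    -- The design counts blocks on two points, and by `fibre-size` each of them is the block of
    -- exactly q - 1 functionals.
    ρ₁-pairs : ∀ {a a′} → NonZeroⁿ a → ¬ (a′ W.∈⟨ a ⟩) → ∑ hn (λ b → ρ₁ a b * ρ₁ a′ b) ≡ l
    ρ₁-pairs {a} {a′} na a′∉a = ∑-classes hn pc (λ b x → maps? b (proj₁ x)) (λ b → ρ₁ a b * ρ₁ a′ b) q∸1 row
        (λ x → fibre-size (proj₁ x))
      where
      na′ : NonZeroⁿ a′
      na′ a′≈0 = a′∉a (W.∈⟨⟩-resp (W.≈ᴹ-sym a′≈0) W.≈ᴹ-refl W.0∈⟨ a ⟩)
      pc = pairCount (ptU na) (ptU na′)
          (λ e → a′∉a (W.∈⟨⟩-sym na (∈⟨⟩-coordinates (≈⇒∈⟨⟩ (proj₁ (ptU na)) (proj₁ (ptU na′)) e))))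
      row : ∀ b → ρ₁ a b * ρ₁ a′ b ≡ ∑ pc (λ x → 𝟙 (maps? b (proj₁ x)))
      row b = ≡.trans (≡.sym (𝟙-× (incident? a b) (incident? a′ b))) (go (incident? a b ×-dec incident? a′ b))
        where
        go : (D : Dec (Incident a b × Incident a′ b)) → 𝟙 D ≡ ∑ pc (λ x → 𝟙 (maps? b (proj₁ x)))
        go (yes (inc , inc′)) = ≡.trans (𝟙-yes (yes (inc , inc′)) (inc , inc′)) (≡.sym (∑-unique pc
            (block nb , proj₂ (proj₂ (incident-resp na nb (W.v∈⟨v⟩ a) (W.v∈⟨v⟩ b) inc)) , proj₂
                (proj₂ (incident-resp na′ nb (W.v∈⟨v⟩ a′) (W.v∈⟨v⟩ b) inc′)))
            (λ x → maps? b (proj₁ x)) (λ (nb′ , e) → transᴮ (symᴮ e) (block-cong nb′ nb (W.v∈⟨v⟩ b)))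
                (λ e → nb , symᴮ e)))
          where nb = proj₁ (proj₂ inc)
        go (no ¬inc) = ≡.trans (𝟙-no (no ¬inc) ¬inc)
            (≡.sym (∑-zero pc (λ (C , a∈ , a′∈) → 𝟙-no (maps? b C) (λ (nb , e) →
            ¬inc ((na , nb , ∈ᴮ-respʳ (symᴮ e) a∈) , (na′ , nb , ∈ᴮ-respʳ (symᴮ e) a′∈))))))

    nonzero-class : ∀ {a a′} → a ∼ a′ → NonZeroⁿ a′ × a′ W.∈⟨ a ⟩
    nonzero-class {a} {a′} (na , a∈) = (λ a′≈0 → na (W.≈ᴹ-trans (proj₂ a∈) (W.≈ᴹ-trans (λ i → F.*-congˡ (a′≈0 i))
        (λ i → F.zeroʳ _)))) , W.∈⟨⟩-sym na a∈

  opaque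
    ρ₁-isVectorDesign : IsVectorDesign k l ρ₁
    ρ₁-isVectorDesign = record
      { idem = λ a b → 𝟙-idem (incident? a b)
      ; ρ-cong = λ {a} {a′} {b} {b′} a≈ b≈ → 𝟙-⇔ (resp≈ a≈ b≈) (resp≈ (W.≈ᴹ-sym a≈) (W.≈ᴹ-sym b≈)) (incident? a b)
          (incident? a′ b′)
      ; ρ-zeroˡ = λ b → 𝟙-no (incident? W.0ᴹ b) (λ (na , _) → na W.≈ᴹ-refl)
      ; ρ-zeroʳ = λ a → 𝟙-no (incident? a W.0ᴹ) (λ (_ , nb , _) → nb W.≈ᴹ-refl)
      ; ρ-classˡ = λ {a} {a′} b a∼ → let (na′ , a′∈) = nonzero-class a∼ in 𝟙-⇔
          (λ inc → incident-resp na′ (proj₁ (proj₂ inc)) (proj₂ a∼) (W.v∈⟨v⟩ b) inc)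
          (λ inc → incident-resp (proj₁ a∼) (proj₁ (proj₂ inc)) a′∈ (W.v∈⟨v⟩ b) inc) (incident? a b) (incident? a′ b)
      ; ρ-classʳ = λ {b} {b′} a b∼ → let (nb′ , b′∈) = nonzero-class b∼ in 𝟙-⇔
          (λ inc → incident-resp (proj₁ inc) nb′ (W.v∈⟨v⟩ a) (proj₂ b∼) inc)
          (λ inc → incident-resp (proj₁ inc) (proj₁ b∼) (W.v∈⟨v⟩ a) b′∈ inc) (incident? a b) (incident? a b′)
      ; blockSize = ρ₁-size
      ; pairCount = ρ₁-pairs
      }
      where
      resp≈ : ∀ {a a′ b b′} → a W.≈ᴹ a′ → b W.≈ᴹ b′ → Incident a b → Incident a′ b′
      resp≈ {a} {a′} {b} {b′} a≈ b≈ inc@(na , nb , _) = incident-resp (λ z → na (W.≈ᴹ-trans a≈ z))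
          (λ z → nb (W.≈ᴹ-trans b≈ z))
        (W.∈⟨⟩-resp W.≈ᴹ-refl a≈ (W.v∈⟨v⟩ a)) (W.∈⟨⟩-resp W.≈ᴹ-refl b≈ (W.v∈⟨v⟩ b)) inc

  -- Adjacency in both graphs expressed by vectors.

  open Deformation U 𝐃 φ using (Cross; inside; outside; cross; cross′; Γφ)
  module Γ₀ = Graph Γ₀
  module Γφ = Graph Γφ

  ⊥₀ : Point → Point → Set _
  ⊥₀ x y = F._≈_ (B (rep x) (rep y)) F.0#

  private
    ≉⇒∉ : ∀ x y → x ≉ y → ¬ (rep y ∈⟨ rep x ⟩)
    ≉⇒∉ x y x≉y y∈x = x≉y (Setoid.sym points {y} {x} (∈⟨⟩⇒≈ y x y∈x))

    ∉⇒≉ : ∀ x y → ¬ (rep y ∈⟨ rep x ⟩) → x ≉ y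
    ∉⇒≉ x y y∉x x≈y = y∉x (≈⇒∈⟨⟩ y x (Setoid.sym points {x} {y} x≈y))

    -- The functional of `y` vanishes at a vector of U exactly when that vector is orthogonal to
    -- `y`. This supplies the hyperplane asked for in `Cross`.
    hyper-points : ∀ y (y∉U : ¬ Span u (rep y)) → let nb = fy≉0 (proj₁ (rep-proper y)) y∉U in
                   (_on kernel nb) ≐ ((_on U) ∩ (y ⊥))
    hyper-points y y∉U =
        (λ {w} w∈ → let (α , e , p) = kernel⇒ nb (on⇒span (kernel nb) w w∈) in
          span⇒on U w (α , e) , perp⇒⊥ y w
              (reflexive (F.trans (B-cong (≈ᴹ-sym e) ≈ᴹ-refl) (F.trans (B-combination α (rep y)) p))))
      , (λ {w} (w∈U , w⊥y) → let (α , e) = on⇒span U w w∈U in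
          span⇒on (kernel nb) w (⇒kernel nb e (F.trans (F.sym (B-combination α (rep y)))
              (F.trans (B-cong e ≈ᴹ-refl) (reflexive (⊥⇒perp y w w⊥y))))))
      where
      nb = fy≉0 (proj₁ (rep-proper y)) y∉U

    -- Points are singular 1-spaces, so a totally singular subspace consists of the vectors of its
    -- points together with the zero vector. Needed because `Cross` fixes its hyperplane by points,
    -- while `φ` compares hyperplanes by vectors.
    subspace-by-points : ∀ {k l} (W : Subspace k) (W′ : Subspace l) → (∀ {z} → Span (proj₁ W) z → Sing z) →
                         (∀ x → x on W → x on W′) → ∀ {z} → Span (proj₁ W) z → Span (proj₁ W′) z
    subspace-by-points W W′ sing ⊆ {z} z∈ = go (z ≟ᴹ 0ᴹ)
      where
      go : Dec (z ≈ᴹ 0ᴹ) → Span (proj₁ W′) z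
      go (yes z≈0) = span-resp (proj₁ W′) (≈ᴹ-sym z≈0) (span-0 (proj₁ W′))
      go (no z≉0) = on⇒span W′ (point (sing z∈ , z≉0))
          (⊆ (point (sing z∈ , z≉0)) (span⇒on W (point (sing z∈ , z≉0)) z∈))

  cross⇒incident : ∀ x y {a} → combination a u ≈ᴹ rep x → Cross x y → Incident a (f (rep y))
  cross⇒incident x y {a} a≈ (x∈U , y∉U , H , (H⊆ , ⊆H) , x∈B) = na , nb ,
      ∈ᴮ-respʳ (Bijection.cong φ H≈) (∈ᴮ-respˡ {Bijection.to φ H} {x , x∈U} {ptU na} x≈ x∈B)
    where
    na = combination-coordinate≉0 (rep-proper x) a≈
    nb = fy≉0 (proj₁ (rep-proper y)) (λ y∈ → y∉U (span⇒on U y y∈))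
    hp = hyper-points y (λ y∈ → y∉U (span⇒on U y y∈))
    x≈ : x ≈ proj₁ (ptU na)
    x≈ = ∈⟨⟩⇒≈ x (proj₁ (ptU na)) (∈⟨⟩-resp a≈ ≈ᴹ-refl (v∈⟨v⟩ (combination a u)))
    -- Both hyperplanes have y⊥ ∩ U as their set of points.
    H≈ : H Hyp.≈ hyper nb
    H≈ = subspace-by-points (proj₁ H) (kernel nb) (λ z∈ → U-sing (proj₂ H z∈)) (λ w w∈ → proj₂ hp {w} (H⊆ {w} w∈))
       , subspace-by-points (kernel nb) (proj₁ H) (λ z∈ → U-sing (proj₂ (hyper nb) z∈))
           (λ w w∈ → ⊆H {w} (proj₁ hp {w} w∈))

  incident⇒cross : ∀ x y {a} → combination a u ≈ᴹ rep x → ¬ Span u (rep y) → Incident a (f (rep y)) → Cross x y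
  incident⇒cross x y {a} a≈ y∉ inc@(na , nb′ , _) = x∈U , (λ y∈ → y∉ (on⇒span U y y∈)) , hyper nb , hyper-points y y∉ ,
      ∈ᴮ-respˡ {block nb} {ptU na} {x , x∈U} (∈⟨⟩⇒≈ (proj₁ (ptU na)) x (∈⟨⟩-resp ≈ᴹ-refl a≈ (v∈⟨v⟩ (combination a u))))
        (proj₂ (proj₂ (incident-resp na nb (W.v∈⟨v⟩ a) (W.v∈⟨v⟩ (f (rep y))) inc)))
    where
    nb = fy≉0 (proj₁ (rep-proper y)) y∉
    x∈U : x on U
    x∈U = span⇒on U x (a , a≈)

  private
    in-in⇔ : ∀ x y → Span u (rep x) → Span u (rep y) → (x Γφ.~ y → ¬ (rep y ∈⟨ rep x ⟩)) × (¬ (rep y ∈⟨ rep x ⟩) → x Γφ.~ y)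
    in-in⇔ x y x∈ y∈ = (λ x~y y∈x → Γφ.~-irrefl {x} {y} (Setoid.sym points {y} {x} (∈⟨⟩⇒≈ y x y∈x)) x~y)
                     , (λ y∉x → inside (span⇒on U x x∈) (span⇒on U y y∈) (∉⇒≉ x y y∉x))

    out-out⇔ : ∀ x y → ¬ Span u (rep x) → ¬ Span u (rep y) →
               (x Γφ.~ y → ¬ (rep y ∈⟨ rep x ⟩) × ⊥₀ x y) × (¬ (rep y ∈⟨ rep x ⟩) × ⊥₀ x y → x Γφ.~ y)
    out-out⇔ x y x∉ y∉ =
        (λ { (inside x∈ _ _) → contradiction (on⇒span U x x∈) x∉
           ; (outside _ _ x≉y y⊥x) → ≉⇒∉ x y x≉y , reflexive (⊥⇒perp y x y⊥x)
           ; (cross (x∈ , _)) → contradiction (on⇒span U x x∈) x∉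
           ; (cross′ (y∈ , _)) → contradiction (on⇒span U y y∈) y∉ })
      , (λ (y∉x , xy≈0) → outside (λ x∈ → x∉ (on⇒span U x x∈)) (λ y∈ → y∉ (on⇒span U y y∈)) (∉⇒≉ x y y∉x)
          (perp⇒⊥ y x (reflexive xy≈0)))

    in-out⇔ : ∀ x y {a} → combination a u ≈ᴹ rep x → ¬ Span u (rep y) →
              (x Γφ.~ y → Incident a (f (rep y))) × (Incident a (f (rep y)) → x Γφ.~ y)
    in-out⇔ x y {a} a≈ y∉ =
        (λ { (inside _ y∈ _) → contradiction (on⇒span U y y∈) y∉
           ; (outside x∉ _ _ _) → ⊥-elim (x∉ (span⇒on U x (a , a≈)))
           ; (cross x~y) → cross⇒incident x y a≈ x~y
           ; (cross′ (y∈ , _)) → contradiction (on⇒span U y y∈) y∉ })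
      , (λ inc → cross (incident⇒cross x y a≈ y∉ inc))

  opaque
    -- `Cross` quantifies over hyperplanes; its reformulation as `Incident` is what makes the mixed
    -- cases decidable.
    adjacent? : ∀ x y → Dec (x Γφ.~ y)
    adjacent? x y = go (span? u (rep x)) (span? u (rep y))
      where
      go : Dec (Span u (rep x)) → Dec (Span u (rep y)) → Dec (x Γφ.~ y)
      go (yes x∈) (yes y∈) = map′ (proj₂ (in-in⇔ x y x∈ y∈)) (proj₁ (in-in⇔ x y x∈ y∈)) (¬? (rep y ∈⟨ rep x ⟩?))
      go (no x∉) (no y∉) = map′ (proj₂ (out-out⇔ x y x∉ y∉)) (proj₁ (out-out⇔ x y x∉ y∉)) (¬? (rep y ∈⟨ rep x ⟩?) ×-dec
          (rep x ⊥? rep y))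
      go (yes (a , a≈)) (no y∉) = map′ (proj₂ (in-out⇔ x y a≈ y∉)) (proj₁ (in-out⇔ x y a≈ y∉)) (incident? a (f (rep y)))
      go (no x∉) (yes (a , a≈)) = map′ (Γφ.~-sym {y} {x} ∘ proj₂ (in-out⇔ y x a≈ x∉)) (proj₁ (in-out⇔ y x a≈ x∉) ∘ Γφ.~-sym {x} {y}) (incident? a (f (rep x)))

    collinear? : ∀ x y → Dec (x Γ₀.~ y)
    collinear? x y = map′ (λ (y∉x , xy≈0) → ∉⇒≉ x y y∉x , ⊥⇒collinear x y (∉⇒≉ x y y∉x) xy≈0)
                          (λ (x≉y , xy) → ≉⇒∉ x y x≉y , collinear⇒⊥ x y xy)
                          (¬? (rep y ∈⟨ rep x ⟩?) ×-dec (rep x ⊥? rep y))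

  module N₀ = Neighbours {_~_ = Γ₀._~_} Γ₀.~-resp-≈ collinear?
  module Nφ = Neighbours {_~_ = Γφ._~_} Γφ.~-resp-≈ adjacent?

  opaque
    α₀≡adj₀ : ∀ {x z} → Proper x → Proper z → N₀.α x z ≡ adj₀ x z
    α₀≡adj₀ {x} {z} px pz = ≡.trans (N₀.α-value (point px) (point pz) ≈ᴹ-refl ≈ᴹ-refl)
      (≡.trans (𝟙-⇔ (λ (x≉z , xz) → ≉⇒∉ (point px) (point pz) x≉z , collinear⇒⊥ (point px) (point pz) xz)
                    (λ (z∉x , xz≈0) → ∉⇒≉ (point px) (point pz) z∉x , ⊥⇒collinear (point px) (point pz)
                        (∉⇒≉ (point px) (point pz) z∉x) xz≈0)
                    (collinear? (point px) (point pz)) (¬? (z ∈⟨ x ⟩?) ×-dec (x ⊥? z)))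
        (𝟙-× (¬? (z ∈⟨ x ⟩?)) (x ⊥? z)))

    degree-N₀ : ∀ x → degree N₀.α (rep x) ≡ degree₀ (rep x)
    degree-N₀ x = ≡.trans (∑-cong h (λ z → 𝟙-guard (proper? z) (λ pz → α₀≡adj₀ (rep-proper x) pz)))
        (degree-adj₀ (rep x))

    common-N₀ : ∀ x y → common N₀.α (rep x) (rep y) ≡ common₀ (rep x) (rep y)
    common-N₀ x y = ≡.trans (∑-cong h (λ z → 𝟙-guard (proper? z) (λ pz → ≡.cong₂ _*_ (α₀≡adj₀ (rep-proper x) pz)
        (α₀≡adj₀ (rep-proper y) pz)))) (common-adj₀ (rep x) (rep y))

    αφ-isAdjacency : IsAdjacency ρ₁ Nφ.α
    αφ-isAdjacency = record
      { α-cong = Nφ.α-cong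
      ; in-in = λ {x} {z} px pz x∈ z∈ → let (⇒ , ⇐) = in-in⇔ (point px) (point pz) x∈ z∈ in
          ≡.trans (Nφ.α-value (point px) (point pz) ≈ᴹ-refl ≈ᴹ-refl) (𝟙-⇔ ⇒ ⇐ (adjacent? (point px) (point pz))
              (¬? (z ∈⟨ x ⟩?)))
      ; out-out = λ {x} {z} px pz x∉ z∉ → let (⇒ , ⇐) = out-out⇔ (point px) (point pz) x∉ z∉ in
          ≡.trans (Nφ.α-value (point px) (point pz) ≈ᴹ-refl ≈ᴹ-refl)
            (≡.trans (𝟙-⇔ ⇒ ⇐ (adjacent? (point px) (point pz)) (¬? (z ∈⟨ x ⟩?) ×-dec (x ⊥? z)))
                (𝟙-× (¬? (z ∈⟨ x ⟩?)) (x ⊥? z)))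
      ; in-out = λ {x} {z} {a} px pz a≈ z∉ → let (⇒ , ⇐) = in-out⇔ (point px) (point pz) a≈ z∉ in
          ≡.trans (Nφ.α-value (point px) (point pz) ≈ᴹ-refl ≈ᴹ-refl) (𝟙-⇔ ⇒ ⇐ (adjacent? (point px) (point pz))
              (incident? a (f z)))
      ; out-in = λ {x} {z} {a} px pz x∉ a≈ → let (⇒ , ⇐) = in-out⇔ (point pz) (point px) a≈ x∉ in
          ≡.trans (Nφ.α-value (point px) (point pz) ≈ᴹ-refl ≈ᴹ-refl)
            (𝟙-⇔ (⇒ ∘ Γφ.~-sym {point px} {point pz}) (Γφ.~-sym {point pz} {point px} ∘ ⇐)
                (adjacent? (point px) (point pz)) (incident? a (f x)))
      }

  -- Comparison with the collinearity graph and the common parameters.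

  module C = Compare ρ₁-isVectorDesign αφ-isAdjacency D₀.ρ₀-isVectorDesign adj₀-isAdjacency

  common-comm : ∀ α x y → common α x y ≡ common α y x
  common-comm α x y = ∑-cong h (λ z → ≡.cong (𝟙 (proper? z) *_) (ℕ.*-comm (α x z) (α y z)))

  private
    U-proper : ∀ {a} → NonZeroⁿ a → Proper (combination a u)
    U-proper {a} na = U-sing (a , ≈ᴹ-refl) , combination≉0 na

    basis-proper : ∀ j → Proper (u j)
    basis-proper j = U-sing (span-basis u j) , basis≉0 u (proj₂ U) j

    x₀ y₀ : Point
    x₀ = point (basis-proper zero)
    y₀ = point (basis-proper (suc zero))

    u₁∉⟨u₀⟩ : ¬ (u (suc zero) ∈⟨ u zero ⟩)
    u₁∉⟨u₀⟩ (μ , e) = F.0≉1 (F.sym (F.trans (coordinates (suc zero)) (F.zeroʳ μ)))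
      where
      δ : Fin n → Coordinates
      δ j i = if does (i Fin.≟ j) then F.1# else F.0#
      coordinates : ∀ i → F._≈_ (δ (suc zero) i) (μ F.* δ zero i)
      coordinates = combination-injective u (proj₂ U) (≈ᴹ-trans (combination-δ u (suc zero)) (≈ᴹ-trans e
        (≈ᴹ-trans (*ₗ-cong F.refl (≈ᴹ-sym (combination-δ u zero))) (≈ᴹ-sym (combination-* μ (δ zero) u)))))

    incident₀ : ∀ {a b} → D₀.ρ₀ a b ≢ 0 → NonZeroⁿ a × NonZeroⁿ b × F._≈_ (a · b) F.0#
    incident₀ {a} {b} ρ≢0 = decidable-stable (D₀.nonzero-perp? a b) (λ ¬p → ρ≢0 (𝟙-no (D₀.nonzero-perp? a b) ¬p))

    nonincident₀ : ∀ {a y} → NonZeroⁿ a → NonZeroⁿ (f y) → D₀.ρ₀ a (f y) ≡ 0 → ¬ (F._≈_ (B (combination a u) y) F.0#)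
    nonincident₀ {a} {y} na nb ρ≡0 p = contradiction
      (≡.trans (≡.sym (𝟙-yes (D₀.nonzero-perp? a (f y)) (na , nb , F.trans (F.sym (B-combination a y)) p))) ρ≡0) λ ()

    z₀ : Point
    z₀ = point (proj₁ (proj₂ ∃-outside))

    z₀∉U : ¬ Span u (rep z₀)
    z₀∉U = proj₂ (proj₂ ∃-outside)

    fz₀≉0 : NonZeroⁿ (f (rep z₀))
    fz₀≉0 = fy≉0 (proj₁ (rep-proper z₀)) z₀∉U

    opaque
      -- A point of U outside the kernel of the functional of `z₀`. The pair shows that `Γ₀` is not
      -- complete and serves as the reference for nonadjacent pairs.
      far : ∃ λ w → ¬ ⊥₀ w z₀
      far = let (a , na , e) = ∃-nonincident D₀.ρ₀-isVectorDesign fz₀≉0 in point (U-proper na) , nonincident₀ na fz₀≉0 e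

    w₀ : Point
    w₀ = proj₁ far

    vertexCount : ∃ λ v → HasCard points v
    vertexCount = proj₁ count , record
      { to = λ x → Inverse.to all (x , tt)
      ; from = λ j → proj₁ (Inverse.from all j)
      ; to-cong = λ {x} {y} e → Inverse.to-cong all {x , tt} {y , tt} e
      ; from-cong = λ {j} {j′} e → Inverse.from-cong all {j} {j′} e
      ; inverse = (λ {j} {x} e → Inverse.inverseˡ all {j} {x , tt} e) , (λ {x} {j} e → Inverse.inverseʳ all {x , tt} {j}
          e)
      }
      where
      module Everything = PointSet {P = λ _ → ⊤} (λ _ _ → tt) (λ _ → yes tt)
      count = Everything.subset-count
      all : HasCard (Subsetoid points (λ _ → ⊤)) (proj₁ count)
      all = Everything.subset-card (proj₂ count)

    -- Reference counts of vectors, hence q - 1 times the parameters, read off from two points of U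
    -- and from the noncollinear pair `w₀`, `z₀`.
    degree-value common-adjacent common-nonadjacent : ℕ
    degree-value = degree₀ (rep x₀)
    common-adjacent = common₀ (rep x₀) (rep y₀)
    common-nonadjacent = common₀ (rep w₀) (rep z₀)

    degree₀-value : ∀ x → degree₀ (rep x) ≡ degree-value
    degree₀-value x = degree₀-const (proj₁ (rep-proper x)) (proj₂ (rep-proper x)) (proj₁ (rep-proper x₀))
        (proj₂ (rep-proper x₀))

    common₀-adjacent : ∀ {x y} → Proper x → Proper y → ¬ (y ∈⟨ x ⟩) → F._≈_ (B x y) F.0# → common₀ x y ≡ common-adjacent
    common₀-adjacent px py y∉x xy≈0 = common₀-collinear-const (proj₁ px) (proj₂ px) (proj₁ (rep-proper x₀))
        (proj₂ (rep-proper x₀))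
      (proj₁ py) (proj₂ py) (proj₁ (rep-proper y₀)) (proj₂ (rep-proper y₀)) xy≈0 (λ x∈y → y∉x (∈⟨⟩-sym (proj₂ px) x∈y))
      (U-perp (span-basis u zero) (span-basis u (suc zero)))
      (λ x∈y → u₁∉⟨u₀⟩ (∈⟨⟩-sym (proj₂ (basis-proper zero)) x∈y))

    common₀-nonadjacent : ∀ {x y} → Proper x → Proper y → ¬ (F._≈_ (B x y) F.0#) → common₀ x y ≡ common-nonadjacent
    common₀-nonadjacent px py xy≉0 = common₀-noncollinear-const (proj₁ px) (proj₂ px) (proj₁ (rep-proper w₀))
        (proj₂ (rep-proper w₀))
      (proj₁ py) (proj₂ py) (proj₁ (rep-proper z₀)) (proj₂ (rep-proper z₀)) xy≉0 (proj₂ far)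

    degreeφ-value : ∀ x → degree Nφ.α (rep x) ≡ degree-value
    degreeφ-value x = ≡.trans (C.degree-≡ (rep-proper x)) (≡.trans (degree-adj₀ (rep x)) (degree₀-value x))

    outside-not-in : ∀ {x y} → Proper y → Span u x → ¬ Span u y → ¬ (y ∈⟨ x ⟩)
    outside-not-in py x∈ y∉ (μ , e) = y∉ (span-resp u (≈ᴹ-sym e) (span-* u μ x∈))

    -- In `Γ₀` the point x is replaced by a point of U that is orthogonal to y if x and y are
    -- adjacent in `Γφ`, and not orthogonal otherwise. Every hyperplane has points of U on it and
    -- off it, so both choices are possible.
    commonφ-cross : ∀ x y {a} → combination a u ≈ᴹ rep x → ¬ Span u (rep y) →
                    (Incident a (f (rep y)) → common Nφ.α (rep x) (rep y) ≡ common-adjacent) ×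
                    (¬ Incident a (f (rep y)) → common Nφ.α (rep x) (rep y) ≡ common-nonadjacent)
    commonφ-cross x y {a} a≈ y∉ = adjacent , nonadjacent
      where
      nb = fy≉0 (proj₁ (rep-proper y)) y∉
      compare : ∀ {a′} (na′ : NonZeroⁿ a′) → ρ₁ a (f (rep y)) ≡ D₀.ρ₀ a′ (f (rep y)) → common Nφ.α (rep x)
          (rep y) ≡ common₀ (combination a′ u) (rep y)
      compare {a′} na′ bit = ≡.trans (C.common-in-out-≡ (rep-proper x) (U-proper na′) (rep-proper y) a≈ ≈ᴹ-refl y∉ bit) (common-adj₀ (combination a′ u) (rep y))
      adjacent : Incident a (f (rep y)) → common Nφ.α (rep x) (rep y) ≡ common-adjacent
      adjacent inc = let (a′ , ρ≢0) = ∃-incident D₀.ρ₀-isVectorDesign nb ; p@(na′ , _ , a′⊥y) = incident₀ ρ≢0 in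
        ≡.trans (compare na′ (≡.trans (𝟙-yes (incident? a (f (rep y))) inc)
            (≡.sym (𝟙-yes (D₀.nonzero-perp? a′ (f (rep y))) p))))
          (common₀-adjacent (U-proper na′) (rep-proper y) (outside-not-in (rep-proper y) (a′ , ≈ᴹ-refl) y∉) (F.trans (B-combination a′ (rep y)) a′⊥y))
      nonadjacent : ¬ Incident a (f (rep y)) → common Nφ.α (rep x) (rep y) ≡ common-nonadjacent
      nonadjacent ¬inc = let (a′ , na′ , ρ≡0) = ∃-nonincident D₀.ρ₀-isVectorDesign nb in
        ≡.trans (compare na′ (≡.trans (𝟙-no (incident? a (f (rep y))) ¬inc) (≡.sym ρ≡0)))
          (common₀-nonadjacent (U-proper na′) (rep-proper y) (nonincident₀ na′ nb ρ≡0))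

    commonφ-adjacent : ∀ x y → x Γφ.~ y → common Nφ.α (rep x) (rep y) ≡ common-adjacent
    commonφ-adjacent x y x~y = go (span? u (rep x)) (span? u (rep y))
      where
      px = rep-proper x
      py = rep-proper y
      go : Dec (Span u (rep x)) → Dec (Span u (rep y)) → common Nφ.α (rep x) (rep y) ≡ common-adjacent
      go (yes x∈) (yes y∈) = ≡.trans (C.common-in-in-≡ px py x∈ y∈ y∉x) (≡.trans (common-adj₀ (rep x) (rep y))
          (common₀-adjacent px py y∉x (U-perp x∈ y∈)))
        where y∉x = proj₁ (in-in⇔ x y x∈ y∈) x~y
      go (no x∉) (no y∉) = ≡.trans (C.common-out-out-≡ px py x∉ y∉) (≡.trans (common-adj₀ (rep x) (rep y))
          (common₀-adjacent px py (proj₁ r) (proj₂ r)))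
        where r = proj₁ (out-out⇔ x y x∉ y∉) x~y
      go (yes (a , a≈)) (no y∉) = proj₁ (commonφ-cross x y {a} a≈ y∉) (proj₁ (in-out⇔ x y {a} a≈ y∉) x~y)
      go (no x∉) (yes (a , a≈)) = ≡.trans (common-comm Nφ.α (rep x) (rep y)) (proj₁ (commonφ-cross y x {a} a≈ x∉) (proj₁ (in-out⇔ y x {a} a≈ x∉) (Γφ.~-sym {x} {y} x~y)))

    commonφ-nonadjacent : ∀ x y → x ≉ y → ¬ (x Γφ.~ y) → common Nφ.α (rep x) (rep y) ≡ common-nonadjacent
    commonφ-nonadjacent x y x≉y x≁y = go (span? u (rep x)) (span? u (rep y))
      where
      px = rep-proper x
      py = rep-proper y
      go : Dec (Span u (rep x)) → Dec (Span u (rep y)) → common Nφ.α (rep x) (rep y) ≡ common-nonadjacent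
      go (yes x∈) (yes y∈) = contradiction (proj₂ (in-in⇔ x y x∈ y∈) (≉⇒∉ x y x≉y)) x≁y
      go (no x∉) (no y∉) = ≡.trans (C.common-out-out-≡ px py x∉ y∉) (≡.trans (common-adj₀ (rep x) (rep y))
        (common₀-nonadjacent px py (λ xy≈0 → x≁y (proj₂ (out-out⇔ x y x∉ y∉) (≉⇒∉ x y x≉y , xy≈0)))))
      go (yes (a , a≈)) (no y∉) = proj₂ (commonφ-cross x y {a} a≈ y∉) (x≁y ∘ proj₂ (in-out⇔ x y {a} a≈ y∉))
      go (no x∉) (yes (a , a≈)) = ≡.trans (common-comm Nφ.α (rep x) (rep y)) (proj₂ (commonφ-cross y x {a} a≈ x∉) (x≁y ∘ Γφ.~-sym {y} {x} ∘ proj₂ (in-out⇔ y x {a} a≈ x∉)))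

    x₀≉y₀ : x₀ ≉ y₀
    x₀≉y₀ = ∉⇒≉ x₀ y₀ u₁∉⟨u₀⟩

    opaque
      -- In `Γ₀` the vectors counted are all representatives of a set of points, so their number is
      -- a multiple of q - 1; the quotient is the parameter for both graphs.
      k₀ : ∃ λ m → degree-value ≡ m * q∸1
      k₀ = let (m , e) = N₀.degree-count x₀ in m , ≡.trans (≡.sym (degree-N₀ x₀)) e

      λ₀ : ∃ λ m → common-adjacent ≡ m * q∸1
      λ₀ = let (m , e) = N₀.common-count x₀ y₀ in m , ≡.trans (≡.sym (common-N₀ x₀ y₀)) e

      μ₀ : ∃ λ m → common-nonadjacent ≡ m * q∸1
      μ₀ = let (m , e) = N₀.common-count w₀ z₀ in m , ≡.trans (≡.sym (common-N₀ w₀ z₀)) e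

    w₀≉z₀ : w₀ ≉ z₀
    w₀≉z₀ w≈z = proj₂ far (reflexive (∈⟨⟩-perp (isotropic (proj₁ (rep-proper z₀))) (≈⇒∈⟨⟩ w₀ z₀ w≈z)))

  Γ₀-stronglyRegular : IsStronglyRegular Γ₀ (proj₁ vertexCount) (proj₁ k₀) (proj₁ λ₀) (proj₁ μ₀)
  Γ₀-stronglyRegular = record
    { order = proj₂ vertexCount
    ; notComplete = λ complete → proj₂ far (collinear⇒⊥ w₀ z₀ (proj₂ (complete w₀ z₀ w₀≉z₀)))
    ; notEdgeless = λ edgeless → edgeless x₀ y₀ (x₀≉y₀ , ⊥⇒collinear x₀ y₀ x₀≉y₀
        (U-perp (span-basis u zero) (span-basis u (suc zero))))
    ; degree = λ x → N₀.degree-card x (≡.trans (degree-N₀ x) (≡.trans (degree₀-value x) (proj₂ k₀)))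
    ; adjacent = λ x y (x≉y , xy) → N₀.common-card x y (≡.trans (common-N₀ x y)
        (≡.trans (common₀-adjacent (rep-proper x) (rep-proper y) (≉⇒∉ x y x≉y) (collinear⇒⊥ x y xy)) (proj₂ λ₀)))
    ; nonadjacent = λ x y x≉y x≁y → N₀.common-card x y (≡.trans (common-N₀ x y)
        (≡.trans (common₀-nonadjacent (rep-proper x) (rep-proper y) (λ xy≈0 → x≁y (x≉y , ⊥⇒collinear x y x≉y xy≈0)))
            (proj₂ μ₀)))
    }

  Γφ-stronglyRegular : IsStronglyRegular Γφ (proj₁ vertexCount) (proj₁ k₀) (proj₁ λ₀) (proj₁ μ₀)
  Γφ-stronglyRegular = record
    { order = proj₂ vertexCount
    -- A point of U off the block that belongs to `z₀` is a vertex not adjacent to `z₀`.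
    ; notComplete = λ complete → let
        (a , na , ρ≡0) = ∃-nonincident ρ₁-isVectorDesign fz₀≉0
        x = point (U-proper na)
        x≉z₀ : x ≉ z₀
        x≉z₀ = ∉⇒≉ x z₀ (outside-not-in (rep-proper z₀) (a , ≈ᴹ-refl) z₀∉U)
        in contradiction (≡.trans (≡.sym (𝟙-yes (incident? a (f (rep z₀))) (proj₁ (in-out⇔ x z₀ ≈ᴹ-refl z₀∉U) (complete x z₀ x≉z₀)))) ρ≡0) λ ()
    ; notEdgeless = λ edgeless → edgeless x₀ y₀ (inside (span⇒on U x₀ (span-basis u zero))
        (span⇒on U y₀ (span-basis u (suc zero))) x₀≉y₀)
    ; degree = λ x → Nφ.degree-card x (≡.trans (degreeφ-value x) (proj₂ k₀))
    ; adjacent = λ x y x~y → Nφ.common-card x y (≡.trans (commonφ-adjacent x y x~y) (proj₂ λ₀))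
    ; nonadjacent = λ x y x≉y x≁y → Nφ.common-card x y (≡.trans (commonφ-nonadjacent x y x≉y x≁y) (proj₂ μ₀))
    }

theorem7p1 : ∀ {c ℓ m ℓm b ℓb i : Level} (𝐏 : PolarSpace c ℓ m ℓm) → let open Geometry 𝐏 in
    ∀ (d : ℕ) → 3 ≤ d → HasRank d →
    (U : Subspace d) → TotallyIsotropic U → IsMaximalSingular (_on U) →
    (𝐃 : SymmetricDesign (pointsOn U) (θ d) (θ (d ∸ 1)) (θ (d ∸ 2)) b ℓb i) →
    (φ : Bijection (hyperplanes U) (SymmetricDesign.Blocks 𝐃)) →
    ∃ λ (v : ℕ) → ∃ λ (k : ℕ) → ∃ λ (λ' : ℕ) → ∃ λ (μ : ℕ) →
    IsStronglyRegular Γ₀ v k λ' μ × IsStronglyRegular (Deformation.Γφ U 𝐃 φ) v k λ' μ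
theorem7p1 𝐏 (suc (suc (suc d))) (s≤s (s≤s (s≤s z≤n))) _ U ti max 𝐃 φ =
  _ , _ , _ , _ , G.Γ₀-stronglyRegular , G.Γφ-stronglyRegular
  where module G = DeformedGraph 𝐏 d U ti max 𝐃 φ
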